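{- For every positive integer $\ell$, every graph $G$ and every $S\subseteq V(G)$: if $G$ has no $S$-outer-rooted model of $\boxplus_\ell$, then $\operatorname{tw}(G,S)\leq 3f_{\boxplus}(6144\ell^4)+1$.
   Context: $\boxplus_\ell$ is the $\ell\times\ell$ grid (vertex set $[\ell]^2$, $(i,j)\sim(i',j')$ iff $|i-i'|+|j-j'|=1$), drawn in the standard way, so its outer-face vertices are those with some coordinate in $\{1,\ell\}$. A model of $H$ in $G$ is a family $(B_x\mid x\in V(H))$ of pairwise disjoint subsets of $V(G)$ such that each $G[B_x]$ is non-empty and connected and for every edge $xy\in E(H)$ there is an edge of $G$ between $B_x$ and $B_y$; a model of the plane graph $\boxplus_\ell$ is $S$-outer-rooted if $B_x\cap S\ne\emptyset$ for every outer-face vertex $x$. $f_{\boxplus}$ is the minimum function such that for every positive integer $\ell$, every graph with no model of $\boxplus_\ell$ has treewidth at most $f_{\boxplus}(\ell)$. A tree decomposition of a graph $H$ is a pair $(T,(W_x\mid x\in V(T)))$ with $T$ a non-null tree and bags $W_x\subseteq V(H)$ such that each edge of $H$ lies in some bag and for each vertex $v$ the set $\{x: v\in W_x\}$ induces a non-empty subtree; its width is $\max_x|W_x|-1$. A tree decomposition of $(G,S)$ is a tree decomposition $\mathcal B$ of some induced subgraph $H$ of $G$ with $S\subseteq V(H)$ such that for every component $C$ of $G-V(H)$ some bag of $\mathcal B$ contains all neighbours of $V(C)$ in $G$. $\operatorname{tw}(G,S)$ is the minimum width of a tree decomposition of $(G,S)$. -}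

module Defs where

open import Data.Nat using (ℕ; zero; suc; _≤_; ∣_-_∣; _∸_)
open import Data.Fin using (Fin; toℕ)
open import Data.Fin.Subset using (Subset; _∈_; _∉_; _⊆_; ∣_∣; Nonempty)
open import Data.Bool using (Bool; true; false)
open import Data.List using (List; []; _∷_; _++_; length)
open import Data.List.Relation.Unary.Linked using (Linked)
open import Data.List.Relation.Unary.Unique.Propositional using (Unique)
open import Data.Product using (Σ; ∃; ∃₂; _×_; _,_)
open import Data.Sum using (_⊎_)
open import Data.Unit using (⊤)
open import Data.Empty using (⊥)
import Data.Nat
import Data.Fin.Subset
open import Relation.Binary.PropositionalEquality using (_≡_; _≢_)
open import Relation.Nullary using (¬_)

record Graph : Set where
  field
    n      : ℕ
    adj    : Fin n → Fin n → Bool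
    sym    : ∀ u v → adj u v ≡ adj v u
    irrefl : ∀ u → adj u u ≡ false

open Graph public

Adj : (G : Graph) → Fin (n G) → Fin (n G) → Set
Adj G u v = adj G u v ≡ true

data Walk (G : Graph) (P : Fin (n G) → Set) : Fin (n G) → Fin (n G) → Set where
  here : ∀ {u} → P u → Walk G P u u
  step : ∀ {u w v} → P u → Adj G u w → Walk G P w v → Walk G P u v

ConnectedSet : (G : Graph) → Subset (n G) → Set
ConnectedSet G B = ∀ u v → u ∈ B → v ∈ B → Walk G (λ x → x ∈ B) u v

record Model (G : Graph) (V : Set) (E : V → V → Set) : Set where
  field
    B         : V → Subset (n G)
    disjoint  : ∀ x y → x ≢ y → ∀ v → v ∈ B x → v ∈ B y → ⊥
    nonempty  : ∀ x → Nonempty (B x)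
    connected : ∀ x → ConnectedSet G (B x)
    edges     : ∀ x y → E x y → ∃₂ λ u v → u ∈ B x × v ∈ B y × Adj G u v

GridV : ℕ → Set
GridV ℓ = Fin ℓ × Fin ℓ

GridE : (ℓ : ℕ) → GridV ℓ → GridV ℓ → Set
GridE ℓ (i , j) (i' , j') = ∣ toℕ i - toℕ i' ∣ Data.Nat.+ ∣ toℕ j - toℕ j' ∣ ≡ 1

Outer : (ℓ : ℕ) → GridV ℓ → Set
Outer ℓ (i , j) = (toℕ i ≡ 0 ⊎ toℕ i ≡ ℓ ∸ 1) ⊎ (toℕ j ≡ 0 ⊎ toℕ j ≡ ℓ ∸ 1)

GridModel : Graph → ℕ → Set
GridModel G ℓ = Model G (GridV ℓ) (GridE ℓ)

OuterRootedGridModel : (G : Graph) → Subset (n G) → ℕ → Set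
OuterRootedGridModel G S ℓ =
  Σ (GridModel G ℓ) λ M → ∀ x → Outer ℓ x →
    ∃ λ v → v ∈ Model.B M x × v ∈ S

Cycle : Graph → Set
Cycle G = ∃ λ x → ∃ λ y → Σ (List (Fin (n G))) λ vs →
  1 ≤ length vs ×
  Unique (x ∷ vs ++ y ∷ []) ×
  Linked (Adj G) (x ∷ vs ++ y ∷ []) ×
  Adj G y x

record Tree : Set where
  field
    graph     : Graph
    nonnull   : 1 ≤ n graph
    connected : ∀ u v → Walk graph (λ _ → ⊤) u v
    acyclic   : ¬ Cycle graph

-- Tree decompositions of the induced subgraph G[X], of width ≤ w
-- (width = max bag size - 1, so width ≤ w iff every bag has ≤ w+1 vertices).

record TreeDecOn (G : Graph) (X : Subset (n G)) (w : ℕ) : Set where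
  field
    T        : Tree
  Node : Set
  Node = Fin (n (Tree.graph T))
  field
    W        : Node → Subset (n G)
    bagsIn   : ∀ t → W t ⊆ X
    edgeCov  : ∀ u v → u ∈ X → v ∈ X → Adj G u v → ∃ λ t → u ∈ W t × v ∈ W t
    vNonempty : ∀ v → v ∈ X → ∃ λ t → v ∈ W t
    vConnected : ∀ v → v ∈ X → ∀ s t → v ∈ W s → v ∈ W t →
                 Walk (Tree.graph T) (λ r → v ∈ W r) s t
    width    : ∀ t → ∣ W t ∣ ≤ suc w

TwAtMost : Graph → ℕ → Set
TwAtMost G k = TreeDecOn G Data.Fin.Subset.⊤ k

-- tw(G,S) ≤ k : a tree decomposition of (G,S) of width ≤ k.
-- The components of G - X are represented by their vertices u ∉ X; the
-- component of u is the set of vertices reachable from u by a walk avoiding X.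
record PairTreeDec (G : Graph) (S : Subset (n G)) (k : ℕ) : Set where
  field
    X      : Subset (n G)
    S⊆X    : S ⊆ X
    dec    : TreeDecOn G X k
  open TreeDecOn dec
  field
    compNbrs : ∀ u → u ∉ X → ∃ λ t →
      ∀ c w → Walk G (λ z → z ∉ X) u c → w ∈ X → Adj G c w → w ∈ W t

TwPairAtMost : (G : Graph) → Subset (n G) → ℕ → Set
TwPairAtMost G S k = PairTreeDec G S k

{-# OPTIONS --safe #-}

-- A haven points, for every vertex set Y of size at most k + 1, to a component of G - Y meeting S.
-- Without one, k + 1 vertices always suffice to break up a component that meets S, and this builds
-- a tree decomposition of (G,S) of width 3k + 1. A graph with a haven has treewidth above k, hence a
-- large grid. If the grid can be cut off from S by fewer than q vertices, take such a cut P
-- closest to the grid: by submodularity no other minimum cut passes beyond P, so a grid vertex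
-- beyond P can be deleted without destroying the haven. Otherwise delete edges outside the grid
-- as long as no cut smaller than q appears. In the end, beyond the closest q-cut only grid edges
-- are left, so the q disjoint paths that Menger's theorem provides from S to a band of rows enter
-- it from above or below, in distinct columns for each side. This gives a grid with a rooted side,
-- which is routed to an outer-rooted grid.

module Submission where

open import Defs
open import Data.Nat using (ℕ; _≤_; _+_; _*_; _^_)
open import Data.Fin.Subset using (Subset)
open import Relation.Nullary using (¬_)
open import Data.Bool using (Bool; true; false)
open import Data.Empty using () renaming (⊥ to Void; ⊥-elim to absurd)
open import Data.Fin using (Fin; zero; suc; toℕ; fromℕ<; combine; remQuot)
open import Data.Fin.Properties using (any?; all?; toℕ<n; toℕ-injective; toℕ-fromℕ<; fromℕ<-toℕ; fromℕ<-cong; toℕ-combine; combine-injective; remQuot-combine; combine-remQuot) renaming (_≟_ to _≟F_; suc-injective to Fin-suc-injective)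
open import Data.Fin.Subset using (_∈_; _∉_; _⊆_; _⊂_; ∣_∣; Nonempty; _∪_; _∩_; _─_; _-_; ⁅_⁆; ∁; ⊤; ⊥)
open import Data.Fin.Subset.Properties
open import Data.List using (List; []; _∷_; _++_; length)
open import Data.List.Relation.Unary.All as All using (All; []; _∷_)
open import Data.List.Relation.Unary.AllPairs using ([]; _∷_)
open import Data.List.Relation.Unary.Linked as Linked using (Linked; []; [-]; _∷_)
open import Data.List.Relation.Unary.Unique.Propositional using (Unique)
open import Data.Nat using (zero; suc; _∸_; _⊔_; _<_; z≤n; s≤s; _≤?_; _<?_) renaming (_≟_ to _≟ℕ_; ∣_-_∣ to dist)
open import Data.Nat.Properties as ℕₚ using (≤-refl; ≤-reflexive; ≤-trans; ≤-antisym; <-≤-trans; ≤-<-trans; <-trans; <-irrefl; <⇒≤; <⇒≱; ≰⇒>; ≮⇒≥; n≤1+n; m≤m+n; m≤n+m; +-mono-≤; +-monoˡ-≤; +-monoʳ-≤; +-comm; +-assoc; +-suc; +-identityʳ; +-cancelʳ-≤; <-cmp; m≤n⇒m<n∨m≡n)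
open import Data.Nat.Solver using (module +-*-Solver)
open import Data.Product using (Σ; ∃; ∃₂; _×_; _,_; proj₁; proj₂)
open import Data.Sum using (_⊎_; inj₁; inj₂; [_,_]′)
open import Data.Unit using (tt) renaming (⊤ to Unit)
open import Data.Vec using ([]; _∷_; tabulate; here; there)
open import Data.Vec.Properties using (lookup∘tabulate; lookup⇒[]=; []=⇒lookup)
open import Function using (_∘_; id; case_of_)
open import Relation.Binary.Definitions using (tri<; tri≈; tri>)
open import Relation.Binary.PropositionalEquality using (_≡_; _≢_; refl; trans; cong; cong₂; subst; subst₂) renaming (sym to ≡-sym)
open import Relation.Nullary using (Dec; yes; no; does; contradiction; ¬?; _×-dec_; _⊎-dec_; _→-dec_)
open import Relation.Nullary.Decidable using (dec-true; decidable-stable; map′)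
import Data.Bool.Properties as Bool

-- Finite sets and paths

-- A graph with large grids may still have small treewidth relative to `S`, namely when its grids
-- are only weakly attached to `S`. This is why havens must point at components meeting `S`, and why
-- a poorly attached grid has to be whittled away without harming the haven. A well attached grid is
-- not enough either: paths from `S` may run through the grid and use edges foreign to it, so their
-- first contacts need not lie in any order along a side. Criticality removes this freedom. The set
-- `S` is minimised together with the edges, because a cut of fewer than q vertices for `S - s`,
-- enlarged by `s`, is what provides a cut of at most q vertices for `S`. Origin of the constants:
-- the routing consumes a grid of height 2ℓ and width 4ℓ with a rooted top row. Entries from above
-- and below are mixed, so q = 8ℓ paths are needed for 4ℓ from one side. Among q + 1 bands of 2ℓ
-- rows one misses the cut, and the deletion of a vertex needs a core that survives the removal of
-- 3q + 1 vertices. Both demands on the side of the grid are at most quadratic in ℓ and lie below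
-- 6144ℓ^4.

does⇒ : ∀ {A : Set} (d : Dec A) → does d ≡ true → A
does⇒ (yes a) _ = a

abstract
  fromDec : ∀ {m} {P : Fin m → Set} → (∀ x → Dec (P x)) → Subset m
  fromDec P? = tabulate (λ x → does (P? x))

  ∈-fromDec⁺ : ∀ {m} {P : Fin m → Set} (P? : ∀ x → Dec (P x)) {x} → P x → x ∈ fromDec P?
  ∈-fromDec⁺ P? {x} px = lookup⇒[]= x _ (trans (lookup∘tabulate _ x) (dec-true (P? x) px))

  ∈-fromDec⁻ : ∀ {m} {P : Fin m → Set} (P? : ∀ x → Dec (P x)) {x} → x ∈ fromDec P? → P x
  ∈-fromDec⁻ P? {x} x∈ = does⇒ (P? x) (trans (≡-sym (lookup∘tabulate _ x)) ([]=⇒lookup x∈))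

-- The hypotheses bound the multiplicity of each element in `p`, `q` by that in `r`, `s`, so the
-- inequality holds coordinate by coordinate. Unions, disjoint parts and the submodularity of
-- boundaries in `uncross` are all instances.
∣∣-submodular : ∀ {m} (p q r s : Subset m) →
  (∀ {x} → x ∈ p → x ∈ q → x ∈ r × x ∈ s) →
  (∀ {x} → x ∈ p ⊎ x ∈ q → x ∈ r ⊎ x ∈ s) →
  ∣ p ∣ + ∣ q ∣ ≤ ∣ r ∣ + ∣ s ∣
∣∣-submodular [] [] [] [] meet join = z≤n
∣∣-submodular (a ∷ p) (b ∷ q) (c ∷ r) (d ∷ s) meet join =
  subst₂ _≤_ (≡-sym (split a b p q)) (≡-sym (split c d r s))
    (+-mono-≤ (heads a b c d (λ { refl refl → let (x , y) = meet here here in head x , head y })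
                             (λ e → [ inj₁ ∘ head , inj₂ ∘ head ]′ (join (unhead e))))
              (∣∣-submodular p q r s
                (λ x y → let (u , v) = meet (there x) (there y) in drop-there u , drop-there v)
                (λ e → [ inj₁ ∘ drop-there , inj₂ ∘ drop-there ]′ (join (sucs e)))))
  where
  bit : Bool → ℕ
  bit true  = 1
  bit false = 0
  card-∷ : ∀ {m} b (p : Subset m) → ∣ b ∷ p ∣ ≡ bit b + ∣ p ∣
  card-∷ true  p = refl
  card-∷ false p = refl
  interchange : ∀ a b c d → (a + b) + (c + d) ≡ (a + c) + (b + d)
  interchange a b c d rewrite +-assoc a b (c + d) | +-assoc a c (b + d)
    | ≡-sym (+-assoc b c d) | ≡-sym (+-assoc c b d) | +-comm b c = refl
  split : ∀ {m} a b (p q : Subset m) →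
    ∣ a ∷ p ∣ + ∣ b ∷ q ∣ ≡ (bit a + bit b) + (∣ p ∣ + ∣ q ∣)
  split a b p q rewrite card-∷ a p | card-∷ b q = interchange (bit a) (∣ p ∣) (bit b) (∣ q ∣)
  head : ∀ {m b} {p : Subset m} → zero ∈ b ∷ p → b ≡ true
  head here = refl
  unhead : ∀ {m b c} {p q : Subset m} → b ≡ true ⊎ c ≡ true → zero ∈ b ∷ p ⊎ zero ∈ c ∷ q
  unhead (inj₁ refl) = inj₁ here
  unhead (inj₂ refl) = inj₂ here
  sucs : ∀ {m b c} {p q : Subset m} {x} → x ∈ p ⊎ x ∈ q → suc x ∈ b ∷ p ⊎ suc x ∈ c ∷ q
  sucs (inj₁ x) = inj₁ (there x)
  sucs (inj₂ x) = inj₂ (there x)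
  heads : ∀ a b c d → (a ≡ true → b ≡ true → c ≡ true × d ≡ true) →
    (a ≡ true ⊎ b ≡ true → c ≡ true ⊎ d ≡ true) → bit a + bit b ≤ bit c + bit d
  heads true true c d f g with refl , refl ← f refl refl = ≤-refl
  heads true false c d f g with g (inj₁ refl)
  ... | inj₁ refl = s≤s z≤n
  ... | inj₂ refl = m≤n+m 1 (bit c)
  heads false true c d f g with g (inj₂ refl)
  ... | inj₁ refl = s≤s z≤n
  ... | inj₂ refl = m≤n+m 1 (bit c)
  heads false false c d f g = z≤n

∣p∣+∣⊥∣≡∣p∣ : ∀ {m} (p : Subset m) → ∣ p ∣ + ∣ ⊥ {m} ∣ ≡ ∣ p ∣
∣p∣+∣⊥∣≡∣p∣ {m} p = trans (cong (∣ p ∣ +_) (∣⊥∣≡0 m)) (+-identityʳ _)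

∣p∪q∣≤∣p∣+∣q∣ : ∀ {m} (p q : Subset m) → ∣ p ∪ q ∣ ≤ ∣ p ∣ + ∣ q ∣
∣p∪q∣≤∣p∣+∣q∣ {m} p q = subst (λ t → t ≤ ∣ p ∣ + ∣ q ∣) (∣p∣+∣⊥∣≡∣p∣ (p ∪ q))
  (∣∣-submodular (p ∪ q) ⊥ p q (λ _ x∈⊥ → contradiction x∈⊥ ∉⊥)
    (λ { (inj₁ x) → x∈p∪q⁻ p q x ; (inj₂ x) → contradiction x ∉⊥ }))

∣p∪⁅x⁆∣≤1+∣p∣ : ∀ {m} (p : Subset m) x → ∣ p ∪ ⁅ x ⁆ ∣ ≤ suc ∣ p ∣
∣p∪⁅x⁆∣≤1+∣p∣ p x = ≤-trans (∣p∪q∣≤∣p∣+∣q∣ p ⁅ x ⁆)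
  (≤-reflexive (trans (cong (∣ p ∣ +_) (∣⁅x⁆∣≡1 x)) (+-comm _ 1)))

∣∣-disjoint : ∀ {m} (p q r : Subset m) → p ⊆ r → q ⊆ r → (∀ {x} → x ∈ p → x ∉ q) →
  ∣ p ∣ + ∣ q ∣ ≤ ∣ r ∣
∣∣-disjoint p q r p⊆r q⊆r disj = subst (λ t → ∣ p ∣ + ∣ q ∣ ≤ t) (∣p∣+∣⊥∣≡∣p∣ r)
  (∣∣-submodular p q r ⊥ (λ x y → contradiction y (disj x)) (λ { (inj₁ x) → inj₁ (p⊆r x) ; (inj₂ x) → inj₁ (q⊆r x) }))

x∈p∪⁅x⁆ : ∀ {m} (p : Subset m) x → x ∈ p ∪ ⁅ x ⁆
x∈p∪⁅x⁆ p x = q⊆p∪q p ⁅ x ⁆ (x∈⁅x⁆ x)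

∈-∪⁅⁆⁻ : ∀ {m} (p : Subset m) x {y} → y ∈ p ∪ ⁅ x ⁆ → y ∈ p ⊎ y ≡ x
∈-∪⁅⁆⁻ p x y∈ with x∈p∪q⁻ p ⁅ x ⁆ y∈
... | inj₁ y∈p = inj₁ y∈p
... | inj₂ y∈x = inj₂ (x∈⁅y⁆⇒x≡y x y∈x)

∈-─⁻ : ∀ {m} (p q : Subset m) {x} → x ∈ p ─ q → x ∈ p × x ∉ q
∈-─⁻ (true ∷ p) (true ∷ q) {zero} ()
∈-─⁻ (true ∷ p) (false ∷ q) {zero} here = here , λ ()
∈-─⁻ (false ∷ p) (true ∷ q) {zero} ()
∈-─⁻ (false ∷ p) (false ∷ q) {zero} ()
∈-─⁻ (a ∷ p) (b ∷ q) {suc x} (there x∈) =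
  let (u , v) = ∈-─⁻ p q x∈ in there u , v ∘ drop-there

∈--⁻ : ∀ {m} (p : Subset m) y {x} → x ∈ p - y → x ∈ p × x ≢ y
∈--⁻ p y x∈ = let (u , v) = ∈-─⁻ p ⁅ y ⁆ x∈ in u , λ { refl → v (x∈⁅x⁆ y) }

injective⇒≤∣∣ : ∀ {k m} (X : Subset m) (f : Fin k → Fin m) → (∀ i → f i ∈ X) →
  (∀ {i j} → f i ≡ f j → i ≡ j) → k ≤ ∣ X ∣
injective⇒≤∣∣ {zero} X f f∈ inj = z≤n
injective⇒≤∣∣ {suc k} X f f∈ inj =
  ≤-<-trans (injective⇒≤∣∣ (X - f zero) (f ∘ suc)
              (λ i → x∈p∧x≢y⇒x∈p-y (f∈ (suc i)) (λ e → case inj e of λ ()))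
              (λ e → Fin-suc-injective (inj e)))
            (x∈p⇒∣p-x∣<∣p∣ (f∈ zero))

-- If `x` were missed, `f` would inject `Fin k` into `X - x`, which has fewer than `k` elements.
∣X∣≤k⇒surjective : ∀ {k m} (X : Subset m) (f : Fin k → Fin m) → (∀ i → f i ∈ X) →
  (∀ {i j} → f i ≡ f j → i ≡ j) → ∣ X ∣ ≤ k → ∀ {x} → x ∈ X → ∃ λ i → f i ≡ x
∣X∣≤k⇒surjective X f f∈ inj X≤k {x} x∈X with any? (λ i → f i ≟F x)
... | yes p = p
... | no ¬p = contradiction X≤k (<⇒≱ (≤-<-trans
        (injective⇒≤∣∣ (X - x) f (λ i → x∈p∧x≢y⇒x∈p-y (f∈ i) (λ e → ¬p (i , e))) inj)
        (x∈p⇒∣p-x∣<∣p∣ x∈X)))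

-- The graph of `Walk` is replaced by a bare relation, so that one set of lemmas serves the given
-- graph, its subgraphs and the trees of decompositions.
data Path {m} (R : Fin m → Fin m → Set) (P : Fin m → Set) : Fin m → Fin m → Set where
  here : ∀ {u} → P u → Path R P u u
  step : ∀ {u w v} → P u → R u w → Path R P w v → Path R P u v

module _ {m} {R : Fin m → Fin m → Set} where

  path-start : ∀ {P u v} → Path R P u v → P u
  path-start (here p) = p
  path-start (step p _ _) = p

  path-end : ∀ {P u v} → Path R P u v → P v
  path-end (here p) = p
  path-end (step _ _ w) = path-end w

  infixr 5 _◅◅_

  _◅◅_ : ∀ {P u v w} → Path R P u v → Path R P v w → Path R P u w
  here _ ◅◅ q = q
  step p e r ◅◅ q = step p e (r ◅◅ q)

  path-rev : ∀ {P} → (∀ {x y} → R x y → R y x) → ∀ {u v} → Path R P u v → Path R P v u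
  path-rev rs (here p) = here p
  path-rev rs (step p e w) = path-rev rs w ◅◅ step (path-start w) (rs e) (here p)

  path-map : ∀ {R' : Fin m → Fin m → Set} {P Q : Fin m → Set} → (∀ {x y} → P x → P y → R x y → R' x y) →
    (∀ {x} → P x → Q x) → ∀ {u v} → Path R P u v → Path R' Q u v
  path-map f g (here p) = here (g p)
  path-map f g (step p e w) = step (g p) (f p (path-start w) e) (path-map f g w)

  path-weaken : ∀ {P Q} → (∀ {x} → P x → Q x) → ∀ {u v} → Path R P u v → Path R Q u v
  path-weaken = path-map (λ _ _ → id)

  path-within : ∀ {P} {T : Fin m → Set} → (∀ {x y} → T x → R x y → P y → T y) →
    ∀ {u v} → T u → Path R P u v → Path R (λ x → P x × T x) u v
  path-within cl t (here p) = here (p , t)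
  path-within cl t (step p e w) = step (p , t) e (path-within cl (cl t e (path-start w)) w)

  -- The usual way to bound a component: choose an invariant `T` that no edge between undeleted
  -- vertices leaves, and carry it along a path.
  path-stays : ∀ {P} {T : Fin m → Set} → (∀ {x y} → T x → R x y → P y → T y) →
    ∀ {u v} → T u → Path R P u v → T v
  path-stays cl t w = proj₂ (path-end (path-within cl t w))

  record Exit (P T : Fin m → Set) (u v : Fin m) : Set where
    constructor exit
    field
      {last first} : Fin m
      before  : Path R (λ x → P x × T x) u last
      edge    : R last first
      outside : ¬ T first
      after   : Path R P first v

  path-exit : ∀ {P T : Fin m → Set} → (∀ x → Dec (T x)) →
    ∀ {u v} → T u → ¬ T v → Path R P u v → Exit P T u v
  path-exit T? t ¬t (here _) = contradiction t ¬t
  path-exit T? t ¬t (step {w = w} p e r) with T? w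
  ... | no ¬tw = exit (here (p , t)) e ¬tw r
  ... | yes tw = let exit b e' o a = path-exit T? tw ¬t r in exit (step (p , t) e b) e' o a

module _ {m} {R : Fin m → Fin m → Set} (R? : ∀ x y → Dec (R x y))
         {P : Fin m → Set} (P? : ∀ x → Dec (P x)) (u : Fin m) where

  private
    Closed : Subset m → Set
    Closed X = ∀ x y → x ∈ X → R x y → P y → y ∈ X

    -- The fuel measures the vertices still missing. Each round adds one, so running out with a
    -- vertex left to add would give more than `m` of them.
    grow : ∀ k (X : Subset m) → m ≤ k + ∣ X ∣ → (∀ x → x ∈ X → Path R P u x) →
      ∃ λ Y → (∀ x → x ∈ X → x ∈ Y) × Closed Y × (∀ x → x ∈ Y → Path R P u x)
    grow k X bound sound with any? (λ x → any? (λ y → (x ∈? X) ×-dec (R? x y ×-dec (P? y ×-dec ¬? (y ∈? X)))))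
    ... | no none = X , (λ _ z → z) ,
          (λ x y x∈ e p → decidable-stable (y ∈? X) (λ y∉ → none (x , y , x∈ , e , p , y∉))) , sound
    ... | yes (x , y , x∈ , e , p , y∉) = go k bound
      where
      X' = X ∪ ⁅ y ⁆
      bigger : suc ∣ X ∣ ≤ ∣ X' ∣
      bigger = p⊂q⇒∣p∣<∣q∣ (p⊆p∪q ⁅ y ⁆ , y , x∈p∪⁅x⁆ X y , y∉)
      go : ∀ k → m ≤ k + ∣ X ∣ → _
      go zero bound = contradiction (≤-trans bigger (∣p∣≤n X')) (<⇒≱ (s≤s bound))
      go (suc k) bound =
        let (Y , X'⊆Y , rest) = grow k X' (≤-trans bound (≤-trans (≤-reflexive (≡-sym (+-suc k _))) (+-monoʳ-≤ k bigger)))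
              (λ z z∈ → case ∈-∪⁅⁆⁻ X y z∈ of λ where
                (inj₁ z∈X) → sound z z∈X
                (inj₂ refl) → sound x x∈ ◅◅ step (path-end (sound x x∈)) e (here p))
        in Y , (λ z z∈ → X'⊆Y z (p⊆p∪q ⁅ y ⁆ z∈)) , rest

    abstract
      reach-spec : ∃ λ Y → (∀ x → x ∈ Y → Path R P u x) × (∀ x → Path R P u x → x ∈ Y)
      reach-spec with P? u
      ... | no ¬p = ⊥ , (λ _ x → contradiction x ∉⊥) , (λ _ w → contradiction (path-start w) ¬p)
      ... | yes p =
        let (Y , ⊆Y , closed , sound) = grow m ⁅ u ⁆ (m≤m+n m _) (λ _ x∈ → case x∈⁅y⁆⇒x≡y u x∈ of λ { refl → here p })
        in Y , sound , λ x w → path-stays (λ {y} {z} → closed y z) (⊆Y u (x∈⁅x⁆ u)) w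

  reach : Subset m
  reach = proj₁ reach-spec

  reach⁻ : ∀ {x} → x ∈ reach → Path R P u x
  reach⁻ = proj₁ (proj₂ reach-spec) _

  reach⁺ : ∀ {x} → Path R P u x → x ∈ reach
  reach⁺ = proj₂ (proj₂ reach-spec) _

  path? : ∀ x → Dec (Path R P u x)
  path? x = map′ reach⁻ reach⁺ (x ∈? reach)

  reach-path : (∀ {x y} → R x y → R y x) → ∀ {x} → x ∈ reach → Path R (_∈ reach) u x
  reach-path R-sym x∈ = path-weaken proj₂
    (path-within {P = P} {T = _∈ reach} (λ y∈ e p → reach⁺ (reach⁻ y∈ ◅◅ step (path-end (reach⁻ y∈)) e (here p)))
      (reach⁺ (here (path-start (reach⁻ x∈)))) (reach⁻ x∈))

enumerate : ∀ {m} k (X : Subset m) → k ≤ ∣ X ∣ →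
  ∃ λ (f : Fin k → Fin m) → (∀ i → f i ∈ X) × (∀ i j → toℕ i < toℕ j → toℕ (f i) < toℕ (f j))
enumerate zero X _ = (λ ()) , (λ ()) , λ ()
enumerate (suc k) (true ∷ X) (s≤s k≤) with enumerate k X k≤
... | f , f∈ , mono = f' , f'∈ , mono'
  where
  f' : Fin (suc k) → Fin _
  f' zero = zero
  f' (suc i) = suc (f i)
  f'∈ : ∀ i → f' i ∈ true ∷ X
  f'∈ zero = here
  f'∈ (suc i) = there (f∈ i)
  mono' : ∀ i j → toℕ i < toℕ j → toℕ (f' i) < toℕ (f' j)
  mono' zero (suc j) _ = s≤s z≤n
  mono' (suc i) (suc j) (s≤s i<j) = s≤s (mono i j i<j)
enumerate (suc k) (false ∷ X) k≤ = let (f , f∈ , mono) = enumerate (suc k) X k≤ in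
  suc ∘ f , there ∘ f∈ , λ i j i<j → s≤s (mono i j i<j)

increasing⇒injective : ∀ {k m} {f : Fin k → Fin m} → (∀ i j → toℕ i < toℕ j → toℕ (f i) < toℕ (f j)) →
  ∀ {i j} → f i ≡ f j → i ≡ j
increasing⇒injective mono {i} {j} eq with <-cmp (toℕ i) (toℕ j)
... | tri≈ _ i≡j _ = toℕ-injective i≡j
... | tri< i<j _ _ = contradiction (mono i j i<j) (<-irrefl (cong toℕ eq))
... | tri> _ _ j<i = contradiction (mono j i j<i) (<-irrefl (cong toℕ (≡-sym eq)))

-- Havens against tree decompositions

-- With the vertex type fixed and edges given by a decidable relation, every subgraph lives on the
-- same `Fin m`; vertex sets, grids and paths carry over without renaming when edges are deleted.
record SGraph (m : ℕ) : Set₁ where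
  field
    E     : Fin m → Fin m → Set
    E?    : ∀ x y → Dec (E x y)
    E-sym : ∀ {x y} → E x y → E y x
    E-irr : ∀ {x} → ¬ E x x

open SGraph

does-⇔ : ∀ {A B : Set} (a : Dec A) (b : Dec B) → (A → B) → (B → A) → does a ≡ does b
does-⇔ (yes a) b f g = ≡-sym (dec-true b (f a))
does-⇔ (no ¬a) (yes b) f g = contradiction (g b) ¬a
does-⇔ (no ¬a) (no ¬b) f g = refl

toGraph : ∀ {m} → SGraph m → Graph
toGraph {m} g = record
  { n      = m
  ; adj    = λ u v → does (E? g u v)
  ; sym    = λ u v → does-⇔ (E? g u v) (E? g v u) (E-sym g) (E-sym g)
  ; irrefl = λ u → case-no (E? g u u) (E-irr g)
  }
  where
  case-no : ∀ {A : Set} (d : Dec A) → ¬ A → does d ≡ false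
  case-no (yes a) ¬a = contradiction a ¬a
  case-no (no _) _ = refl

fromGraph : (G : Graph) → SGraph (n G)
fromGraph G = record
  { E     = Adj G
  ; E?    = λ u v → adj G u v Bool.≟ true
  ; E-sym = λ {u} {v} e → trans (sym G v u) e
  ; E-irr = λ {u} e → case trans (≡-sym (irrefl G u)) e of λ ()
  }

fromWalk : ∀ {G P u v} → Walk G P u v → Path (Adj G) P u v
fromWalk (here p) = here p
fromWalk (step p e w) = step p e (fromWalk w)

toWalk : ∀ {G P u v} → Path (Adj G) P u v → Walk G P u v
toWalk (here p) = here p
toWalk (step p e w) = step p e (toWalk w)

-- rep Y names the component of g - Y that the haven assigns to Y: the one containing this vertex of S.
record Haven {m} (g : SGraph m) (S : Subset m) (K : ℕ) : Set where
  field
    rep   : ∀ Y → ∣ Y ∣ ≤ K → Fin m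
    rep∈S : ∀ Y Y≤K → rep Y Y≤K ∈ S
    rep∉  : ∀ Y Y≤K → rep Y Y≤K ∉ Y
    touch : ∀ Y₁ Y₂ Y₁≤K Y₂≤K → ∃₂ λ x y →
            Path (E g) (_∉ Y₁) (rep Y₁ Y₁≤K) x × Path (E g) (_∉ Y₂) (rep Y₂ Y₂≤K) y × (x ≡ y ⊎ E g x y)

module _ {m} {R : Fin m → Fin m → Set} where

  data Chain : Fin m → Fin m → List (Fin m) → Set where
    [_]  : ∀ u → Chain u u (u ∷ [])
    _∷_ : ∀ {u w v l} → R u w → Chain w v (w ∷ l) → Chain u v (u ∷ w ∷ l)

  private
    Simple : (Fin m → Set) → Fin m → Fin m → Set
    Simple P u v = ∃ λ l → Chain u v (u ∷ l) × Unique (u ∷ l) × All P (u ∷ l)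

    -- Loop erasure: if `u` already occurs on the simple path, the tail from that occurrence is a
    -- simple path from `u`; otherwise `u` can be put in front.
    visits : ∀ {P w v l} u → Chain w v (w ∷ l) → Unique (w ∷ l) → All P (w ∷ l) →
      Simple P u v ⊎ All (u ≢_) (w ∷ l)
    visits {w = w} u c un ps with u ≟F w
    visits u c un ps | yes refl = inj₁ (_ , c , un , ps)
    visits u [ _ ] un ps | no u≢w = inj₂ (u≢w ∷ [])
    visits u (e ∷ c) (_ ∷ un) (_ ∷ ps) | no u≢w with visits u c un ps
    ... | inj₁ s = inj₁ s
    ... | inj₂ a = inj₂ (u≢w ∷ a)

    simplify : ∀ {P u v} → Path R P u v → Simple P u v
    simplify (here p) = [] , [ _ ] , ([] ∷ []) , (p ∷ [])
    simplify (step {u = u} p e w) with simplify w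
    ... | l , c , un , ps with visits u c un ps
    ...   | inj₁ s = s
    ...   | inj₂ a = _ , e ∷ c , a ∷ un , p ∷ ps

    chain-linked : ∀ {u v l} → Chain u v l → Linked R l
    chain-linked [ _ ] = [-]
    chain-linked (e ∷ c) = e ∷ chain-linked c

    snoc : ∀ {u v l} → Chain u v l → ∃ λ vs → l ≡ vs ++ v ∷ []
    snoc [ u ] = [] , refl
    snoc (_∷_ {u = u} e c) = let (vs , eq) = snoc c in u ∷ vs , cong (u ∷_) eq

    chain-snoc : ∀ {u v l} → Chain u v l → u ≢ v → ∃ λ vs → l ≡ vs ++ v ∷ [] × 1 ≤ length vs
    chain-snoc [ _ ] u≢u = contradiction refl u≢u
    chain-snoc (_∷_ {u = u} e c) _ = let (vs , eq) = snoc c in u ∷ vs , cong (u ∷_) eq , s≤s z≤n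

  module _ (R-irr : ∀ {x} → ¬ R x x) where

    two-neighbours⇒cycle : ∀ {x a b} → R x a → R b x → a ≢ b → Path R (_≢ x) a b →
      ∃ λ x → ∃ λ y → Σ (List (Fin m)) λ vs →
        1 ≤ length vs × Unique (x ∷ vs ++ y ∷ []) × Linked R (x ∷ vs ++ y ∷ []) × R y x
    two-neighbours⇒cycle {x} {a} {b} xa bx a≢b w with simplify w
    ... | l , c , un , avoid with chain-snoc c a≢b
    ...   | vs , eq , long = x , b , vs , long ,
              subst (λ l → Unique (x ∷ l)) eq (All.map (λ p e → p (≡-sym e)) avoid ∷ un) ,
              subst (λ l → Linked R (x ∷ l)) eq (xa ∷ chain-linked c) , bx

  -- The tail is treated before `u` is compared with `t`, so the visit to `t` that is found is the
  -- last one and the rest avoids `t`.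
  leave : ∀ {P} t {u b} → b ≢ t → Path R P u b →
    Path R (λ x → P x × x ≢ t) u b ⊎ ∃ λ t' → R t t' × Path R (λ x → P x × x ≢ t) t' b
  leave t b≢t (here p) = inj₁ (here (p , b≢t))
  leave t b≢t (step {u = u} p e w) with leave t b≢t w
  ... | inj₂ found = inj₂ found
  ... | inj₁ w' with u ≟F t
  ...   | yes refl = inj₂ (_ , e , w')
  ...   | no u≢t = inj₁ (step (p , u≢t) e w')

  first-step : ∀ {P t b} → b ≢ t → Path R P t b → ∃ λ t' → R t t' × Path R (λ x → P x × x ≢ t) t' b
  first-step {t = t} b≢t w with leave t b≢t w
  ... | inj₁ w' = contradiction refl (proj₂ (path-start w'))
  ... | inj₂ found = found

-- From a bag W t the haven points into one component of T - t; moving to the neighbour of t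
-- in that component strictly shrinks the component.
module _ {m} (g : SGraph m) {S : Subset m} {k : ℕ}
         (td : TreeDecOn (toGraph g) ⊤ k) (h : Haven g S (suc k)) where
  open TreeDecOn td
  open Haven h

  private
    TG = Tree.graph T
    R = Adj TG
    open SGraph (fromGraph TG) using () renaming (E? to R?; E-sym to R-sym; E-irr to R-irr)

    ¬two-neighbours : ∀ {x a b} → R x a → R x b → a ≢ b → ¬ Path R (_≢ x) a b
    ¬two-neighbours {x} {a} {b} xa xb a≢b w =
      Tree.acyclic T (two-neighbours⇒cycle (λ {x} → R-irr {x}) xa (R-sym {x} {b} xb) a≢b w)

    Points : Node → Node → Set
    Points t t' = R t t' × (∀ x s → Path (E g) (_∉ W t) (rep (W t) (width t)) x → x ∈ W s → Path R (_≢ t) t' s)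

    -- The bags of a vertex outside `W t` form a subtree avoiding `t`, hence lie on one side of `t`.
    -- Adjacent vertices share a bag, so the side is the same along the whole component.
    point : ∀ t → ∃ (Points t)
    point t =
      let (b , r∈b) = vNonempty r ∈⊤
          (t' , e , w) = first-step (λ b≡t → r∉ (subst (λ i → r ∈ W i) b≡t r∈b)) (fromWalk (Tree.connected T t b))
          base : ∀ s → r ∈ W s → Path R (_≢ t) t' s
          base s r∈s = path-weaken proj₂ w ◅◅
            path-weaken (λ { i refl → r∉ i }) (fromWalk (vConnected r ∈⊤ b s r∈b r∈s))
      in t' , e , λ x s p x∈s → path-stays {T = λ x → ∀ s → x ∈ W s → Path R (_≢ t) t' s}
        (λ {x} {y} tx xy y∉ s y∈s →
          let (q , x∈q , y∈q) = edgeCov x y ∈⊤ ∈⊤ (dec-true (E? g x y) xy)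
          in tx q x∈q ◅◅ path-weaken (λ { i refl → y∉ i }) (fromWalk (vConnected y ∈⊤ q s y∈q y∈s)))
        base p s x∈s
      where
      r = rep (W t) (width t)
      r∉ = rep∉ (W t) (width t)

    common-bag : ∀ t t' → ∃ λ s → ∃₂ λ x y → Path (E g) (_∉ W t) (rep (W t) (width t)) x ×
      Path (E g) (_∉ W t') (rep (W t') (width t')) y × x ∈ W s × y ∈ W s
    common-bag t t' with touch (W t) (W t') (width t) (width t')
    ... | x , y , p , q , inj₁ refl = let (s , x∈) = vNonempty x ∈⊤ in s , x , x , p , q , x∈ , x∈
    ... | x , y , p , q , inj₂ e = let (s , x∈ , y∈) = edgeCov x y ∈⊤ ∈⊤ (dec-true (E? g x y) e) in
      s , x , y , p , q , x∈ , y∈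

    avoid? : ∀ (t x : Node) → Dec (x ≢ t)
    avoid? t x = ¬? (x ≟F t)

    side : Node → Node → Subset (n TG)
    side t t' = reach R? (avoid? t) t'

    descend : ∀ fuel t t' → Points t t' → ∣ side t t' ∣ < fuel → Void
    descend (suc fuel) t t' (e , pts) bound with point t'
    ... | t'' , e' , pts' with t'' ≟F t
    -- If `t` and `t'` point at each other, their touching components share a bag `s`, which is
    -- reached from `t'` avoiding `t` and from `t` avoiding `t'`. Together with the edge between
    -- them this closes a cycle.
    ...   | yes refl =
      let (s , x , y , p , q , x∈ , y∈) = common-bag t t'
          w  = pts x s p x∈
          w' = pts' y s q y∈
          (r , e'' , w'') = first-step (path-end w') w
      in ¬two-neighbours e'' (R-sym {t} {t'} e) (proj₁ (path-start w''))
           (path-weaken proj₂ w'' ◅◅ path-rev (λ {x} {y} → R-sym {x} {y}) w')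
    ...   | no t''≢t = descend fuel t' t'' (e' , pts') (<-≤-trans (p⊂q⇒∣p∣<∣q∣ shrink) (ℕₚ.≤-pred bound))
      where
      t'≢t : t' ≢ t
      t'≢t refl = R-irr {t} e
      -- The branch entered at `t''` cannot come back to `t`: both are neighbours of `t'`, and a
      -- connection avoiding `t'` would close a cycle.
      avoids-t : ∀ {s} → Path R (_≢ t') t'' s → Path R (λ x → x ≢ t' × (Path R (_≢ t') t'' x × x ≢ t)) t'' s
      avoids-t w = path-within
        (λ {x} {y} (px , _) xy y≢ → (px ◅◅ step (path-end px) xy (here y≢)) ,
           λ { refl → ¬two-neighbours e' (R-sym {t} {t'} e) t''≢t (px ◅◅ step (path-end px) xy (here y≢)) })
        (here (path-start w) , t''≢t) w
      shrink : side t' t'' ⊂ side t t'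
      shrink = (λ s∈ → reach⁺ R? (avoid? t) t' (step t'≢t e' (path-weaken (proj₂ ∘ proj₂) (avoids-t (reach⁻ R? (avoid? t') t'' s∈)))))
             , t' , reach⁺ R? (avoid? t) t' (here t'≢t)
             , λ t'∈ → path-end (reach⁻ R? (avoid? t') t'' t'∈) refl

  haven⇒¬treedec : Void
  haven⇒¬treedec with Tree.nonnull T
  ... | 1≤n = let t = fromℕ< 1≤n ; (t' , pt) = point t in descend _ t t' pt ≤-refl

-- Building a tree decomposition

-- Each extension of a decomposition hangs one new bag on an old one. Growing a tree by leaves makes
-- its connectivity an induction and reduces acyclicity to the uniqueness and the order of parents.
data PTree : ℕ → Set where
  root : PTree 1
  leaf : ∀ {N} → PTree N → Fin N → PTree (suc N)

data Parent : ∀ {N} → PTree N → Fin N → Fin N → Set where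
  new : ∀ {N} {T : PTree N} {p} → Parent (leaf T p) zero (suc p)
  old : ∀ {N} {T : PTree N} {q c p} → Parent T c p → Parent (leaf T q) (suc c) (suc p)

parent? : ∀ {N} (T : PTree N) c p → Dec (Parent T c p)
parent? root c p = no λ ()
parent? (leaf T q) zero zero = no λ ()
parent? (leaf T q) zero (suc p) with q ≟F p
... | yes refl = yes new
... | no q≢p = no λ { new → q≢p refl }
parent? (leaf T q) (suc c) zero = no λ ()
parent? (leaf T q) (suc c) (suc p) = map′ old (λ { (old x) → x }) (parent? T c p)

parent-unique : ∀ {N} {T : PTree N} {c p q} → Parent T c p → Parent T c q → p ≡ q
parent-unique new new = refl
parent-unique (old a) (old b) = cong suc (parent-unique a b)

parent-< : ∀ {N} {T : PTree N} {c p} → Parent T c p → toℕ c < toℕ p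
parent-< new = s≤s z≤n
parent-< (old a) = s≤s (parent-< a)

treeGraph : ∀ {N} → PTree N → SGraph N
treeGraph T = record
  { E     = λ c d → Parent T c d ⊎ Parent T d c
  ; E?    = λ c d → parent? T c d ⊎-dec parent? T d c
  ; E-sym = [ inj₂ , inj₁ ]′
  ; E-irr = [ (λ p → <-irrefl refl (parent-< p)) , (λ p → <-irrefl refl (parent-< p)) ]′
  }

-- Parents have larger indices, so a path that once steps down keeps descending to its last vertex.
module _ {N} (T : PTree N) where
  private
    R = E (treeGraph T)

    init-All : ∀ l {y} {P : Fin N → Set} → All P (l ++ y ∷ []) → P y × All P l
    init-All [] (p ∷ _) = p , []
    init-All (_ ∷ l) (p ∷ ps) = let (q , qs) = init-All l ps in q , p ∷ qs

    -- Membership of the parent in `l` is phrased through `All`, because it is played against the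
    -- inequalities that `Unique` supplies in that form.
    ParentIn : Fin N → List (Fin N) → Set₁
    ParentIn y l = ∃ λ p → Parent T y p × (∀ {Q : Fin N → Set} → All Q l → Q p)

    descending : ∀ {a b} l {y} → Parent T b a → Linked R (b ∷ l ++ y ∷ []) →
      Unique (a ∷ b ∷ l ++ y ∷ []) → toℕ y < toℕ a × ParentIn y (b ∷ l)
    descending {b = b} [] ba (inj₂ yb ∷ _) _ = <-trans (parent-< yb) (parent-< ba) , b , yb , λ { (q ∷ _) → q }
    descending [] ba (inj₁ by ∷ _) ((_ ∷ a≢y ∷ _) ∷ _) = contradiction (parent-unique ba by) a≢y
    descending (c ∷ l) ba (inj₁ bc ∷ _) ((_ ∷ a≢c ∷ _) ∷ _) = contradiction (parent-unique ba bc) a≢c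
    descending (c ∷ l) ba (inj₂ cb ∷ lk) (_ ∷ un) =
      let (y<b , p , yp , f) = descending l cb lk un
      in <-trans y<b (parent-< ba) , p , yp , λ { (_ ∷ qs) → f qs }

    ascending : ∀ {b} l {y} → Linked R (b ∷ l ++ y ∷ []) → Unique (b ∷ l ++ y ∷ []) →
      toℕ b < toℕ y ⊎ ParentIn y (b ∷ l)
    ascending [] (inj₁ by ∷ _) _ = inj₁ (parent-< by)
    ascending {b} [] (inj₂ yb ∷ _) _ = inj₂ (b , yb , λ { (q ∷ _) → q })
    ascending (c ∷ l) (inj₁ bc ∷ lk) (_ ∷ un) with ascending l lk un
    ... | inj₁ c<y = inj₁ (<-trans (parent-< bc) c<y)
    ... | inj₂ (p , yp , f) = inj₂ (p , yp , λ { (_ ∷ qs) → f qs })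
    ascending (c ∷ l) (inj₂ cb ∷ lk) un@(_ ∷ _) =
      let (_ , p , yp , f) = descending l cb lk un in inj₂ (p , yp , λ { (_ ∷ qs) → f qs })

  -- For each direction of the first and the closing edge, either the indices would increase around
  -- the cycle or some vertex would have two different parents.
  parents-acyclic : ∀ {x y} vs → 1 ≤ length vs → Unique (x ∷ vs ++ y ∷ []) →
    Linked R (x ∷ vs ++ y ∷ []) → ¬ R y x
  parents-acyclic (c ∷ vs) _ un@(x≢ ∷ _) (inj₂ cx ∷ lk) yx with descending vs cx lk un | yx
  ... | y<x , p , yp , f | inj₁ y→x = f (proj₂ (init-All (c ∷ vs) x≢)) (parent-unique y→x yp)
  ... | y<x , _ | inj₂ x→y = <-irrefl refl (<-trans y<x (parent-< x→y))
  parents-acyclic (c ∷ vs) _ (_ ∷ (c≢ ∷ _)) (inj₁ xc ∷ lk) (inj₂ xy) =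
    proj₁ (init-All vs c≢) (parent-unique xc xy)
  parents-acyclic (c ∷ vs) _ (x≢ ∷ un) (inj₁ xc ∷ lk) (inj₁ yx) with ascending vs lk un
  ... | inj₁ c<y = <-irrefl refl (<-trans (<-trans (parent-< xc) c<y) (parent-< yx))
  ... | inj₂ (p , yp , f) = f (proj₂ (init-All (c ∷ vs) x≢)) (parent-unique yx yp)

module _ {N} {T : PTree N} {p : Fin N} where
  old-edge : ∀ {c d} → E (treeGraph T) c d → E (treeGraph (leaf T p)) (suc c) (suc d)
  old-edge = [ inj₁ ∘ old , inj₂ ∘ old ]′

  old-path : ∀ {P Q} → (∀ {x} → P x → Q (suc x)) → ∀ {c d} →
    Path (E (treeGraph T)) P c d → Path (E (treeGraph (leaf T p))) Q (suc c) (suc d)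
  old-path f (here q) = here (f q)
  old-path f (step q e w) = step (f q) (old-edge e) (old-path f w)

treeConnected : ∀ {N} (T : PTree N) c d → Path (E (treeGraph T)) (λ _ → Unit) c d
treeConnected root zero zero = here tt
treeConnected (leaf T p) zero zero = here tt
treeConnected (leaf T p) zero (suc d) = step tt (inj₁ new) (old-path (λ _ → tt) (treeConnected T p d))
treeConnected (leaf T p) (suc c) zero = old-path (λ _ → tt) (treeConnected T c p) ◅◅ step tt (inj₂ new) (here tt)
treeConnected (leaf T p) (suc c) (suc d) = old-path (λ _ → tt) (treeConnected T c d)

fromAdj : ∀ {m} (g : SGraph m) {x y} → Adj (toGraph g) x y → E g x y
fromAdj g {x} {y} = does⇒ (E? g x y)

toAdj : ∀ {m} (g : SGraph m) {x y} → E g x y → Adj (toGraph g) x y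
toAdj g {x} {y} = dec-true (E? g x y)

tree : ∀ {N} → PTree N → Tree
tree T = record
  { graph     = toGraph (treeGraph T)
  ; nonnull   = nonnull T
  ; connected = λ u v → toWalk (path-map (λ _ _ → toAdj (treeGraph T)) id (treeConnected T u v))
  ; acyclic   = λ (x , y , vs , long , un , lk , yx) →
      parents-acyclic T vs long un (Linked.map (fromAdj (treeGraph T)) lk) (fromAdj (treeGraph T) yx)
  }
  where
  nonnull : ∀ {N} → PTree N → 1 ≤ N
  nonnull root = s≤s z≤n
  nonnull (leaf _ _) = s≤s z≤n

-- Extending a partial decomposition

module _ {m} (g : SGraph m) where
  boundary? : ∀ (X : Subset m) u w → Dec (w ∈ X × ∃ λ c → Path (E g) (_∉ X) u c × E g c w)
  boundary? X u w = (w ∈? X) ×-dec any? (λ c → path? (E? g) (λ z → ¬? (z ∈? X)) u c ×-dec E? g c w)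

  boundary : Subset m → Fin m → Subset m
  boundary X u = fromDec (boundary? X u)

  -- The vertices outside `A` are not removed but isolated, which keeps the vertex type.
  restrict : Subset m → SGraph m
  restrict A = record
    { E     = λ x y → E g x y × x ∈ A × y ∈ A
    ; E?    = λ x y → E? g x y ×-dec ((x ∈? A) ×-dec (y ∈? A))
    ; E-sym = λ (e , x , y) → E-sym g e , y , x
    ; E-irr = λ (e , _) → E-irr g e
    }

module _ {m} (g : SGraph m) (S : Subset m) (k : ℕ) where

  -- Only components meeting `S` need a small boundary, since only they are decomposed further; any
  -- other component just has to attach to a bag. A boundary of at most 2k + 1 vertices and k + 1
  -- new ones make a bag of at most 3k + 2, that is, width 3k + 1.
  record PartialDec : Set where
    field
      X          : Subset m
      {N}        : ℕ
      T          : PTree N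
      W          : Fin N → Subset m
      bagsIn     : ∀ t → W t ⊆ X
      edgeCov    : ∀ u v → u ∈ X → v ∈ X → E g u v → ∃ λ t → u ∈ W t × v ∈ W t
      vNonempty  : ∀ v → v ∈ X → ∃ λ t → v ∈ W t
      vConnected : ∀ v → v ∈ X → ∀ s t → v ∈ W s → v ∈ W t → Path (E (treeGraph T)) (λ r → v ∈ W r) s t
      width      : ∀ t → ∣ W t ∣ ≤ (k + suc k) + suc k
      attached   : ∀ u → u ∉ X → ∃ λ t → boundary g X u ⊆ W t
      small      : ∀ s → s ∈ S → s ∉ X → ∣ boundary g X s ∣ ≤ k + suc k

  open PartialDec

  initial : PartialDec
  initial = record
    { X = ⊥ ; T = root ; W = λ _ → ⊥
    ; bagsIn = λ _ x → x
    ; edgeCov = λ u v u∈ _ _ → contradiction u∈ ∉⊥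
    ; vNonempty = λ v v∈ → contradiction v∈ ∉⊥
    ; vConnected = λ v v∈ → contradiction v∈ ∉⊥
    ; width = λ _ → subst (λ t → t ≤ (k + suc k) + suc k) (≡-sym (∣⊥∣≡0 m)) z≤n
    ; attached = λ u _ → zero , λ w∈ → contradiction (proj₁ (∈-fromDec⁻ (boundary? g ⊥ u) w∈)) ∉⊥
    ; small = λ s _ _ → ≤-trans (p⊆q⇒∣p∣≤∣q∣ (λ w∈ → proj₁ (∈-fromDec⁻ (boundary? g ⊥ s) w∈)))
                                (subst (λ t → t ≤ k + suc k) (≡-sym (∣⊥∣≡0 m)) z≤n)
    }

  module Step (P : PartialDec) (s : Fin m) (s∈S : s ∈ S) (s∉X : s ∉ X P) where
    private
      out? : ∀ (Y : Subset m) x → Dec (x ∉ Y)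
      out? Y x = ¬? (x ∈? Y)

      D = reach (E? g) (out? (X P)) s
      R = boundary g (X P) s
      G' = restrict g (D ∪ R)

      D⁻ : ∀ {x} → x ∈ D → Path (E g) (_∉ X P) s x
      D⁻ = reach⁻ (E? g) (out? (X P)) s
      D⁺ : ∀ {x} → Path (E g) (_∉ X P) s x → x ∈ D
      D⁺ = reach⁺ (E? g) (out? (X P)) s
      D∉X : ∀ {x} → x ∈ D → x ∉ X P
      D∉X x∈ = path-end (D⁻ x∈)
      s∈D : s ∈ D
      s∈D = D⁺ (here s∉X)
      D-closed : ∀ {x y} → x ∈ D → E g x y → y ∉ X P → y ∈ D
      D-closed x∈ e y∉ = D⁺ (D⁻ x∈ ◅◅ step (D∉X x∈) e (here y∉))
      R⁻ : ∀ {w} → w ∈ R → w ∈ X P × ∃ λ c → c ∈ D × E g c w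
      R⁻ w∈ = let (w∈X , c , p , e) = ∈-fromDec⁻ (boundary? g (X P) s) w∈ in w∈X , c , D⁺ p , e
      R⁺ : ∀ {w c} → w ∈ X P → c ∈ D → E g c w → w ∈ R
      R⁺ w∈ c∈ e = ∈-fromDec⁺ (boundary? g (X P) s) (w∈ , _ , D⁻ c∈ , e)
      ∈D∪ : ∀ {x} → x ∈ D → x ∈ D ∪ R
      ∈D∪ = p⊆p∪q R
      ∈∪R : ∀ {x} → x ∈ R → x ∈ D ∪ R
      ∈∪R = q⊆p∪q D R

      U : Subset m → Fin m → Subset m
      U Y s' = reach (E? G') (out? Y) s'

      -- If Y is not bad, every component of G' - Y meeting S keeps a small boundary and loses part of D;
      -- if all Y are bad, the witnesses form a haven, as each vertex of R has a neighbour in D.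
      Bad : Subset m → Set
      Bad Y = ∃ λ s' → s' ∈ S × s' ∈ D ∪ R × s' ∉ Y × (suc k ≤ ∣ R ∩ U Y s' ∣ ⊎ D ⊆ U Y s')

      bad? : ∀ Y → Dec (Bad Y)
      bad? Y = any? λ s' → (s' ∈? S) ×-dec ((s' ∈? (D ∪ R)) ×-dec (out? Y s' ×-dec
        ((suc k ≤? ∣ R ∩ U Y s' ∣) ⊎-dec (D ⊆? U Y s'))))

      nonempty-if-large : ∀ (p : Subset m) → suc k ≤ ∣ p ∣ → Nonempty p
      nonempty-if-large p large with nonempty? p
      ... | yes ne = ne
      ... | no ¬ne = contradiction (subst (suc k ≤_) (trans (cong ∣_∣ (Empty-unique ¬ne)) (∣⊥∣≡0 m)) large) λ ()

      haven : (∀ Y → ∣ Y ∣ ≤ suc k → Bad Y) → Haven G' S (suc k)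
      haven bad = record
        { rep = λ Y b → proj₁ (bad Y b)
        ; rep∈S = λ Y b → proj₁ (proj₂ (bad Y b))
        ; rep∉ = λ Y b → proj₁ (proj₂ (proj₂ (proj₂ (bad Y b))))
        ; touch = touch
        }
        where
        Touch : Subset m → Fin m → Subset m → Fin m → Set
        Touch Y₁ s₁ Y₂ s₂ = ∃₂ λ x y → Path (E G') (_∉ Y₁) s₁ x × Path (E G') (_∉ Y₂) s₂ y × (x ≡ y ⊎ E G' x y)
        U⁻ : ∀ Y s' {x} → x ∈ U Y s' → Path (E G') (_∉ Y) s' x
        U⁻ Y s' = reach⁻ (E? G') (out? Y) s'
        mixed : ∀ Y₁ s₁ Y₂ s₂ → suc k ≤ ∣ R ∩ U Y₁ s₁ ∣ → D ⊆ U Y₂ s₂ → Touch Y₁ s₁ Y₂ s₂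
        mixed Y₁ s₁ Y₂ s₂ large D⊆ =
          let (r , r∈) = nonempty-if-large _ large
              (r∈R , r∈U) = x∈p∩q⁻ R (U Y₁ s₁) r∈
              (_ , c , c∈D , e) = R⁻ r∈R
          in r , c , U⁻ Y₁ s₁ r∈U , U⁻ Y₂ s₂ (D⊆ c∈D) , inj₂ (E-sym g e , ∈∪R r∈R , ∈D∪ c∈D)
        touch : ∀ Y₁ Y₂ b₁ b₂ → Touch Y₁ (proj₁ (bad Y₁ b₁)) Y₂ (proj₁ (bad Y₂ b₂))
        touch Y₁ Y₂ b₁ b₂ with bad Y₁ b₁ | bad Y₂ b₂
        ... | s₁ , _ , _ , _ , inj₂ D⊆₁ | s₂ , _ , _ , _ , inj₂ D⊆₂ =
          s , s , U⁻ Y₁ s₁ (D⊆₁ s∈D) , U⁻ Y₂ s₂ (D⊆₂ s∈D) , inj₁ refl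
        ... | s₁ , _ , _ , _ , inj₁ large | s₂ , _ , _ , _ , inj₂ D⊆ = mixed Y₁ s₁ Y₂ s₂ large D⊆
        ... | s₁ , _ , _ , _ , inj₂ D⊆ | s₂ , _ , _ , _ , inj₁ large =
          let (x , y , p , q , e) = mixed Y₂ s₂ Y₁ s₁ large D⊆
          in y , x , q , p , [ (λ eq → inj₁ (≡-sym eq)) , inj₂ ∘ E-sym G' ]′ e
        ... | s₁ , _ , _ , _ , inj₁ large₁ | s₂ , _ , _ , _ , inj₁ large₂
          with nonempty? (U Y₁ s₁ ∩ U Y₂ s₂)
        ...   | yes (x , x∈) = let (x∈₁ , x∈₂) = x∈p∩q⁻ _ _ x∈ in x , x , U⁻ Y₁ s₁ x∈₁ , U⁻ Y₂ s₂ x∈₂ , inj₁ refl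
        -- Each of the two components contains k + 1 of the at most 2k + 1 vertices of `R`, so they
        -- cannot be disjoint.
        ...   | no disjoint = contradiction (small P s s∈S s∉X) (<⇒≱ (≤-trans (+-mono-≤ large₁ large₂)
                (∣∣-disjoint (R ∩ U Y₁ s₁) (R ∩ U Y₂ s₂) R (p∩q⊆p R _) (p∩q⊆p R _)
                  (λ x∈₁ x∈₂ → disjoint (_ , x∈p∩q⁺ (proj₂ (x∈p∩q⁻ R _ x∈₁) , proj₂ (x∈p∩q⁻ R _ x∈₂)))))))

      module Extend (Y : Subset m) (Y≤ : ∣ Y ∣ ≤ suc k) (good : ¬ Bad Y) where
        X' = X P ∪ (Y ∩ D)
        W₀ = R ∪ (Y ∩ D)
        t₀ = proj₁ (attached P s s∉X)
        T' = leaf (T P) t₀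
        W' : Fin (suc (N P)) → Subset m
        W' zero = W₀
        W' (suc t) = W P t

        X'⁻ : ∀ {x} → x ∈ X' → x ∈ X P ⊎ (x ∈ Y × x ∈ D)
        X'⁻ x∈ = [ inj₁ , inj₂ ∘ x∈p∩q⁻ Y D ]′ (x∈p∪q⁻ (X P) (Y ∩ D) x∈)
        X⊆X' : ∀ {x} → x ∈ X P → x ∈ X'
        X⊆X' = p⊆p∪q (Y ∩ D)
        YD⊆X' : ∀ {x} → x ∈ Y → x ∈ D → x ∈ X'
        YD⊆X' y d = q⊆p∪q (X P) (Y ∩ D) (x∈p∩q⁺ (y , d))
        R⊆W₀ : ∀ {x} → x ∈ R → x ∈ W₀
        R⊆W₀ = p⊆p∪q (Y ∩ D)
        YD⊆W₀ : ∀ {x} → x ∈ Y → x ∈ D → x ∈ W₀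
        YD⊆W₀ y d = q⊆p∪q R (Y ∩ D) (x∈p∩q⁺ (y , d))

        bags : ∀ t → W' t ⊆ X'
        bags zero x∈ with x∈p∪q⁻ R (Y ∩ D) x∈
        ... | inj₁ r = X⊆X' (proj₁ (R⁻ r))
        ... | inj₂ yd = q⊆p∪q (X P) (Y ∩ D) yd
        bags (suc t) x∈ = X⊆X' (bagsIn P t x∈)

        edges : ∀ u v → u ∈ X' → v ∈ X' → E g u v → ∃ λ t → u ∈ W' t × v ∈ W' t
        edges u v u∈ v∈ e with X'⁻ u∈ | X'⁻ v∈
        ... | inj₁ a | inj₁ b = let (t , p , q) = edgeCov P u v a b e in suc t , p , q
        ... | inj₁ a | inj₂ (y , d) = zero , R⊆W₀ (R⁺ a d (E-sym g e)) , YD⊆W₀ y d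
        ... | inj₂ (y , d) | inj₁ b = zero , YD⊆W₀ y d , R⊆W₀ (R⁺ b d e)
        ... | inj₂ (y , d) | inj₂ (y' , d') = zero , YD⊆W₀ y d , YD⊆W₀ y' d'

        occurs : ∀ v → v ∈ X' → ∃ λ t → v ∈ W' t
        occurs v v∈ with X'⁻ v∈
        ... | inj₁ a = let (t , p) = vNonempty P v a in suc t , p
        ... | inj₂ (y , d) = zero , YD⊆W₀ y d

        -- A vertex of the new bag that occurs in an old bag is not in `D`, so it belongs to `R`,
        -- and `t₀` was chosen with all of `R` in its bag.
        from-new : ∀ v i → v ∈ W₀ → v ∈ W P i → Path (E (treeGraph T')) (λ r → v ∈ W' r) zero (suc i)
        from-new v i v∈ v∈i with x∈p∪q⁻ R (Y ∩ D) v∈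
        ... | inj₁ r = step v∈ (inj₁ new) (old-path id
                (vConnected P v (bagsIn P i v∈i) t₀ i (proj₂ (attached P s s∉X) r) v∈i))
        ... | inj₂ yd = contradiction (bagsIn P i v∈i) (D∉X (proj₂ (x∈p∩q⁻ Y D yd)))

        connects : ∀ v → v ∈ X' → ∀ a b → v ∈ W' a → v ∈ W' b → Path (E (treeGraph T')) (λ r → v ∈ W' r) a b
        connects v _ zero zero p q = here p
        connects v _ zero (suc b) p q = from-new v b p q
        connects v _ (suc a) zero p q = path-rev (λ {x} {y} → E-sym (treeGraph T')) (from-new v a q p)
        connects v _ (suc a) (suc b) p q = old-path id (vConnected P v (bagsIn P a p) a b p q)

        narrow : ∀ t → ∣ W' t ∣ ≤ (k + suc k) + suc k
        narrow zero = ≤-trans (∣p∪q∣≤∣p∣+∣q∣ R (Y ∩ D))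
          (+-mono-≤ (small P s s∈S s∉X) (≤-trans (∣p∩q∣≤∣p∣ Y D) Y≤))
        narrow (suc t) = width P t

        X'-path : ∀ {u c} → Path (E g) (_∉ X') u c → Path (E g) (_∉ X P) u c
        X'-path = path-weaken (λ x∉ x∈ → x∉ (X⊆X' x∈))

        boundary-elsewhere : ∀ u → u ∉ X' → u ∉ D → boundary g X' u ⊆ boundary g (X P) u
        boundary-elsewhere u u∉X' u∉D w∈ with ∈-fromDec⁻ (boundary? g X' u) w∈
        ... | w∈X' , c , p , e with X'⁻ w∈X'
        ...   | inj₁ w∈X = ∈-fromDec⁺ (boundary? g (X P) u) (w∈X , c , X'-path p , e)
        ...   | inj₂ (_ , w∈D) = contradiction
                (path-stays {P = _∉ X P} {T = _∈ D} D-closed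
                  (D-closed w∈D (E-sym g e) (path-end (X'-path p)))
                  (path-rev (E-sym g) (X'-path p)))
                u∉D

        inside-D : ∀ {u c} → u ∈ D → Path (E g) (_∉ X') u c → Path (E g) (λ x → x ∉ X' × x ∈ D) u c
        inside-D = path-within (λ x∈ e y∉ → D-closed x∈ e (λ y∈ → y∉ (X⊆X' y∈)))

        boundary-inside : ∀ u → u ∈ D → boundary g X' u ⊆ W₀
        boundary-inside u u∈D w∈ with ∈-fromDec⁻ (boundary? g X' u) w∈
        ... | w∈X' , c , p , e with X'⁻ w∈X'
        ...   | inj₁ w∈X = R⊆W₀ (R⁺ w∈X (proj₂ (path-end (inside-D u∈D p))) e)
        ...   | inj₂ (y , d) = YD⊆W₀ y d

        -- Here the choice of `Y` pays off: when `Y` is not bad, at most k vertices of `R` and k + 1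
        -- of `Y` remain, which restores the bound 2k + 1.
        boundary-rooted : ∀ s' → s' ∈ D → s' ∉ Y → boundary g X' s' ⊆ (R ∩ U Y s') ∪ Y
        boundary-rooted s' s'∈D s'∉Y {w} w∈ with w ∈? Y
        ... | yes w∈Y = q⊆p∪q (R ∩ U Y s') Y w∈Y
        ... | no w∉Y with ∈-fromDec⁻ (boundary? g X' s') w∈
        ...   | w∈X' , c , p , e with X'⁻ w∈X'
        ...     | inj₂ (w∈Y , _) = contradiction w∈Y w∉Y
        ...     | inj₁ w∈X =
          let p' = inside-D s'∈D p
              w∈R = R⁺ w∈X (proj₂ (path-end p')) e
              q = path-map {P = λ x → x ∉ X' × x ∈ D} {Q = _∉ Y} (λ (_ , x∈) (_ , y∈) e → e , ∈D∪ x∈ , ∈D∪ y∈)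
                    (λ (x∉ , x∈) x∈Y → x∉ (YD⊆X' x∈Y x∈)) p'
          in p⊆p∪q Y (x∈p∩q⁺ (w∈R , reach⁺ (E? G') (out? Y) s'
               (q ◅◅ step (path-end q) (e , ∈D∪ (proj₂ (path-end p')) , ∈∪R w∈R) (here w∉Y))))

        attach : ∀ u → u ∉ X' → ∃ λ t → boundary g X' u ⊆ W' t
        attach u u∉ with u ∈? D
        ... | yes u∈D = zero , boundary-inside u u∈D
        ... | no u∉D = let (t , sub) = attached P u (λ u∈ → u∉ (X⊆X' u∈)) in
          suc t , λ w∈ → sub (boundary-elsewhere u u∉ u∉D w∈)

        smaller : ∀ s' → s' ∈ S → s' ∉ X' → ∣ boundary g X' s' ∣ ≤ k + suc k
        smaller s' s'∈S s'∉ with s' ∈? D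
        ... | no s'∉D = ≤-trans (p⊆q⇒∣p∣≤∣q∣ (boundary-elsewhere s' s'∉ s'∉D))
                          (small P s' s'∈S (λ s'∈ → s'∉ (X⊆X' s'∈)))
        ... | yes s'∈D = ≤-trans (p⊆q⇒∣p∣≤∣q∣ (boundary-rooted s' s'∈D s'∉Y))
                (≤-trans (∣p∪q∣≤∣p∣+∣q∣ (R ∩ U Y s') Y) (+-mono-≤ few Y≤))
          where
          s'∉Y : s' ∉ Y
          s'∉Y y = s'∉ (YD⊆X' y s'∈D)
          few : ∣ R ∩ U Y s' ∣ ≤ k
          few = ℕₚ.≤-pred (≰⇒> (λ large → good (s' , s'∈S , ∈D∪ s'∈D , s'∉Y , inj₁ large)))

        extended : PartialDec
        extended = record
          { X = X' ; T = T' ; W = W' ; bagsIn = bags ; edgeCov = edges ; vNonempty = occurs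
          ; vConnected = connects ; width = narrow ; attached = attach ; small = smaller }

        -- The second alternative in `Bad` exists for this. If `Y` missed `D`, the component of `s`
        -- in `G'` minus `Y` would contain the connected set `D`, and `Y` would be bad. So every
        -- extension enlarges `X`.
        hits : Nonempty (Y ∩ D)
        hits with nonempty? (Y ∩ D)
        ... | yes ne = ne
        ... | no ¬ne = contradiction (s , s∈S , ∈D∪ s∈D , disjoint s∈D , inj₂ (λ {x} → covers {x})) good
          where
          disjoint : ∀ {x} → x ∈ D → x ∉ Y
          disjoint x∈D x∈Y = ¬ne (_ , x∈p∩q⁺ (x∈Y , x∈D))
          covers : D ⊆ U Y s
          covers x∈ = reach⁺ (E? G') (out? Y) s
            (path-map {P = λ x → x ∉ X P × x ∈ D} {Q = _∉ Y} (λ (_ , x∈) (_ , y∈) e → e , ∈D∪ x∈ , ∈D∪ y∈)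
              (λ (_ , x∈) → disjoint x∈) (path-within D-closed s∈D (D⁻ x∈)))

        progress : ∣ X P ∣ < ∣ X' ∣
        progress = let (x , x∈) = hits ; (x∈Y , x∈D) = x∈p∩q⁻ Y D x∈ in
          p⊂q⇒∣p∣<∣q∣ (X⊆X' , x , YD⊆X' x∈Y x∈D , D∉X x∈D)

    next : (∀ A → ¬ Haven (restrict g A) S (suc k)) → ∃ λ P' → ∣ X P ∣ < ∣ X P' ∣
    next no-haven with anySubset? (λ Y → (∣ Y ∣ ≤? suc k) ×-dec ¬? (bad? Y))
    ... | yes (Y , Y≤ , good) = Extend.extended Y Y≤ good , Extend.progress Y Y≤ good
    ... | no none = contradiction
            (haven (λ Y Y≤ → decidable-stable (bad? Y) (λ good → none (Y , Y≤ , good)))) (no-haven (D ∪ R))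

  complete : (∀ A → ¬ Haven (restrict g A) S (suc k)) → ∃ λ P → S ⊆ X P
  complete no-haven = go m initial (m≤m+n m _)
    where
    go : ∀ fuel P → m ≤ fuel + ∣ X P ∣ → ∃ λ P → S ⊆ X P
    go fuel P bound with any? (λ s → (s ∈? S) ×-dec ¬? (s ∈? X P))
    ... | no none = P , λ {x} x∈ → decidable-stable (x ∈? X P) (λ x∉ → none (x , x∈ , x∉))
    ... | yes (s , s∈S , s∉X) with Step.next P s s∈S s∉X no-haven | fuel
    ...   | P' , more | zero = contradiction (≤-trans more (∣p∣≤n (X P'))) (<⇒≱ (s≤s bound))
    ...   | P' , more | suc fuel' =
      go fuel' P' (≤-trans bound (≤-trans (≤-reflexive (≡-sym (+-suc fuel' _))) (+-monoʳ-≤ fuel' more)))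

no-haven⇒pairTreeDec : ∀ (G : Graph) (S : Subset (n G)) k →
  (∀ A → ¬ Haven (restrict (fromGraph G) A) S (suc k)) → PairTreeDec G S (3 * k + 1)
no-haven⇒pairTreeDec G S k no-haven with complete (fromGraph G) S k no-haven
... | P , S⊆X = record
  { X = X ; S⊆X = S⊆X
  ; dec = record
    { T = tree T ; W = W ; bagsIn = bagsIn
    ; edgeCov = edgeCov ; vNonempty = vNonempty
    ; vConnected = λ v v∈ s t p q → toWalk (path-map (λ _ _ → toAdj (treeGraph T)) id (vConnected v v∈ s t p q))
    ; width = λ t → ≤-trans (width t) (≤-reflexive bound) }
  ; compNbrs = λ u u∉ → let (t , sub) = attached u u∉ in
      t , λ c w p w∈ e → sub (∈-fromDec⁺ (boundary? (fromGraph G) X u) (w∈ , c , fromWalk p , e))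
  }
  where
  open PartialDec P
  open +-*-Solver
  bound : (k + suc k) + suc k ≡ suc (3 * k + 1)
  bound = solve 1 (λ k → (k :+ (con 1 :+ k)) :+ (con 1 :+ k) := con 1 :+ (con 3 :* k :+ con 1)) refl k

-- Grids and their cores

-- Values outside the h × w range of IsRect are junk.
record RectData (m : ℕ) : Set where
  field
    B : ℕ → ℕ → Subset m
    right₁ right₂ down₁ down₂ : ℕ → ℕ → Fin m

record IsRect {m} (g : SGraph m) (D : RectData m) (h w : ℕ) : Set where
  open RectData D
  field
    disjoint  : ∀ {y x y' x' v} → y < h → x < w → y' < h → x' < w → v ∈ B y x → v ∈ B y' x' → y ≡ y' × x ≡ x'
    nonempty  : ∀ {y x} → y < h → x < w → Nonempty (B y x)
    connected : ∀ {y x u v} → y < h → x < w → u ∈ B y x → v ∈ B y x → Path (E g) (_∈ B y x) u v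
    rightward : ∀ {y x} → y < h → suc x < w →
                right₁ y x ∈ B y x × right₂ y x ∈ B y (suc x) × E g (right₁ y x) (right₂ y x)
    downward  : ∀ {y x} → suc y < h → x < w →
                down₁ y x ∈ B y x × down₂ y x ∈ B (suc y) x × E g (down₁ y x) (down₂ y x)

-- Connectivity of a set of cells, kept apart from the vertices: strips and hooks are checked by
-- coordinates alone, and `joined-path` turns the result into paths of the graph.
data Joined (P : ℕ → ℕ → Set) : ℕ → ℕ → ℕ → ℕ → Set where
  stay  : ∀ {y x} → P y x → Joined P y x y x
  right : ∀ {y x} → P y x → P y (suc x) → Joined P y x y (suc x)
  down  : ∀ {y x} → P y x → P (suc y) x → Joined P y x (suc y) x
  back  : ∀ {y x y' x'} → Joined P y x y' x' → Joined P y' x' y x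
  via   : ∀ {y x y' x' y'' x''} → Joined P y x y' x' → Joined P y' x' y'' x'' → Joined P y x y'' x''

row-joined : ∀ {P : ℕ → ℕ → Set} {y} a b → a ≤ b → (∀ x → a ≤ x → x ≤ b → P y x) → Joined P y a y b
row-joined zero zero _ p = stay (p zero z≤n z≤n)
row-joined a (suc b) a≤ p with m≤n⇒m<n∨m≡n a≤
... | inj₂ refl = stay (p (suc b) ≤-refl ≤-refl)
... | inj₁ (s≤s a≤b) = via (row-joined a b a≤b (λ x l u → p x l (≤-trans u (n≤1+n b))))
                           (right (p b a≤b (n≤1+n b)) (p (suc b) a≤ ≤-refl))

column-joined : ∀ {P : ℕ → ℕ → Set} {x} a b → a ≤ b → (∀ y → a ≤ y → y ≤ b → P y x) → Joined P a x b x
column-joined zero zero _ p = stay (p zero z≤n z≤n)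
column-joined a (suc b) a≤ p with m≤n⇒m<n∨m≡n a≤
... | inj₂ refl = stay (p (suc b) ≤-refl ≤-refl)
... | inj₁ (s≤s a≤b) = via (column-joined a b a≤b (λ x l u → p x l (≤-trans u (n≤1+n b))))
                           (down (p b a≤b (n≤1+n b)) (p (suc b) a≤ ≤-refl))

joined-ends : ∀ {P y x y' x'} → Joined P y x y' x' → P y x × P y' x'
joined-ends (stay p) = p , p
joined-ends (right p q) = p , q
joined-ends (down p q) = p , q
joined-ends (back j) = let (p , q) = joined-ends j in q , p
joined-ends (via i j) = proj₁ (joined-ends i) , proj₂ (joined-ends j)

module _ {m} {g : SGraph m} {D : RectData m} {h w} (r : IsRect g D h w) where
  open RectData D
  open IsRect r

  joined-path : ∀ {P : ℕ → ℕ → Set} {Q : Fin m → Set} → (∀ {y x} → P y x → y < h × x < w) →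
    (∀ {y x v} → P y x → v ∈ B y x → Q v) →
    ∀ {y x y' x' u v} → Joined P y x y' x' → u ∈ B y x → v ∈ B y' x' → Path (E g) Q u v
  joined-path in-range f (stay p) u∈ v∈ =
    let (y< , x<) = in-range p in path-weaken (f p) (connected y< x< u∈ v∈)
  joined-path in-range f (right p q) u∈ v∈ =
    let (y< , x<) = in-range p ; (_ , x+1<) = in-range q ; (a∈ , b∈ , e) = rightward y< x+1<
    in path-weaken (f p) (connected y< x< u∈ a∈) ◅◅
       step (f p a∈) e (path-weaken (f q) (connected y< x+1< b∈ v∈))
  joined-path in-range f (down p q) u∈ v∈ =
    let (y< , x<) = in-range p ; (y+1< , _) = in-range q ; (a∈ , b∈ , e) = downward y+1< x<
    in path-weaken (f p) (connected y< x< u∈ a∈) ◅◅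
       step (f p a∈) e (path-weaken (f q) (connected y+1< x< b∈ v∈))
  joined-path in-range f (back j) u∈ v∈ = path-rev (E-sym g) (joined-path in-range f j v∈ u∈)
  joined-path in-range f (via i j) u∈ v∈ =
    let (y< , x<) = in-range (proj₂ (joined-ends i)) ; (z , z∈) = nonempty y< x<
    in joined-path in-range f i u∈ z∈ ◅◅ joined-path in-range f j z∈ v∈

  transpose-data : RectData m
  transpose-data = record { B = λ y x → B x y ; right₁ = λ y x → down₁ x y ; right₂ = λ y x → down₂ x y
                          ; down₁ = λ y x → right₁ x y ; down₂ = λ y x → right₂ x y }

  transpose : IsRect g transpose-data w h
  transpose = record
    { disjoint = λ y< x< y'< x'< v∈ v∈' → let (p , q) = disjoint x< y< x'< y'< v∈ v∈' in q , p
    ; nonempty = λ y< x< → nonempty x< y< ; connected = λ y< x< → connected x< y<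
    ; rightward = λ y< x< → downward x< y< ; downward = λ y< x< → rightward x< y< }

  FreeRow : Subset m → ℕ → Set
  FreeRow Z y = ∀ x v → x < w → v ∈ B y x → v ∉ Z

  private
    BandHit : ∀ {k} s → Subset m → Fin k → Set
    BandHit s Z j = ∃ λ (i : Fin s) → ∃ λ (x : Fin w) → ∃ λ v → v ∈ B (toℕ (combine j i)) (toℕ x) × v ∈ Z

    bandHit? : ∀ {k} s Z (j : Fin k) → Dec (BandHit s Z j)
    bandHit? s Z j = any? (λ i → any? (λ x → any? (λ v → (v ∈? B (toℕ (combine j i)) (toℕ x)) ×-dec (v ∈? Z))))

  free-band : ∀ k s (Z : Subset m) → k * s ≤ h → ∣ Z ∣ < k →
    ∃ λ a → a + s ≤ h × (∀ y → a ≤ y → y < a + s → FreeRow Z y)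
  free-band k s Z k*s≤h Z<k with any? {n = k} (λ j → ¬? (bandHit? s Z j))
  ... | yes (j , free) = s * toℕ j , top , λ y a≤y y<a+s x v x<w v∈B v∈Z →
        free (fromℕ< (offset< a≤y y<a+s) , fromℕ< x<w , v ,
              subst₂ (λ y x → v ∈ B y x) (≡-sym (row≡ a≤y y<a+s)) (≡-sym (toℕ-fromℕ< x<w)) v∈B , v∈Z)
    where
    top : s * toℕ j + s ≤ h
    top = ≤-trans (≤-reflexive (trans (+-comm _ s) (≡-sym (ℕₚ.*-suc s (toℕ j)))))
            (≤-trans (ℕₚ.*-monoʳ-≤ s (toℕ<n j)) (≤-trans (≤-reflexive (ℕₚ.*-comm s k)) k*s≤h))
    offset< : ∀ {y} → s * toℕ j ≤ y → y < s * toℕ j + s → y ∸ s * toℕ j < s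
    offset< {y} a≤y y< = ℕₚ.+-cancelˡ-< (s * toℕ j) _ _ (subst (λ t → t < s * toℕ j + s) (≡-sym (ℕₚ.m+[n∸m]≡n a≤y)) y<)
    row≡ : ∀ {y} (a≤y : s * toℕ j ≤ y) (y< : y < s * toℕ j + s) → toℕ (combine j (fromℕ< (offset< a≤y y<))) ≡ y
    row≡ a≤y y< = trans (toℕ-combine j _) (trans (cong (s * toℕ j +_) (toℕ-fromℕ< (offset< a≤y y<))) (ℕₚ.m+[n∸m]≡n a≤y))
  ... | no none = contradiction (injective⇒≤∣∣ Z (λ j → proj₁ (proj₂ (proj₂ (hit j))))
            (λ j → proj₂ (proj₂ (proj₂ (proj₂ (hit j))))) injective) (<⇒≱ Z<k)
    where
    hit : ∀ j → BandHit s Z j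
    hit j = decidable-stable (bandHit? s Z j) (λ free → none (j , free))
    row< : ∀ (j : Fin k) (i : Fin s) → toℕ (combine j i) < h
    row< j i = <-≤-trans (toℕ<n (combine j i)) k*s≤h
    injective : ∀ {j j'} → proj₁ (proj₂ (proj₂ (hit j))) ≡ proj₁ (proj₂ (proj₂ (hit j'))) → j ≡ j'
    injective {j} {j'} eq with hit j | hit j'
    injective {j} {j'} refl | i , x , v , v∈ , _ | i' , x' , _ , v∈' , _ =
      proj₁ (combine-injective j i j' i' (toℕ-injective
        (proj₁ (disjoint (row< j i) (toℕ<n x) (row< j' i') (toℕ<n x') v∈ v∈'))))

  free-row : ∀ Z → ∣ Z ∣ < h → ∃ λ y → y < h × FreeRow Z y
  free-row Z Z<h = let (a , a+1≤h , free) = free-band h 1 Z (≤-reflexive (ℕₚ.*-identityʳ h)) Z<h in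
    a , ≤-trans (≤-reflexive (+-comm 1 a)) a+1≤h , free a ≤-refl (≤-reflexive (+-comm 1 a))

-- core Z is the component of g - Z that contains all rows and columns of a grid avoiding Z; only
-- these consequences are used.
record Core {m} (g : SGraph m) (N : ℕ) : Set where
  field
    core      : Subset m → Subset m
    inhabited : ∀ {Z} → ∣ Z ∣ < N → Nonempty (core Z)
    avoids    : ∀ {Z x} → x ∈ core Z → x ∉ Z
    connects  : ∀ {Z x y} → x ∈ core Z → y ∈ core Z → Path (E g) (_∉ Z) x y
    closed    : ∀ {Z x y} → x ∈ core Z → E g x y → y ∉ Z → y ∈ core Z
    monotone  : ∀ {Z W x} → ∣ W ∣ < N → Z ⊆ W → x ∈ core W → x ∈ core Z

module GridCore {m} {g : SGraph m} {D : RectData m} {N} (r : IsRect g D N N) where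
  open RectData D
  open IsRect r

  FreeColumn : Subset m → ℕ → Set
  FreeColumn = FreeRow (transpose r)

  free-column : ∀ Z → ∣ Z ∣ < N → ∃ λ x → x < N × FreeColumn Z x
  free-column = free-row (transpose r)

  private
    out? : ∀ (Z : Subset m) v → Dec (v ∉ Z)
    out? Z v = ¬? (v ∈? Z)

    Base : Subset m → Fin m → Set
    Base Z v = ∃ λ (y : Fin N) → (∀ (x : Fin N) u → u ∈ B (toℕ y) (toℕ x) → u ∉ Z) × ∃ λ (x : Fin N) → v ∈ B (toℕ y) (toℕ x)

    base? : ∀ Z v → Dec (Base Z v)
    base? Z v = any? λ y → all? (λ x → all? (λ u → (u ∈? B (toℕ y) (toℕ x)) →-dec out? Z u))
                            ×-dec any? (λ x → v ∈? B (toℕ y) (toℕ x))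

    base-row : ∀ {Z v} → Base Z v → ∃ λ y → ∃ λ x → y < N × x < N × FreeRow r Z y × v ∈ B y x
    base-row {Z} (y , free , x , v∈) = toℕ y , toℕ x , toℕ<n y , toℕ<n x ,
      (λ x' u x'< u∈ → free (fromℕ< x'<) u (subst (λ x → u ∈ B (toℕ y) x) (≡-sym (toℕ-fromℕ< x'<)) u∈)) , v∈

    row-base : ∀ {Z y x v} → y < N → x < N → FreeRow r Z y → v ∈ B y x → Base Z v
    row-base {Z} {y} {x} {v} y< x< free v∈ = fromℕ< y< ,
      (λ x' u u∈ → free (toℕ x') u (toℕ<n x') (subst (λ y → u ∈ B y (toℕ x')) (toℕ-fromℕ< y<) u∈)) ,
      fromℕ< x< , subst₂ (λ y x → v ∈ B y x) (≡-sym (toℕ-fromℕ< y<)) (≡-sym (toℕ-fromℕ< x<)) v∈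

    -- Any vertex of a row free of `Z` may serve as the start, because a free column connects all
    -- free rows as long as `Z` has fewer than `N` vertices. The empty default covers sets `Z` that
    -- leave no row free.
    core : Subset m → Subset m
    core Z with any? (base? Z)
    ... | yes (b , _) = reach (E? g) (out? Z) b
    ... | no _ = ⊥

    core⁻ : ∀ {Z v} → v ∈ core Z → ∃ λ b → Base Z b × Path (E g) (_∉ Z) b v
    core⁻ {Z} v∈ with any? (base? Z)
    ... | yes (b , bb) = b , bb , reach⁻ (E? g) (out? Z) b v∈
    ... | no _ = contradiction v∈ ∉⊥

    core-path : ∀ {Z u v} → u ∈ core Z → v ∈ core Z → Path (E g) (_∉ Z) u v
    core-path {Z} u∈ v∈ with any? (base? Z)
    ... | yes (b , bb) = path-rev (E-sym g) (reach⁻ (E? g) (out? Z) b u∈) ◅◅ reach⁻ (E? g) (out? Z) b v∈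
    ... | no _ = contradiction v∈ ∉⊥

    core-extend : ∀ {Z u v} → u ∈ core Z → Path (E g) (_∉ Z) u v → v ∈ core Z
    core-extend {Z} u∈ p with any? (base? Z)
    ... | yes (b , bb) = reach⁺ (E? g) (out? Z) b (reach⁻ (E? g) (out? Z) b u∈ ◅◅ p)
    ... | no _ = contradiction u∈ ∉⊥

    row-path : ∀ {Z y x x' u v} → FreeRow r Z y → y < N → x < N → x' < N → u ∈ B y x → v ∈ B y x' → Path (E g) (_∉ Z) u v
    row-path {Z} {y} {x} {x'} free y< x< x'< u∈ v∈ =
      joined-path r {P = λ y' x → y ≡ y' × x < N} (λ { (refl , x<) → y< , x< }) (λ { (refl , x<) → free _ _ x< })
        (via (back (from-zero x<)) (from-zero x'<)) u∈ v∈
      where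
      from-zero : ∀ {x} → x < N → Joined (λ y' x → y ≡ y' × x < N) y 0 y x
      from-zero {x} x< = row-joined 0 x z≤n (λ _ _ ≤x → refl , ≤-<-trans ≤x x<)

  private
    column-path : ∀ {Z x y y' u v} → FreeColumn Z x → x < N → y < N → y' < N → u ∈ B y x → v ∈ B y' x → Path (E g) (_∉ Z) u v
    column-path {Z} {x} {y} {y'} free x< y< y'< u∈ v∈ =
      joined-path r {P = λ y x' → x ≡ x' × y < N} (λ { (refl , y<) → y< , x< }) (λ { (refl , y<) → free _ _ y< })
        (via (back (from-zero y<)) (from-zero y'<)) u∈ v∈
      where
      from-zero : ∀ {y} → y < N → Joined (λ y x' → x ≡ x' × y < N) 0 x y x
      from-zero {y} y< = column-joined 0 y z≤n (λ _ _ ≤y → refl , ≤-<-trans ≤y y<)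

    base-path : ∀ {Z b b'} → ∣ Z ∣ < N → Base Z b → Base Z b' → Path (E g) (_∉ Z) b b'
    base-path {Z} Z<N bb bb' =
      let (y , x , y< , x< , free , b∈) = base-row bb
          (y' , x' , y'< , x'< , free' , b'∈) = base-row bb'
          (c , c< , freec) = free-column Z Z<N
          (u , u∈) = nonempty y< c<
          (u' , u'∈) = nonempty y'< c<
      in row-path free y< x< c< b∈ u∈ ◅◅ column-path freec c< y< y'< u∈ u'∈ ◅◅ row-path free' y'< c< x'< u'∈ b'∈

    base∈core : ∀ {Z v} → ∣ Z ∣ < N → Base Z v → v ∈ core Z
    base∈core {Z} {v} Z<N bv with any? (base? Z)
    ... | yes (b , bb) = reach⁺ (E? g) (out? Z) b (base-path Z<N bb bv)
    ... | no none = contradiction (v , bv) none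

    base-mono : ∀ {Z W v} → Z ⊆ W → Base W v → Base Z v
    base-mono Z⊆W (y , free , rest) = y , (λ x u u∈ u∈Z → free x u u∈ (Z⊆W u∈Z)) , rest

  gridCore : Core g N
  gridCore = record
    { core = core
    ; inhabited = λ {Z} Z<N → let (y , y< , free) = free-row r Z Z<N ; (v , v∈) = nonempty y< y< in
        v , base∈core Z<N (row-base y< y< free v∈)
    ; avoids = λ {Z} v∈ → path-end (core-path {Z} v∈ v∈)
    ; connects = λ {Z} → core-path {Z}
    ; closed = λ {Z} x∈ e y∉ → core-extend {Z} x∈ (step (path-end (core-path {Z} x∈ x∈)) e (here y∉))
    ; monotone = λ {Z} {W} W<N Z⊆W x∈ → let (b , bb , p) = core⁻ {W} x∈ in
        core-extend {Z} (base∈core (≤-<-trans (p⊆q⇒∣p∣≤∣q∣ Z⊆W) W<N) (base-mono Z⊆W bb))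
          (path-weaken (λ x∉ x∈ → x∉ (Z⊆W x∈)) p)
    }

  row⊆core : ∀ {Z y x v} → ∣ Z ∣ < N → y < N → x < N → FreeRow r Z y → v ∈ B y x → v ∈ core Z
  row⊆core Z<N y< x< free v∈ = base∈core Z<N (row-base y< x< free v∈)

  column⊆core : ∀ {Z y x v} → ∣ Z ∣ < N → y < N → x < N → FreeColumn Z x → v ∈ B y x → v ∈ core Z
  column⊆core {Z} Z<N y< x< freec v∈ =
    let (y' , y'< , free) = free-row r Z Z<N ; (u , u∈) = nonempty y'< x< in
    core-extend {Z} (row⊆core Z<N y'< x< free u∈) (column-path freec x< y'< y< u∈ v∈)

  core-base : ∀ {Z v} → v ∈ core Z → ∃ λ y → ∃ λ x → ∃ λ b → y < N × x < N × FreeRow r Z y × b ∈ B y x × Path (E g) (_∉ Z) b v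
  core-base {Z} v∈ = let (b , bb , p) = core⁻ {Z} v∈ ; (y , x , y< , x< , free , b∈) = base-row bb in
    y , x , b , y< , x< , free , b∈ , p

-- Closest cuts

module _ {m} (g : SGraph m) where
  neighbours? : ∀ (C : Subset m) w → Dec (w ∉ C × ∃ λ c → c ∈ C × E g c w)
  neighbours? C w = ¬? (w ∈? C) ×-dec any? (λ c → (c ∈? C) ×-dec E? g c w)

  neighbours : Subset m → Subset m
  neighbours C = fromDec (neighbours? C)

module Separation {m} {g : SGraph m} {N} (cr : Core g N) (S : Subset m) where
  open Core cr

  -- The set `Z` cuts the grid off from `S`; it may itself contain vertices of `S`.
  Separating : Subset m → Set
  Separating Z = ∀ v → v ∈ core Z → v ∉ S

  separating? : ∀ Z → Dec (Separating Z)
  separating? Z = all? λ v → (v ∈? core Z) →-dec ¬? (v ∈? S)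

  Linked≥ : ℕ → Set
  Linked≥ r = ∀ Z → ∣ Z ∣ < r → ¬ Separating Z

  -- Submodularity of the vertex boundary: if C₁ = core P and C₂ = core Z, then one of the
  -- boundaries of C₁ ∪ C₂ and C₁ ∩ C₂ is no larger than r, and the first is at least r.
  uncross : ∀ {r} → r + r < N → Linked≥ r → ∀ {P Z} → ∣ P ∣ ≤ r → ∣ Z ∣ ≤ r → Separating P → Separating Z →
    ∃ λ Q → ∣ Q ∣ ≤ r × Separating Q × core Q ⊆ core P × core Q ⊆ core Z
  uncross {r} 2r<N linked {P} {Z} P≤ Z≤ sepP sepZ = Nm , Nm≤r , sepm , (λ x∈ → proj₁ (corem x∈)) , (λ x∈ → proj₂ (corem x∈))
    where
    C₁ = core P
    C₂ = core Z
    Nj = neighbours g (C₁ ∪ C₂)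
    Nm = neighbours g (C₁ ∩ C₂)
    PZ≤ : ∣ P ∪ Z ∣ ≤ r + r
    PZ≤ = ≤-trans (∣p∪q∣≤∣p∣+∣q∣ P Z) (+-mono-≤ P≤ Z≤)
    PZ<N : ∣ P ∪ Z ∣ < N
    PZ<N = ≤-<-trans PZ≤ 2r<N
    -- By monotonicity this vertex lies in the cores of `P`, `Z`, `Nj` and `Nm` at once. It is the
    -- starting point from which the last two cores are confined to the union and the intersection
    -- of the first two.
    x₀ = proj₁ (inhabited {P ∪ Z} PZ<N)
    x₀∈ = proj₂ (inhabited {P ∪ Z} PZ<N)
    edge-P : ∀ {x y} → x ∈ C₁ → E g x y → y ∉ C₁ → y ∈ P
    edge-P {x} {y} x∈ e y∉ = decidable-stable (y ∈? P) (λ y∉P → y∉ (closed x∈ e y∉P))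
    edge-Z : ∀ {x y} → x ∈ C₂ → E g x y → y ∉ C₂ → y ∈ Z
    edge-Z {x} {y} x∈ e y∉ = decidable-stable (y ∈? Z) (λ y∉Z → y∉ (closed x∈ e y∉Z))
    Nj⁻ : ∀ {w} → w ∈ Nj → w ∉ C₁ × w ∉ C₂ × ∃ λ c → (c ∈ C₁ ⊎ c ∈ C₂) × E g c w
    Nj⁻ w∈ = let (w∉ , c , c∈ , e) = ∈-fromDec⁻ (neighbours? g (C₁ ∪ C₂)) w∈ in
      (λ a → w∉ (p⊆p∪q C₂ a)) , (λ a → w∉ (q⊆p∪q C₁ C₂ a)) , c , x∈p∪q⁻ C₁ C₂ c∈ , e
    Nm⁻ : ∀ {w} → w ∈ Nm → ¬ (w ∈ C₁ × w ∈ C₂) × ∃ λ c → c ∈ C₁ × c ∈ C₂ × E g c w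
    Nm⁻ w∈ = let (w∉ , c , c∈ , e) = ∈-fromDec⁻ (neighbours? g (C₁ ∩ C₂)) w∈ ; (a , b) = x∈p∩q⁻ C₁ C₂ c∈ in
      (λ ab → w∉ (x∈p∩q⁺ ab)) , c , a , b , e
    Nj⊆ : Nj ⊆ P ∪ Z
    Nj⊆ w∈ with Nj⁻ w∈
    ... | w∉₁ , w∉₂ , c , inj₁ c∈ , e = p⊆p∪q Z (edge-P c∈ e w∉₁)
    ... | w∉₁ , w∉₂ , c , inj₂ c∈ , e = q⊆p∪q P Z (edge-Z c∈ e w∉₂)
    Nm⊎ : ∀ {w} → w ∈ Nm → w ∈ P ⊎ w ∈ Z
    Nm⊎ {w} w∈ with Nm⁻ w∈
    ... | w∉ , c , c∈₁ , c∈₂ , e with w ∈? C₁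
    ...   | no w∉₁ = inj₁ (edge-P c∈₁ e w∉₁)
    ...   | yes w∈₁ = inj₂ (edge-Z c∈₂ e (λ w∈₂ → w∉ (w∈₁ , w∈₂)))
    Nm⊆ : Nm ⊆ P ∪ Z
    Nm⊆ w∈ = x∈p∪q⁺ (Nm⊎ w∈)
    sizes : ∣ Nm ∣ + ∣ Nj ∣ ≤ ∣ P ∣ + ∣ Z ∣
    sizes = ∣∣-submodular Nm Nj P Z both either
      where
      both : ∀ {w} → w ∈ Nm → w ∈ Nj → w ∈ P × w ∈ Z
      both a b = let (_ , c , c∈₁ , c∈₂ , e) = Nm⁻ a ; (w∉₁ , w∉₂ , _) = Nj⁻ b in edge-P c∈₁ e w∉₁ , edge-Z c∈₂ e w∉₂
      either : ∀ {w} → w ∈ Nm ⊎ w ∈ Nj → w ∈ P ⊎ w ∈ Z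
      either (inj₁ a) = Nm⊎ a
      either (inj₂ b) = x∈p∪q⁻ P Z (Nj⊆ b)
    corej : ∀ {x} → x ∈ core Nj → x ∈ C₁ ⊎ x ∈ C₂
    corej x∈ = path-stays {P = _∉ Nj} {T = λ x → x ∈ C₁ ⊎ x ∈ C₂}
      (λ {x} {y} x∈ e y∉ → x∈p∪q⁻ C₁ C₂ (decidable-stable (y ∈? (C₁ ∪ C₂))
        (λ y∉∪ → y∉ (∈-fromDec⁺ (neighbours? g (C₁ ∪ C₂)) (y∉∪ , x , x∈p∪q⁺ x∈ , e)))))
      (inj₁ (monotone PZ<N (p⊆p∪q Z) x₀∈)) (connects (monotone PZ<N Nj⊆ x₀∈) x∈)
    corem : ∀ {x} → x ∈ core Nm → x ∈ C₁ × x ∈ C₂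
    corem x∈ = path-stays {P = _∉ Nm} {T = λ x → x ∈ C₁ × x ∈ C₂}
      (λ {x} {y} x∈ e y∉ → x∈p∩q⁻ C₁ C₂ (decidable-stable (y ∈? (C₁ ∩ C₂))
        (λ y∉∩ → y∉ (∈-fromDec⁺ (neighbours? g (C₁ ∩ C₂)) (y∉∩ , x , x∈p∩q⁺ x∈ , e)))))
      (monotone PZ<N (p⊆p∪q Z) x₀∈ , monotone PZ<N (q⊆p∪q P Z) x₀∈) (connects (monotone PZ<N Nm⊆ x₀∈) x∈)
    sepm : Separating Nm
    sepm v v∈ = sepP v (proj₁ (corem v∈))
    Nj≥r : r ≤ ∣ Nj ∣
    Nj≥r = ≮⇒≥ (λ lt → linked Nj lt (λ v v∈ → [ sepP v , sepZ v ]′ (corej v∈)))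
    Nm≤r : ∣ Nm ∣ ≤ r
    Nm≤r = +-cancelʳ-≤ r _ _ (≤-trans (+-monoʳ-≤ ∣ Nm ∣ Nj≥r) (≤-trans sizes (+-mono-≤ P≤ Z≤)))

  Closest : ℕ → Subset m → Set
  Closest r P = ∣ P ∣ ≤ r × Separating P × (∀ Z → ∣ Z ∣ ≤ r → Separating Z → core P ⊆ core Z)

  -- It suffices to minimise the size of the core: uncrossing with any other small separator `Z`
  -- yields a separator whose core is strictly smaller, unless `core P` already lies in `core Z`.
  closest : ∀ {r} → r + r < N → Linked≥ r → ∀ Z → ∣ Z ∣ ≤ r → Separating Z → ∃ (Closest r)
  closest {r} 2r<N linked Z Z≤ sepZ = go _ Z ≤-refl Z≤ sepZ
    where
    go : ∀ fuel P → ∣ core P ∣ ≤ fuel → ∣ P ∣ ≤ r → Separating P → ∃ (Closest r)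
    go fuel P bound P≤ sepP with anySubset? (λ Q → (∣ Q ∣ ≤? r) ×-dec (separating? Q ×-dec (∣ core Q ∣ <? ∣ core P ∣)))
    go fuel P bound P≤ sepP | no none = P , P≤ , sepP , λ Z Z≤ sepZ → below Z Z≤ sepZ
      where
      below : ∀ Z → ∣ Z ∣ ≤ r → Separating Z → core P ⊆ core Z
      below Z Z≤ sepZ {x} x∈ with uncross 2r<N linked P≤ Z≤ sepP sepZ
      ... | Q , Q≤ , sepQ , Q⊆P , Q⊆Z = decidable-stable (x ∈? core Z) (λ x∉ →
              none (Q , Q≤ , sepQ , p⊂q⇒∣p∣<∣q∣ (Q⊆P , x , x∈ , λ x∈Q → x∉ (Q⊆Z x∈Q))))
    go zero P bound P≤ sepP | yes (Q , _ , _ , less) = contradiction (≤-trans less bound) λ ()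
    go (suc fuel) P bound P≤ sepP | yes (Q , Q≤ , sepQ , less) = go fuel Q (ℕₚ.≤-pred (≤-trans less bound)) Q≤ sepQ

-- A set Y' deleted from g - v is traded for a set Y, no larger, deleted from g: inside
-- core P ∪ P it is replaced by the part of P that Y' cuts off from the core.
module Irrelevant {m} {g : SGraph m} {N} (cr : Core g N) {S : Subset m} {K} (hv : Haven g S K) where
  open Core cr
  open Separation cr S

  module _ {p} (3p+1<N : suc (p + p + p) < N) (linked : Linked≥ p)
           {P} (P-closest : Closest p P) {v} (v∈C : v ∈ core P) where

    private
      C = core P
      B = C ∪ P
      A = ⊤ - v
      g-v = restrict g A
      P≤ = proj₁ P-closest
      sepP = proj₁ (proj₂ P-closest)

      ∈A : ∀ {x} → x ≢ v → x ∈ A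
      ∈A x≢v = x∈p∧x≢y⇒x∈p-y ∈⊤ x≢v

      outside-edge : ∀ {x y} → x ∉ C → E g x y → y ∈ C → x ∈ P
      outside-edge {x} x∉ e y∈ = decidable-stable (x ∈? P) (λ x∉P → x∉ (closed y∈ (E-sym g e) x∉P))

      -- The set `C'` is the connected remainder of the core side after the deletion of `Y'` and
      -- `v`. Field `keep` says that what survives `Y` outside the core also survives `Y'`, and is
      -- attached to `C'` if it lies in `P`. Field `cores` is there to make any two non-empty
      -- remainders meet.
      record Trade (Y' : Subset m) : Set where
        field
          Y C'   : Subset m
          size   : ∣ Y ∣ ≤ ∣ Y' ∣
          joined : ∀ {x y} → x ∈ C' → y ∈ C' → Path (E g-v) (_∉ Y') x y
          keep   : ∀ {a} → a ∉ C → a ∉ Y → a ∉ Y' × (a ∈ P → a ∈ C')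
          cores  : ∀ {x} → x ∈ C' → ∣ Y' ∩ B ∣ ≤ p × core (P ∪ (Y' ∩ B) ∪ ⁅ v ⁆) ⊆ C'

      split : ∀ (X X' : Subset m) → ∣ X ─ X' ∣ + ∣ X ∩ X' ∣ ≤ ∣ X ∣
      split X X' = ∣∣-disjoint (X ─ X') (X ∩ X') X (p─q⊆p X X') (p∩q⊆p X X')
        (λ a b → proj₂ (∈-─⁻ X X' a) (proj₂ (x∈p∩q⁻ X X' b)))

      trade : ∀ Y' → Trade Y'
      trade Y' with ∣ Y' ∩ B ∣ <? p
      ... | no many = record
        { Y = (Y' ─ B) ∪ P ; C' = ⊥
        ; size = ≤-trans (∣p∪q∣≤∣p∣+∣q∣ (Y' ─ B) P)
                   (≤-trans (+-monoʳ-≤ ∣ Y' ─ B ∣ (≤-trans P≤ (≮⇒≥ many))) (split Y' B))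
        ; joined = λ x∈ → contradiction x∈ ∉⊥
        ; keep = λ {a} a∉C a∉Y → (λ a∈Y' → a∉Y (p⊆p∪q P (x∈p∧x∉q⇒x∈p─q a∈Y'
                   (λ a∈B → [ a∉C , (λ a∈P → a∉Y (q⊆p∪q (Y' ─ B) P a∈P)) ]′ (x∈p∪q⁻ C P a∈B)))))
                 , (λ a∈P → contradiction (q⊆p∪q (Y' ─ B) P a∈P) a∉Y)
        ; cores = λ x∈ → contradiction x∈ ∉⊥
        }
      ... | yes few = record
        { Y = (Y' ─ B) ∪ (P ─ C') ; C' = C'
        ; size = ≤-trans (∣p∪q∣≤∣p∣+∣q∣ (Y' ─ B) (P ─ C'))
                   (≤-trans (+-monoʳ-≤ ∣ Y' ─ B ∣ cut) (split Y' B))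
        ; joined = λ x∈ y∈ → path-rev (E-sym g-v) (C'-path x∈) ◅◅ C'-path y∈
        ; keep = keep
        ; cores = λ _ → <⇒≤ few , Q⊆C'
        }
        where
        Q = P ∪ (Y' ∩ B) ∪ ⁅ v ⁆
        Q⁻ : ∀ {x} → x ∉ Q → x ∉ P × ¬ (x ∈ Y' × x ∈ B) × x ≢ v
        Q⁻ x∉ = (λ a → x∉ (x∈p∪q⁺ (inj₁ a))) , (λ a → x∉ (x∈p∪q⁺ (inj₂ (x∈p∪q⁺ (inj₁ (x∈p∩q⁺ a))))))
               , λ { refl → x∉ (x∈p∪q⁺ (inj₂ (x∈p∪q⁺ (inj₂ (x∈⁅x⁆ v))))) }
        Q<N : ∣ Q ∣ < N
        Q<N = ≤-<-trans (≤-trans (∣p∪q∣≤∣p∣+∣q∣ P (Y' ∩ B ∪ ⁅ v ⁆)) (+-mono-≤ P≤ (≤-trans (∣p∪⁅x⁆∣≤1+∣p∣ (Y' ∩ B) v) few)))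
                (≤-<-trans (≤-trans (m≤m+n (p + p) p) (n≤1+n _)) 3p+1<N)
        x₀ = proj₁ (inhabited {Q} Q<N)
        x₀∈ = proj₂ (inhabited {Q} Q<N)
        ok? : ∀ x → Dec (x ∈ B × x ∉ Y' × x ≢ v)
        ok? x = (x ∈? B) ×-dec (¬? (x ∈? Y') ×-dec ¬? (x ≟F v))
        C' = reach (E? g) ok? x₀
        C'⁻ : ∀ {x} → x ∈ C' → Path (E g) (λ x → x ∈ B × x ∉ Y' × x ≢ v) x₀ x
        C'⁻ = reach⁻ (E? g) ok? x₀
        C'-path : ∀ {x} → x ∈ C' → Path (E g-v) (_∉ Y') x₀ x
        C'-path x∈ = path-map {Q = _∉ Y'} (λ (_ , _ , a) (_ , _ , b) e → e , ∈A a , ∈A b) (λ (_ , a , _) → a) (C'⁻ x∈)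
        coreQ-ok : ∀ {x} → x ∈ core Q → x ∈ B × x ∉ Y' × x ≢ v
        coreQ-ok x∈ = let (_ , b , c) = Q⁻ (avoids x∈) ; x∈B = p⊆p∪q P (monotone Q<N (p⊆p∪q _) x∈) in
          x∈B , (λ a → b (a , x∈B)) , c
        Q⊆C' : core Q ⊆ C'
        Q⊆C' x∈ = reach⁺ (E? g) ok? x₀ (path-weaken (λ (_ , a) → coreQ-ok a)
          (path-within {P = _∉ Q} {T = _∈ core Q} closed x₀∈ (connects x₀∈ x∈)))
        keep : ∀ {a} → a ∉ C → a ∉ (Y' ─ B) ∪ (P ─ C') → a ∉ Y' × (a ∈ P → a ∈ C')
        keep {a} a∉C a∉Y = a∉Y' , in-C'
          where
          in-C' : a ∈ P → a ∈ C'
          in-C' a∈P = decidable-stable (a ∈? C') (λ a∉C' → a∉Y (q⊆p∪q (Y' ─ B) _ (x∈p∧x∉q⇒x∈p─q a∈P a∉C')))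
          a∉Y' : a ∉ Y'
          a∉Y' a∈Y' = a∉Y (p⊆p∪q _ (x∈p∧x∉q⇒x∈p─q a∈Y'
            (λ a∈B → [ a∉C , (λ a∈P → proj₁ (proj₂ (path-end (C'⁻ (in-C' a∈P)))) a∈Y') ]′ (x∈p∪q⁻ C P a∈B))))
        Z = (P ∩ C') ∪ (Y' ∩ B)
        Zv⊆Q : Z ∪ ⁅ v ⁆ ⊆ Q
        Zv⊆Q x∈ with x∈p∪q⁻ Z ⁅ v ⁆ x∈
        ... | inj₂ b = x∈p∪q⁺ (inj₂ (x∈p∪q⁺ (inj₂ b)))
        ... | inj₁ a with x∈p∪q⁻ (P ∩ C') (Y' ∩ B) a
        ...   | inj₁ c = x∈p∪q⁺ (inj₁ (proj₁ (x∈p∩q⁻ P C' c)))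
        ...   | inj₂ d = x∈p∪q⁺ (inj₂ (x∈p∪q⁺ (inj₁ d)))
        trapped : ∀ {w} → w ∈ core (Z ∪ ⁅ v ⁆) → w ∈ C' × w ∈ C
        trapped w∈ = path-stays {P = _∉ Z ∪ ⁅ v ⁆} {T = λ x → x ∈ C' × x ∈ C} stays
          (Q⊆C' x₀∈ , monotone Q<N (p⊆p∪q _) x₀∈) (connects (monotone Q<N Zv⊆Q x₀∈) w∈)
          where
          stays : ∀ {x y} → x ∈ C' × x ∈ C → E g x y → y ∉ Z ∪ ⁅ v ⁆ → y ∈ C' × y ∈ C
          stays {x} {y} (x∈C' , x∈C) e y∉ = y∈C' , closed x∈C e y∉P
            where
            y∈B : y ∈ B
            y∈B with y ∈? P
            ... | yes y∈P = q⊆p∪q C P y∈P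
            ... | no y∉P = p⊆p∪q P (closed x∈C e y∉P)
            y∈C' : y ∈ C'
            y∈C' = reach⁺ (E? g) ok? x₀ (C'⁻ x∈C' ◅◅ step (path-end (C'⁻ x∈C')) e (here (y∈B ,
              (λ y∈Y' → y∉ (p⊆p∪q ⁅ v ⁆ (q⊆p∪q (P ∩ C') (Y' ∩ B) (x∈p∩q⁺ (y∈Y' , y∈B))))) ,
              λ { refl → y∉ (x∈p∪⁅x⁆ Z v) })))
            y∉P : y ∉ P
            y∉P y∈P = y∉ (p⊆p∪q ⁅ v ⁆ (p⊆p∪q (Y' ∩ B) (x∈p∩q⁺ (y∈P , y∈C'))))
        -- Otherwise `Z` would have fewer than `p` vertices, and `Z ∪ ⁅ v ⁆` would be a separator of
        -- size at most `p`. As `P` is closest, its core, and with it `v`, would lie in the core of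
        -- a set containing `v`.
        cut : ∣ P ─ C' ∣ ≤ ∣ Y' ∩ B ∣
        cut = ≮⇒≥ λ more →
          let Z<p : ∣ Z ∣ < p
              Z<p = <-≤-trans (≤-<-trans (∣p∪q∣≤∣p∣+∣q∣ (P ∩ C') (Y' ∩ B)) (ℕₚ.+-monoʳ-< ∣ P ∩ C' ∣ more))
                      (≤-trans (≤-reflexive (+-comm ∣ P ∩ C' ∣ _)) (≤-trans (split P C') P≤))
              sepZv : Separating (Z ∪ ⁅ v ⁆)
              sepZv w w∈ = sepP w (proj₂ (trapped w∈))
          in avoids (proj₂ (proj₂ P-closest) (Z ∪ ⁅ v ⁆) (≤-trans (∣p∪⁅x⁆∣≤1+∣p∣ Z v) Z<p) sepZv v∈C) (x∈p∪⁅x⁆ Z v)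

      module _ (Y' : Subset m) where
        open Trade (trade Y')

        -- Outside the core the path is copied step by step. An excursion into the core is replaced
        -- by `C'`: the path enters and leaves the core through vertices of `P` outside `Y`, and
        -- these belong to `C'`.
        Follows : Fin m → Fin m → Set
        Follows a x = (x ∉ C × x ∉ Y × Path (E g-v) (_∉ Y') a x)
                    ⊎ (x ∈ C × Nonempty C' × ∀ {c} → c ∈ C' → Path (E g-v) (_∉ Y') a c)

        into-C' : ∀ {a x} → x ∉ C → x ∉ Y → x ∈ P → Path (E g-v) (_∉ Y') a x →
          Nonempty C' × ∀ {c} → c ∈ C' → Path (E g-v) (_∉ Y') a c
        into-C' x∉C x∉Y x∈P w = let x∈C' = proj₂ (keep x∉C x∉Y) x∈P in (_ , x∈C') , λ c∈ → w ◅◅ joined x∈C' c∈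

        ≢v : ∀ {x} → x ∉ C → x ≢ v
        ≢v x∉C refl = x∉C v∈C

        follow : ∀ {a x} → a ∉ C → Path (E g) (_∉ Y) a x → Follows a x
        follow {a} a∉C w = path-stays {P = _∉ Y} {T = Follows a} stays
          (inj₁ (a∉C , path-start w , here (proj₁ (keep a∉C (path-start w))))) w
          where
          stays : ∀ {x y} → Follows a x → E g x y → y ∉ Y → Follows a y
          stays {x} {y} f e y∉Y with y ∈? C | f
          ... | yes y∈C | inj₂ (_ , rest) = inj₂ (y∈C , rest)
          ... | yes y∈C | inj₁ (x∉C , x∉Y , w) = inj₂ (y∈C , into-C' x∉C x∉Y (outside-edge x∉C e y∈C) w)
          ... | no y∉C | inj₁ (x∉C , x∉Y , w) = inj₁ (y∉C , y∉Y ,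
                  w ◅◅ step (path-end w) (e , ∈A (≢v x∉C) , ∈A (≢v y∉C)) (here (proj₁ (keep y∉C y∉Y))))
          ... | no y∉C | inj₂ (x∈C , _ , all) = inj₁ (y∉C , y∉Y ,
                  all (proj₂ (keep y∉C y∉Y) (outside-edge y∉C (E-sym g e) x∈C)))

      -- The set `P`, the parts of `Y₁` and `Y₂` in `B`, and `v` amount to at most 3p + 1 vertices,
      -- so their joint core is inhabited. It lies in both remainders.
      common : ∀ Y₁ Y₂ → Nonempty (Trade.C' (trade Y₁)) → Nonempty (Trade.C' (trade Y₂)) →
        ∃ λ c → c ∈ Trade.C' (trade Y₁) × c ∈ Trade.C' (trade Y₂)
      common Y₁ Y₂ (_ , n₁) (_ , n₂) =
        let (few₁ , in₁) = Trade.cores (trade Y₁) n₁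
            (few₂ , in₂) = Trade.cores (trade Y₂) n₂
            (c , c∈) = inhabited {Q} (≤-<-trans (bound few₁ few₂) 3p+1<N)
        in c , in₁ (monotone (≤-<-trans (bound few₁ few₂) 3p+1<N) sub₁ c∈)
             , in₂ (monotone (≤-<-trans (bound few₁ few₂) 3p+1<N) sub₂ c∈)
        where
        Q₁ Q₂ Q : Subset m
        Q₁ = Y₁ ∩ B
        Q₂ = Y₂ ∩ B
        Q = (P ∪ (Q₁ ∪ Q₂)) ∪ ⁅ v ⁆
        bound : ∣ Q₁ ∣ ≤ p → ∣ Q₂ ∣ ≤ p → ∣ Q ∣ ≤ suc (p + p + p)
        bound a b = ≤-trans (∣p∪⁅x⁆∣≤1+∣p∣ (P ∪ (Q₁ ∪ Q₂)) v) (s≤s (≤-trans (∣p∪q∣≤∣p∣+∣q∣ P (Q₁ ∪ Q₂))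
          (≤-trans (+-mono-≤ P≤ (≤-trans (∣p∪q∣≤∣p∣+∣q∣ Q₁ Q₂) (+-mono-≤ a b))) (≤-reflexive (≡-sym (+-assoc p p p))))))
        sub₁ : P ∪ Q₁ ∪ ⁅ v ⁆ ⊆ Q
        sub₁ x∈ with x∈p∪q⁻ P _ x∈
        ... | inj₁ a = p⊆p∪q _ (p⊆p∪q _ a)
        ... | inj₂ b = [ (λ c → p⊆p∪q _ (q⊆p∪q P _ (p⊆p∪q _ c))) , q⊆p∪q _ _ ]′ (x∈p∪q⁻ Q₁ ⁅ v ⁆ b)
        sub₂ : P ∪ Q₂ ∪ ⁅ v ⁆ ⊆ Q
        sub₂ x∈ with x∈p∪q⁻ P _ x∈
        ... | inj₁ a = p⊆p∪q _ (p⊆p∪q _ a)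
        ... | inj₂ b = [ (λ c → p⊆p∪q _ (q⊆p∪q P _ (q⊆p∪q Q₁ _ c))) , q⊆p∪q _ _ ]′ (x∈p∪q⁻ Q₂ ⁅ v ⁆ b)

    -- The haven answers for the traded set. Its representative is in `S`, hence outside `core P`,
    -- where `Y` and `Y'` can be compared; if both connected parts reach the core, they touch inside
    -- the remainders.
    haven-without : Haven g-v S K
    haven-without = record
      { rep = λ Y' b → rep (Y Y') (b' Y' b)
      ; rep∈S = λ Y' b → rep∈S (Y Y') (b' Y' b)
      ; rep∉ = λ Y' b → proj₁ (Trade.keep (trade Y') (rep∉C Y' b) (rep∉ (Y Y') (b' Y' b)))
      ; touch = touch'
      }
      where
      open Haven hv
      Y : Subset m → Subset m
      Y Y' = Trade.Y (trade Y')
      b' : ∀ Y' → ∣ Y' ∣ ≤ K → ∣ Y Y' ∣ ≤ K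
      b' Y' b = ≤-trans (Trade.size (trade Y')) b
      rep∉C : ∀ Y' b → rep (Y Y') (b' Y' b) ∉ C
      rep∉C Y' b r∈C = sepP _ r∈C (rep∈S (Y Y') (b' Y' b))
      touch' : ∀ Y₁ Y₂ b₁ b₂ → ∃₂ λ x y → Path (E g-v) (_∉ Y₁) (rep (Y Y₁) (b' Y₁ b₁)) x ×
        Path (E g-v) (_∉ Y₂) (rep (Y Y₂) (b' Y₂ b₂)) y × (x ≡ y ⊎ E g-v x y)
      touch' Y₁ Y₂ b₁ b₂ with touch (Y Y₁) (Y Y₂) (b' Y₁ b₁) (b' Y₂ b₂)
      ... | x , y , w₁ , w₂ , xy with follow Y₁ (rep∉C Y₁ b₁) w₁ | follow Y₂ (rep∉C Y₂ b₂) w₂ | xy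
      ...   | inj₁ (x∉C , _ , u₁) | inj₁ (y∉C , _ , u₂) | inj₁ eq = x , y , u₁ , u₂ , inj₁ eq
      ...   | inj₁ (x∉C , _ , u₁) | inj₁ (y∉C , _ , u₂) | inj₂ e =
              x , y , u₁ , u₂ , inj₂ (e , ∈A (≢v Y₁ x∉C) , ∈A (≢v Y₁ y∉C))
      ...   | inj₂ (x∈C , n₁ , f₁) | inj₂ (y∈C , n₂ , f₂) | _ =
              let (c , c₁ , c₂) = common Y₁ Y₂ n₁ n₂ in c , c , f₁ c₁ , f₂ c₂ , inj₁ refl
      ...   | inj₁ (x∉C , _ , _) | inj₂ (y∈C , _) | inj₁ refl = contradiction y∈C x∉C
      ...   | inj₂ (x∈C , _) | inj₁ (y∉C , _ , _) | inj₁ refl = contradiction x∈C y∉C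
      ...   | inj₁ (x∉C , x∉Y , u₁) | inj₂ (y∈C , n₂ , f₂) | inj₂ e =
              let (n₁ , f₁) = into-C' Y₁ x∉C x∉Y (outside-edge x∉C e y∈C) u₁
                  (c , c₁ , c₂) = common Y₁ Y₂ n₁ n₂ in c , c , f₁ c₁ , f₂ c₂ , inj₁ refl
      ...   | inj₂ (x∈C , n₁ , f₁) | inj₁ (y∉C , y∉Y , u₂) | inj₂ e =
              let (n₂ , f₂) = into-C' Y₂ y∉C y∉Y (outside-edge y∉C (E-sym g e) x∈C) u₂
                  (c , c₁ , c₂) = common Y₁ Y₂ n₁ n₂ in c , c , f₁ c₁ , f₂ c₂ , inj₁ refl

-- Menger's theorem

module _ {m} (g : SGraph m) where
  private
    isEdge? : ∀ e → Dec (E g (proj₁ (remQuot {m} m e)) (proj₂ (remQuot {m} m e)))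
    isEdge? e = E? g (proj₁ (remQuot {m} m e)) (proj₂ (remQuot {m} m e))

  -- Only the size of this set matters: it is the measure that falls in Menger's theorem, in the
  -- passage to a critical graph and in the deletion of vertices.
  edgeSet : Subset (m * m)
  edgeSet = fromDec isEdge?

  edgeSet⁺ : ∀ {x y} → E g x y → combine x y ∈ edgeSet
  edgeSet⁺ {x} {y} e = ∈-fromDec⁺ isEdge? (subst (λ p → E g (proj₁ p) (proj₂ p)) (≡-sym (remQuot-combine x y)) e)

  edgeSet⁻ : ∀ {e} → e ∈ edgeSet → ∃₂ λ x y → E g x y × combine x y ≡ e
  edgeSet⁻ {e} e∈ = _ , _ , ∈-fromDec⁻ isEdge? e∈ , combine-remQuot {m} m e

edges-decrease : ∀ {m} (g g' : SGraph m) → (∀ {x y} → E g' x y → E g x y) →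
  ∀ {x y} → E g x y → ¬ E g' x y → ∣ edgeSet g' ∣ < ∣ edgeSet g ∣
edges-decrease g g' sub {x} {y} e ¬e = p⊂q⇒∣p∣<∣q∣
  ( (λ d → let (u , v , e' , eq) = edgeSet⁻ g' d in subst (_∈ edgeSet g) eq (edgeSet⁺ g (sub e')))
  , combine x y , edgeSet⁺ g e
  , λ d → let (u , v , e' , eq) = edgeSet⁻ g' d ; (u≡x , v≡y) = combine-injective u v x y eq in
      ¬e (subst₂ (E g') u≡x v≡y e') )

SameEdge : ∀ {m} → Fin m → Fin m → Fin m → Fin m → Set
SameEdge x y u v = (u ≡ x × v ≡ y) ⊎ (u ≡ y × v ≡ x)

sameEdge? : ∀ {m} (x y u v : Fin m) → Dec (SameEdge x y u v)
sameEdge? x y u v = ((u ≟F x) ×-dec (v ≟F y)) ⊎-dec ((u ≟F y) ×-dec (v ≟F x))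

SameEdge-swap : ∀ {m} {x y u v : Fin m} → SameEdge x y u v → SameEdge x y v u
SameEdge-swap (inj₁ (p , q)) = inj₂ (q , p)
SameEdge-swap (inj₂ (p , q)) = inj₁ (q , p)

module _ {m} (g : SGraph m) (x y : Fin m) where
  deleteEdge : SGraph m
  deleteEdge = record
    { E     = λ u v → E g u v × ¬ SameEdge x y u v
    ; E?    = λ u v → E? g u v ×-dec ¬? (sameEdge? x y u v)
    ; E-sym = λ (e , ne) → E-sym g e , ne ∘ SameEdge-swap
    ; E-irr = λ (e , _) → E-irr g e
    }

  deleteEdge-decreases : E g x y → ∣ edgeSet deleteEdge ∣ < ∣ edgeSet g ∣
  deleteEdge-decreases e = edges-decrease g deleteEdge proj₁ e (λ (_ , ne) → ne (inj₁ (refl , refl)))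

-- Connected sets stand in for paths: gluing two of them is a union, and a path inside one is
-- extracted only where it is needed.
record Linkage {m} (R : Fin m → Fin m → Set) (A B : Subset m) (k : ℕ) : Set where
  field
    L         : Fin k → Subset m
    disjoint  : ∀ {i j v} → v ∈ L i → v ∈ L j → i ≡ j
    connected : ∀ {i u v} → u ∈ L i → v ∈ L i → Path R (_∈ L i) u v
    source    : ∀ i → ∃ λ a → a ∈ A × a ∈ L i
    target    : ∀ i → ∃ λ b → b ∈ B × b ∈ L i

Separates : ∀ {m} → SGraph m → Subset m → Subset m → Subset m → Set
Separates g A B Z = ∀ {a b} → a ∈ A → b ∈ B → ¬ Path (E g) (_∉ Z) a b

-- Trims a member of a linkage at its first vertex in `X`. Up to that vertex it stays in `T`, which
-- no edge leaves except into `X`; with `T` one side of a cut, this keeps the two linkages to be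
-- glued apart.
first-hit : ∀ {m} {R : Fin m → Fin m → Set} {P T : Fin m → Set} (X : Subset m) →
  (∀ {u v} → T u → R u v → v ∉ X → T v) → ∀ {s t} → (s ∉ X → T s) → t ∈ X → Path R P s t →
  ∃ λ z → z ∈ X × P z × Path R (λ u → P u × (u ≡ z ⊎ (T u × u ∉ X))) s z
first-hit X closed {s} {t} T-start t∈X w with s ∈? X
... | yes s∈X = s , s∈X , path-start w , here (path-start w , inj₁ refl)
... | no s∉X with path-exit {T = _∉ X} (λ v → ¬? (v ∈? X)) s∉X (λ t∉ → t∉ t∈X) w
...   | exit {last} {z} before e z-in after =
  let inside = path-within {T = λ u → _ } (λ tu e (_ , v∉) → closed tu e v∉) (T-start s∉X) before
      z∈X = decidable-stable (z ∈? X) z-in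
  in z , z∈X , path-start after ,
     (path-weaken (λ ((p , u∉) , t) → p , inj₂ (t , u∉)) inside ◅◅
      step (let ((p , u∉) , t) = path-end inside in p , inj₂ (t , u∉)) e (here (path-start after , inj₁ refl)))

-- Göring's proof: if deleting the edge xy creates a separator Y of size k - 1, then Y ∪ {x} is linked
-- to A and Y ∪ {y} to B, and the two linkages meet only in Y.
module _ {m : ℕ} where

  private
    Result : SGraph m → Subset m → Subset m → ℕ → Set
    Result g A B k = (∃ λ Z → ∣ Z ∣ < k × Separates g A B Z) ⊎ Linkage (E g) A B k

    edgeless : ∀ g A B k → (∀ x y → ¬ E g x y) → Result g A B k
    edgeless g A B k none with k ≤? ∣ A ∩ B ∣
    ... | no ¬k≤ = inj₁ (A ∩ B , ≰⇒> ¬k≤ , separates)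
      where
      separates : Separates g A B (A ∩ B)
      separates a∈ b∈ (here v∉) = v∉ (x∈p∩q⁺ (a∈ , b∈))
      separates a∈ b∈ (step _ e _) = none _ _ e
    ... | yes k≤ = let (f , f∈ , mono) = enumerate k (A ∩ B) k≤ in inj₂ record
      { L = λ i → ⁅ f i ⁆
      ; disjoint = λ {i} {j} v∈ v∈' → increasing⇒injective mono (trans (≡-sym (x∈⁅y⁆⇒x≡y _ v∈)) (x∈⁅y⁆⇒x≡y _ v∈'))
      ; connected = λ {i} u∈ v∈ → subst₂ (Path (E g) (_∈ ⁅ f i ⁆)) (≡-sym (x∈⁅y⁆⇒x≡y _ u∈)) (≡-sym (x∈⁅y⁆⇒x≡y _ v∈)) (here (x∈⁅x⁆ (f i)))
      ; source = λ i → f i , proj₁ (x∈p∩q⁻ A B (f∈ i)) , x∈⁅x⁆ (f i)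
      ; target = λ i → f i , proj₂ (x∈p∩q⁻ A B (f∈ i)) , x∈⁅x⁆ (f i)
      }

    module Cross (g : SGraph m) (A B : Subset m) (k : ℕ) (x y : Fin m) (e : E g x y)
                 (Y : Subset m) (Y<k : ∣ Y ∣ < k) (g' : SGraph m)
                 (sub : ∀ {u v} → E g' u v → E g u v)
                 (sup : ∀ {u v} → E g u v → E g' u v ⊎ SameEdge x y u v)
                 (D : Subset m) (A⊆D : ∀ {a} → a ∈ A → a ∉ Y → a ∈ D) (B∉D : ∀ {b} → b ∈ B → b ∉ D)
                 (D-closed : ∀ {u v} → u ∈ D → E g' u v → v ∉ Y → v ∈ D)
                 (x∈D : x ∈ D) (y∉D : y ∉ D) (y∉Y : y ∉ Y) where
      X X' : Subset m
      X = Y ∪ ⁅ x ⁆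
      X' = Y ∪ ⁅ y ⁆

      ∉X⁻ : ∀ {u} → u ∉ X → u ∉ Y
      ∉X⁻ u∉ u∈ = u∉ (p⊆p∪q ⁅ x ⁆ u∈)
      ∉X'⁻ : ∀ {u} → u ∉ X' → u ∉ Y
      ∉X'⁻ u∉ u∈ = u∉ (p⊆p∪q ⁅ y ⁆ u∈)

      within-D : ∀ {Z a u} → Path (E g) (λ v → v ∉ Z × v ∈ D) a u → Path (E g') (_∉ Z) a u
      within-D = path-map (λ (_ , p) (_ , q) e → [ id , [ (λ { (_ , refl) → contradiction q y∉D }) , (λ { (refl , _) → contradiction p y∉D }) ]′ ]′ (sup e)) proj₁

      -- A path from `A` to `B` must leave `D`, and it can do so only along the edge from `x` to `y`
      -- or into `Y`. Either way its part up to that point reaches `X` within `g'`.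
      separates-left : ∀ Z → Separates g' A X Z → Separates g A B Z
      separates-left Z sepZ {a} {b} a∈ b∈ w with a ∈? Y
      ... | yes a∈Y = sepZ a∈ (p⊆p∪q ⁅ x ⁆ a∈Y) (here (path-start w))
      ... | no a∉Y with path-exit {T = _∈ D} (_∈? D) (A⊆D a∈ a∉Y) (B∉D b∈) w
      ...   | exit {u} {v} before e' v∉D after with sup e'
      ...     | inj₂ (inj₁ (refl , refl)) = sepZ a∈ (x∈p∪⁅x⁆ Y x) (within-D {Z} before)
      ...     | inj₂ (inj₂ (refl , refl)) = contradiction x∈D v∉D
      ...     | inj₁ e'' with v ∈? Y
      ...       | no v∉Y = v∉D (D-closed (proj₂ (path-end before)) e'' v∉Y)
      ...       | yes v∈Y = sepZ a∈ (p⊆p∪q ⁅ x ⁆ v∈Y)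
                    (within-D {Z} before ◅◅ step (proj₁ (path-end before)) e'' (here (path-start after)))

      separates-right : ∀ Z → Separates g' X' B Z → Separates g A B Z
      separates-right Z sepZ {a} {b} a∈ b∈ w with b ∈? Y
      ... | yes b∈Y = sepZ (p⊆p∪q ⁅ y ⁆ b∈Y) b∈ (here (path-end w))
      ... | no b∉Y with path-exit {T = λ u → u ∉ D × u ∉ Y} (λ u → ¬? (u ∈? D) ×-dec ¬? (u ∈? Y)) (B∉D b∈ , b∉Y)
                          (λ (a∉D , a∉Y) → a∉D (A⊆D a∈ a∉Y)) (path-rev (E-sym g) w)
      ...   | exit {u} {v} before e' v-in after = finish (sup (E-sym g e'))
        where
        in-g' : Path (E g') (_∉ Z) u b
        in-g' = path-rev (E-sym g') (path-map (λ (_ , p , _) (_ , q , _) e →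
                  [ id , [ (λ { (refl , _) → contradiction x∈D p }) , (λ { (_ , refl) → contradiction x∈D q }) ]′ ]′ (sup e)) proj₁ before)
        u∉ = proj₂ (path-end before)
        finish : E g' v u ⊎ SameEdge x y v u → Void
        finish (inj₂ (inj₁ (refl , refl))) = sepZ (x∈p∪⁅x⁆ Y y) b∈ in-g'
        finish (inj₂ (inj₂ (_ , refl))) = proj₁ u∉ x∈D
        finish (inj₁ e'') with v ∈? D
        ... | yes v∈D = proj₁ u∉ (D-closed v∈D e'' (proj₂ u∉))
        ... | no v∉D = sepZ (p⊆p∪q ⁅ y ⁆ (decidable-stable (v ∈? Y) (λ v∉Y → v-in (v∉D , v∉Y)))) b∈
                         (step (path-start after) e'' in-g')

      module Join (l₁ : Linkage (E g') A X k) (l₂ : Linkage (E g') X' B k) where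
        open Linkage l₁ renaming (L to L₁; disjoint to disjoint₁; connected to connected₁; source to source₁; target to target₁)
        open Linkage l₂ renaming (L to L₂; disjoint to disjoint₂; connected to connected₂; source to source₂; target to target₂)

        hit₁ : ∀ i → ∃ λ z → z ∈ X × z ∈ L₁ i × Path (E g') (λ u → u ∈ L₁ i × (u ≡ z ⊎ (u ∈ D × u ∉ X))) (proj₁ (source₁ i)) z
        hit₁ i = let (a , a∈A , a∈L) = source₁ i ; (t , t∈X , t∈L) = target₁ i in
          first-hit {T = _∈ D} X (λ u∈ e v∉ → D-closed u∈ e (∉X⁻ v∉)) (λ a∉ → A⊆D a∈A (∉X⁻ a∉)) t∈X (connected₁ a∈L t∈L)

        hit₂ : ∀ j → ∃ λ z → z ∈ X' × z ∈ L₂ j × Path (E g') (λ u → u ∈ L₂ j × (u ≡ z ⊎ ((u ∉ D × u ∉ Y) × u ∉ X'))) (proj₁ (target₂ j)) z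
        hit₂ j = let (b , b∈B , b∈L) = target₂ j ; (t , t∈X' , t∈L) = source₂ j in
          first-hit {T = λ u → u ∉ D × u ∉ Y} X'
            (λ (u∉D , u∉Y) e v∉ → (λ v∈D → u∉D (D-closed v∈D (E-sym g' e) u∉Y)) , ∉X'⁻ v∉)
            (λ b∉ → B∉D b∈B , ∉X'⁻ b∉) t∈X' (connected₂ b∈L t∈L)

        z w : Fin k → Fin m
        z i = proj₁ (hit₁ i)
        w j = proj₁ (hit₂ j)
        z∈X : ∀ i → z i ∈ X
        z∈X i = proj₁ (proj₂ (hit₁ i))
        w∈X' : ∀ j → w j ∈ X'
        w∈X' j = proj₁ (proj₂ (hit₂ j))
        z-injective : ∀ {i j} → z i ≡ z j → i ≡ j
        z-injective {i} {j} eq = disjoint₁ (proj₁ (proj₂ (proj₂ (hit₁ i)))) (subst (_∈ L₁ j) (≡-sym eq) (proj₁ (proj₂ (proj₂ (hit₁ j)))))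
        w-injective : ∀ {i j} → w i ≡ w j → i ≡ j
        w-injective {i} {j} eq = disjoint₂ (proj₁ (proj₂ (proj₂ (hit₂ i)))) (subst (_∈ L₂ j) (≡-sym eq) (proj₁ (proj₂ (proj₂ (hit₂ j)))))

        pred₁? : ∀ i u → Dec (u ∈ L₁ i × (u ≡ z i ⊎ (u ∈ D × u ∉ X)))
        pred₁? i u = (u ∈? L₁ i) ×-dec ((u ≟F z i) ⊎-dec ((u ∈? D) ×-dec ¬? (u ∈? X)))
        pred₂? : ∀ j u → Dec (u ∈ L₂ j × (u ≡ w j ⊎ ((u ∉ D × u ∉ Y) × u ∉ X')))
        pred₂? j u = (u ∈? L₂ j) ×-dec ((u ≟F w j) ⊎-dec ((¬? (u ∈? D) ×-dec ¬? (u ∈? Y)) ×-dec ¬? (u ∈? X')))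

        P Q : Fin k → Subset m
        P i = reach (E? g') (pred₁? i) (z i)
        Q j = reach (E? g') (pred₂? j) (w j)

        P⁻ : ∀ i {u} → u ∈ P i → u ∈ L₁ i × (u ≡ z i ⊎ (u ∈ D × u ∉ X))
        P⁻ i u∈ = path-end (reach⁻ (E? g') (pred₁? i) (z i) u∈)
        Q⁻ : ∀ j {u} → u ∈ Q j → u ∈ L₂ j × (u ≡ w j ⊎ ((u ∉ D × u ∉ Y) × u ∉ X'))
        Q⁻ j u∈ = path-end (reach⁻ (E? g') (pred₂? j) (w j) u∈)

        -- The set `X'` has at most `k` vertices, so the `k` distinct ends `w j` exhaust it. A
        -- member ending in `Y` continues at the same vertex, the one ending in `x` continues from
        -- `y`.
        partner : ∀ i → ∃ λ j → (z i ∈ Y × w j ≡ z i) ⊎ (z i ≡ x × w j ≡ y)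
        partner i with ∈-∪⁅⁆⁻ Y x (z∈X i)
        ... | inj₁ z∈Y = let (j , eq) = matched (p⊆p∪q ⁅ y ⁆ z∈Y) in j , inj₁ (z∈Y , eq)
          where
          matched : ∀ {t} → t ∈ X' → ∃ λ j → w j ≡ t
          matched = ∣X∣≤k⇒surjective X' w w∈X' w-injective (≤-trans (∣p∪⁅x⁆∣≤1+∣p∣ Y y) Y<k)
        ... | inj₂ z≡x = let (j , eq) = ∣X∣≤k⇒surjective X' w w∈X' w-injective (≤-trans (∣p∪⁅x⁆∣≤1+∣p∣ Y y) Y<k) (x∈p∪⁅x⁆ Y y)
                         in j , inj₂ (z≡x , eq)

        σ : Fin k → Fin k
        σ i = proj₁ (partner i)

        σ-injective : ∀ {i i'} → σ i ≡ σ i' → i ≡ i'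
        σ-injective {i} {i'} eq with partner i | partner i'
        σ-injective refl | j , inj₁ (_ , a) | _ , inj₁ (_ , b) = z-injective (trans (≡-sym a) b)
        σ-injective refl | j , inj₁ (z∈Y , a) | _ , inj₂ (_ , b) = contradiction (subst (_∈ Y) (trans (≡-sym a) b) z∈Y) y∉Y
        σ-injective refl | j , inj₂ (_ , a) | _ , inj₁ (z∈Y , b) = contradiction (subst (_∈ Y) (trans (≡-sym b) a) z∈Y) y∉Y
        σ-injective refl | j , inj₂ (a , _) | _ , inj₂ (b , _) = z-injective (trans a (≡-sym b))

        apart : ∀ i i' {v} → v ≡ z i ⊎ (v ∈ D × v ∉ X) → v ≡ w (σ i') ⊎ ((v ∉ D × v ∉ Y) × v ∉ X') → i ≡ i'
        apart i i' (inj₁ refl) (inj₁ eq) = same (proj₂ (partner i'))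
          where
          same : (z i' ∈ Y × w (σ i') ≡ z i') ⊎ (z i' ≡ x × w (σ i') ≡ y) → i ≡ i'
          same (inj₁ (_ , a)) = z-injective (trans eq a)
          same (inj₂ (_ , a)) = contradiction (trans eq a) λ z≡y →
            [ (λ z∈Y → y∉Y (subst (_∈ Y) z≡y z∈Y)) , (λ z≡x → y∉D (subst (_∈ D) (trans (≡-sym z≡x) z≡y) x∈D)) ]′ (∈-∪⁅⁆⁻ Y x (z∈X i))
        apart i i' (inj₁ refl) (inj₂ ((v∉D , v∉Y) , _)) =
          [ (λ v∈Y → contradiction v∈Y v∉Y) , (λ z≡x → contradiction (subst (_∈ D) (≡-sym z≡x) x∈D) v∉D) ]′ (∈-∪⁅⁆⁻ Y x (z∈X i))
        apart i i' (inj₂ (v∈D , v∉X)) (inj₁ refl) =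
          [ (λ v∈Y → contradiction v∈Y (∉X⁻ v∉X)) , (λ w≡y → contradiction (subst (_∈ D) w≡y v∈D) y∉D) ]′ (∈-∪⁅⁆⁻ Y y (w∈X' (σ i')))
        apart i i' (inj₂ (v∈D , _)) (inj₂ ((v∉D , _) , _)) = contradiction v∈D v∉D

        meet : ∀ i i' {v} → v ∈ P i → v ∈ Q (σ i') → i ≡ i'
        meet i i' v∈P v∈Q = apart i i' (proj₂ (P⁻ i v∈P)) (proj₂ (Q⁻ (σ i') v∈Q))

        z∈P : ∀ i → z i ∈ P i
        z∈P i = reach⁺ (E? g') (pred₁? i) (z i) (here (proj₁ (proj₂ (proj₂ (hit₁ i))) , inj₁ refl))

        w∈Q : ∀ j → w j ∈ Q j
        w∈Q j = reach⁺ (E? g') (pred₂? j) (w j) (here (proj₁ (proj₂ (proj₂ (hit₂ j))) , inj₁ refl))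

        L : Fin k → Subset m
        L i = P i ∪ Q (σ i)

        bridge : ∀ i → (z i ∈ Y × w (σ i) ≡ z i) ⊎ (z i ≡ x × w (σ i) ≡ y) → Path (E g) (_∈ L i) (z i) (w (σ i))
        bridge i (inj₁ (_ , eq)) = subst (Path (E g) (_∈ L i) (z i)) (≡-sym eq) (here (p⊆p∪q (Q (σ i)) (z∈P i)))
        bridge i (inj₂ (a , b)) = step (p⊆p∪q (Q (σ i)) (z∈P i)) (subst₂ (E g) (≡-sym a) (≡-sym b) e)
                                    (here (q⊆p∪q (P i) (Q (σ i)) (w∈Q (σ i))))

        to-centre : ∀ i {u} → u ∈ P i ⊎ u ∈ Q (σ i) → Path (E g) (_∈ L i) (z i) u
        to-centre i (inj₁ u∈P) = path-map (λ _ _ → sub) (p⊆p∪q (Q (σ i)))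
          (reach-path (E? g') (pred₁? i) (z i) (E-sym g') u∈P)
        to-centre i (inj₂ u∈Q) = bridge i (proj₂ (partner i)) ◅◅ path-map (λ _ _ → sub) (q⊆p∪q (P i) (Q (σ i)))
          (reach-path (E? g') (pred₂? (σ i)) (w (σ i)) (E-sym g') u∈Q)

        joined : Linkage (E g) A B k
        joined = record
          { L = L
          ; disjoint = λ {i} {i'} v∈ v∈' → disjoint i i' (x∈p∪q⁻ (P i) (Q (σ i)) v∈) (x∈p∪q⁻ (P i') (Q (σ i')) v∈')
          ; connected = λ {i} u∈ v∈ → path-rev (E-sym g) (to-centre i (x∈p∪q⁻ (P i) (Q (σ i)) u∈)) ◅◅
                                     to-centre i (x∈p∪q⁻ (P i) (Q (σ i)) v∈)
          ; source = λ i → let (a , a∈A , _) = source₁ i in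
              a , a∈A , p⊆p∪q (Q (σ i)) (reach⁺ (E? g') (pred₁? i) (z i) (path-rev (E-sym g') (proj₂ (proj₂ (proj₂ (hit₁ i))))))
          ; target = λ i → let (b , b∈B , _) = target₂ (σ i) in
              b , b∈B , q⊆p∪q (P i) (Q (σ i)) (reach⁺ (E? g') (pred₂? (σ i)) (w (σ i)) (path-rev (E-sym g') (proj₂ (proj₂ (proj₂ (hit₂ (σ i)))))))
          }
          where
          disjoint : ∀ i i' {v} → v ∈ P i ⊎ v ∈ Q (σ i) → v ∈ P i' ⊎ v ∈ Q (σ i') → i ≡ i'
          disjoint i i' (inj₁ a) (inj₁ b) = disjoint₁ (proj₁ (P⁻ i a)) (proj₁ (P⁻ i' b))
          disjoint i i' (inj₁ a) (inj₂ b) = meet i i' a b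
          disjoint i i' (inj₂ a) (inj₁ b) = ≡-sym (meet i' i b a)
          disjoint i i' (inj₂ a) (inj₂ b) = σ-injective (disjoint₂ (proj₁ (Q⁻ (σ i) a)) (proj₁ (Q⁻ (σ i') b)))

    mutual
      search : ∀ fuel g → ∣ edgeSet g ∣ < fuel → ∀ A B k → Result g A B k
      search (suc fuel) g bound A B k with any? (λ x → any? (λ y → E? g x y))
      ... | no none = edgeless g A B k (λ x y e → none (x , y , e))
      ... | yes (x , y , e) with search fuel (deleteEdge g x y) (smaller fuel g bound x y e) A B k
      ...   | inj₂ l = inj₂ record
                { L = Linkage.L l ; disjoint = Linkage.disjoint l ; source = Linkage.source l ; target = Linkage.target l
                ; connected = λ u∈ v∈ → path-map (λ _ _ → proj₁) id (Linkage.connected l u∈ v∈) }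
      ...   | inj₁ (Y , Y<k , sepY) = cut fuel g bound A B k x y e Y Y<k sepY

      smaller : ∀ fuel g → ∣ edgeSet g ∣ < suc fuel → ∀ x y → E g x y → ∣ edgeSet (deleteEdge g x y) ∣ < fuel
      smaller fuel g bound x y e = ≤-trans (deleteEdge-decreases g x y e) (ℕₚ.≤-pred bound)

      cut : ∀ fuel g → ∣ edgeSet g ∣ < suc fuel → ∀ A B k x y → E g x y → ∀ Y → ∣ Y ∣ < k →
        Separates (deleteEdge g x y) A B Y → Result g A B k
      cut fuel g bound A B k x y e Y Y<k sepY = decide
        where
        g' = deleteEdge g x y
        Reached : Fin m → Set
        Reached u = ∃ λ a → a ∈ A × Path (E g') (_∉ Y) a u
        reached? : ∀ u → Dec (Reached u)
        reached? u = any? (λ a → (a ∈? A) ×-dec path? (E? g') (λ v → ¬? (v ∈? Y)) a u)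
        D = fromDec reached?
        D⁻ : ∀ {u} → u ∈ D → Reached u
        D⁻ = ∈-fromDec⁻ reached?
        D⁺ : ∀ {u} → Reached u → u ∈ D
        D⁺ = ∈-fromDec⁺ reached?
        A⊆D : ∀ {a} → a ∈ A → a ∉ Y → a ∈ D
        A⊆D a∈ a∉ = D⁺ (_ , a∈ , here a∉)
        B∉D : ∀ {b} → b ∈ B → b ∉ D
        B∉D b∈ b∈D = let (a , a∈ , p) = D⁻ b∈D in sepY a∈ b∈ p
        D-closed : ∀ {u v} → u ∈ D → E g' u v → v ∉ Y → v ∈ D
        D-closed u∈ e v∉ = let (a , a∈ , p) = D⁻ u∈ in D⁺ (a , a∈ , p ◅◅ step (path-end p) e (here v∉))
        sup : ∀ {u v} → E g u v → E g' u v ⊎ SameEdge x y u v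
        sup {u} {v} e with sameEdge? x y u v
        ... | yes s = inj₂ s
        ... | no ¬s = inj₁ (e , ¬s)

        cross : ∀ x' y' → E g x' y' → (∀ {u v} → E g u v → E g' u v ⊎ SameEdge x' y' u v) →
          x' ∈ D → y' ∉ D → y' ∉ Y → Result g A B k
        cross x' y' e' sup' x∈D y∉D y∉Y = merge (search fuel g' smaller' A Cr.X k) (search fuel g' smaller' Cr.X' B k)
          where
          module Cr = Cross g A B k x' y' e' Y Y<k g' proj₁ sup' D A⊆D B∉D D-closed x∈D y∉D y∉Y
          smaller' = smaller fuel g bound x y e
          merge : Result g' A Cr.X k → Result g' Cr.X' B k → Result g A B k
          merge (inj₁ (Z , Z<k , sepZ)) _ = inj₁ (Z , Z<k , Cr.separates-left Z sepZ)
          merge (inj₂ _) (inj₁ (Z , Z<k , sepZ)) = inj₁ (Z , Z<k , Cr.separates-right Z sepZ)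
          merge (inj₂ l₁) (inj₂ l₂) = inj₂ (Cr.Join.joined l₁ l₂)

        crossing? : ∀ u v → Dec (u ∈ D × v ∉ D × v ∉ Y)
        crossing? u v = (u ∈? D) ×-dec (¬? (v ∈? D) ×-dec ¬? (v ∈? Y))

        decide : Result g A B k
        decide with crossing? x y | crossing? y x
        ... | yes (x∈D , y∉D , y∉Y) | _ = cross x y e sup x∈D y∉D y∉Y
        ... | no _ | yes (y∈D , x∉D , x∉Y) = cross y x (E-sym g e)
                (λ e → [ inj₁ , inj₂ ∘ [ inj₂ , inj₁ ]′ ]′ (sup e)) y∈D x∉D x∉Y
        -- If the edge leaves `D` in neither direction, putting it back opens no new way out of `D`,
        -- and `Y` already separates in `g`.
        ... | no ¬xy | no ¬yx = inj₁ (Y , Y<k , separates)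
          where
          closed : ∀ {u v} → u ∈ D → E g u v → v ∉ Y → v ∈ D
          closed {u} {v} u∈ e v∉ with sup e
          ... | inj₁ e' = D-closed u∈ e' v∉
          ... | inj₂ (inj₁ (refl , refl)) = decidable-stable (v ∈? D) (λ v∉D → ¬xy (u∈ , v∉D , v∉))
          ... | inj₂ (inj₂ (refl , refl)) = decidable-stable (v ∈? D) (λ v∉D → ¬yx (u∈ , v∉D , v∉))
          separates : Separates g A B Y
          separates a∈ b∈ p = B∉D b∈ (path-stays {P = _∉ Y} {T = _∈ D} closed (A⊆D a∈ (path-start p)) p)

  abstract
    menger : ∀ (g : SGraph m) A B k → (∃ λ Z → ∣ Z ∣ < k × Separates g A B Z) ⊎ Linkage (E g) A B k
    menger g = search _ g ≤-refl

-- From linkages to a rooted side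

∸-step : ∀ h y → y < h → h ∸ y ≡ suc (h ∸ suc y)
∸-step (suc h) zero _ = refl
∸-step (suc h) (suc y) (s≤s y<h) = ∸-step h y y<h

shift-data : ∀ {m} → RectData m → ℕ → RectData m
shift-data D a = record { B = λ y → B (a + y) ; right₁ = λ y → right₁ (a + y) ; right₂ = λ y → right₂ (a + y)
                        ; down₁ = λ y → down₁ (a + y) ; down₂ = λ y → down₂ (a + y) }
  where open RectData D

-- The edge between the new rows y and y + 1 is the old edge leaving row h - y - 2, traversed
-- upwards; hence the shifted index and the exchanged ends.
flip-data : ∀ {m} → RectData m → ℕ → RectData m
flip-data D h = record
  { B = λ y → B (h ∸ suc y) ; right₁ = λ y → right₁ (h ∸ suc y) ; right₂ = λ y → right₂ (h ∸ suc y)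
  ; down₁ = λ y → down₂ (h ∸ suc (suc y)) ; down₂ = λ y → down₁ (h ∸ suc (suc y)) }
  where open RectData D

module _ {m} {g : SGraph m} where

  shift-rect : ∀ {D h w} → IsRect g D h w → ∀ a s → a + s ≤ h → IsRect g (shift-data D a) s w
  shift-rect {D} {h} {w} r a s a+s≤h = record
    { disjoint = λ y< x< y'< x'< v∈ v∈' →
        let (p , q) = disjoint (up y<) x< (up y'<) x'< v∈ v∈' in ℕₚ.+-cancelˡ-≡ a _ _ p , q
    ; nonempty = λ y< x< → nonempty (up y<) x<
    ; connected = λ y< x< → connected (up y<) x<
    ; rightward = λ y< x< → rightward (up y<) x<
    ; downward = λ {y} {x} y< x< →
        let (p , q , e) = downward (subst (λ t → t < h) (+-suc a y) (up y<)) x< in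
        p , subst (λ t → RectData.down₂ D (a + y) x ∈ RectData.B D t x) (≡-sym (+-suc a y)) q , e
    }
    where
    open IsRect r
    up : ∀ {y} → y < s → a + y < h
    up y<s = <-≤-trans (ℕₚ.+-monoʳ-< a y<s) a+s≤h

  flip-rect : ∀ {D h w} → IsRect g D h w → IsRect g (flip-data D h) h w
  flip-rect {D} {h} {w} r = record
    { disjoint = λ y< x< y'< x'< v∈ v∈' →
        let (p , q) = disjoint (below y<) x< (below y'<) x'< v∈ v∈' in ℕₚ.suc-injective (ℕₚ.∸-cancelˡ-≡ y< y'< p) , q
    ; nonempty = λ y< x< → nonempty (below y<) x<
    ; connected = λ y< x< → connected (below y<) x<
    ; rightward = λ y< x< → rightward (below y<) x<
    ; downward = λ {y} {x} y< x< →
        let (p , q , e) = downward (subst (λ t → t < h) (unroll y<) (below (<⇒≤ y<))) x< in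
        subst (λ t → RectData.down₂ D (h ∸ suc (suc y)) x ∈ RectData.B D t x) (≡-sym (unroll y<)) q , p , E-sym g e
    }
    where
    open IsRect r
    below : ∀ {y} → y < h → h ∸ suc y < h
    below {y} y<h = ℕₚ.∸-monoʳ-< {h} {suc y} {0} (s≤s z≤n) y<h
    unroll : ∀ {y} → suc y < h → h ∸ suc y ≡ suc (h ∸ suc (suc y))
    unroll y< = ∸-step h (suc _) y<

-- Consecutive selected columns bound a strip of columns, which is contracted to a single column.
module Group {m} {g : SGraph m} {D : RectData m} {h w} (r : IsRect g D h w) (0<h : 0 < h) {k}
             (c : Fin k → Fin w) (increasing : ∀ i j → toℕ i < toℕ j → toℕ (c i) < toℕ (c j))
             (root : Fin k → Subset m)
             (root-disjoint : ∀ {i j v} → v ∈ root i → v ∈ root j → i ≡ j)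
             (root-off : ∀ {i y x v} → y < h → x < w → v ∈ root i → v ∉ RectData.B D y x)
             (root-connected : ∀ {i u v} → u ∈ root i → v ∈ root i → Path (E g) (_∈ root i) u v)
             (root-edge : ∀ i → ∃₂ λ u v → u ∈ root i × v ∈ RectData.B D 0 (toℕ (c i)) × E g u v) where
  open RectData D
  open IsRect r

  private
    -- The left end of a strip. The default `w` closes the last strip at the right edge of the grid;
    -- columns to the left of the first selected one are dropped.
    bound : ℕ → ℕ
    bound a with a <? k
    ... | yes a<k = toℕ (c (fromℕ< a<k))
    ... | no _ = w

    bound-< : ∀ {a} (a<k : a < k) → bound a ≡ toℕ (c (fromℕ< a<k))
    bound-< {a} a<k with a <? k
    ... | yes a<k' = cong (toℕ ∘ c) (fromℕ<-cong a a refl a<k' a<k)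
    ... | no ≮ = contradiction a<k ≮

    bound<w : ∀ {a} → a < k → bound a < w
    bound<w a<k = subst (λ t → t < w) (≡-sym (bound-< a<k)) (toℕ<n _)

    bound≤w : ∀ a → bound a ≤ w
    bound≤w a with a <? k
    ... | yes a<k = <⇒≤ (toℕ<n _)
    ... | no _ = ≤-refl

    bound-mono : ∀ {a b} → a < b → a < k → bound a < bound b
    bound-mono {a} {b} a<b a<k with b <? k
    ... | no _ = bound<w a<k
    ... | yes b<k = subst (λ t → t < toℕ (c (fromℕ< b<k))) (≡-sym (bound-< a<k))
            (increasing _ _ (subst₂ _<_ (≡-sym (toℕ-fromℕ< a<k)) (≡-sym (toℕ-fromℕ< b<k)) a<b))

    InStrip : ℕ → ℕ → Set
    InStrip a x = bound a ≤ x × x < bound (suc a)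

    strip-< : ∀ {a x} → InStrip a x → x < w
    strip-< {a} (_ , x<) = <-≤-trans x< (bound≤w (suc a))

    bound-next : ∀ {a b} → a < b → b < k → bound (suc a) ≤ bound b
    bound-next {a} a<b b<k with m≤n⇒m<n∨m≡n a<b
    ... | inj₂ refl = ≤-refl
    ... | inj₁ a+1<b = <⇒≤ (bound-mono a+1<b (<-trans a+1<b b<k))

    strip-unique : ∀ {a b x} → a < k → b < k → InStrip a x → InStrip b x → a ≡ b
    strip-unique {a} {b} a<k b<k (la , ua) (lb , ub) with <-cmp a b
    ... | tri≈ _ eq _ = eq
    ... | tri< a<b _ _ = contradiction (<-≤-trans ua (≤-trans (bound-next a<b b<k) lb)) (<-irrefl refl)
    ... | tri> _ _ b<a = contradiction (<-≤-trans ub (≤-trans (bound-next b<a a<k) la)) (<-irrefl refl)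

    first : ∀ {a} → a < k → InStrip a (bound a)
    first a<k = ≤-refl , bound-mono ≤-refl a<k

    final : ℕ → ℕ
    final a = bound (suc a) ∸ 1

    suc-final : ∀ {a} → a < k → suc (final a) ≡ bound (suc a)
    suc-final a<k = ≡-sym (∸-step _ 0 (≤-<-trans z≤n (bound-mono ≤-refl a<k)))

    last : ∀ {a} → a < k → InStrip a (final a)
    last {a} a<k = ℕₚ.≤-pred (subst (λ t → bound a < t) (≡-sym (suc-final a<k)) (bound-mono ≤-refl a<k))
                 , ≤-reflexive (suc-final a<k)

    Cell : ℕ → ℕ → Fin m → Set
    Cell y a v = (∃ λ (x : Fin w) → InStrip a (toℕ x) × v ∈ B y (toℕ x)) ⊎ (y ≡ 0 × ∃ λ i → toℕ i ≡ a × v ∈ root i)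

    cell? : ∀ y a v → Dec (Cell y a v)
    cell? y a v = any? (λ x → ((bound a ≤? toℕ x) ×-dec (toℕ x <? bound (suc a))) ×-dec (v ∈? B y (toℕ x)))
                  ⊎-dec ((y ≟ℕ 0) ×-dec any? (λ i → (toℕ i ≟ℕ a) ×-dec (v ∈? root i)))

    cell : ∀ {y a x v} → InStrip a x → v ∈ B y x → Cell y a v
    cell {y} {a} {x} {v} in-a v∈ = inj₁ (fromℕ< x<w , subst (InStrip a) eq in-a , subst (λ x → v ∈ B y x) eq v∈)
      where
      x<w = strip-< in-a
      eq = ≡-sym (toℕ-fromℕ< x<w)

  groups : RectData m
  groups = record
    { B = λ y a → fromDec (cell? y a)
    ; right₁ = λ y a → right₁ y (final a) ; right₂ = λ y a → right₂ y (final a)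
    ; down₁ = λ y a → down₁ y (bound a) ; down₂ = λ y a → down₂ y (bound a) }

  private
    cell-disjoint : ∀ {y a y' a' v} → y < h → a < k → y' < h → a' < k → Cell y a v → Cell y' a' v → y ≡ y' × a ≡ a'
    cell-disjoint y< a< y'< a'< (inj₁ (x , in-a , v∈)) (inj₁ (x' , in-a' , v∈')) =
      let (p , q) = disjoint y< (toℕ<n x) y'< (toℕ<n x') v∈ v∈' in
      p , strip-unique a< a'< in-a (subst (InStrip _) (≡-sym q) in-a')
    cell-disjoint y< a< y'< a'< (inj₁ (x , _ , v∈)) (inj₂ (_ , i , _ , v∈')) = contradiction v∈ (root-off y< (toℕ<n x) v∈')
    cell-disjoint y< a< y'< a'< (inj₂ (_ , i , _ , v∈)) (inj₁ (x , _ , v∈')) = contradiction v∈' (root-off y'< (toℕ<n x) v∈)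
    cell-disjoint y< a< y'< a'< (inj₂ (refl , i , refl , v∈)) (inj₂ (refl , j , refl , v∈')) =
      refl , cong toℕ (root-disjoint v∈ v∈')

    strip-path : ∀ {y a x x' u v} → y < h → a < k → InStrip a x → InStrip a x' → u ∈ B y x → v ∈ B y x' →
      Path (E g) (Cell y a) u v
    strip-path {y} {a} {x} {x'} y< a< in-a in-a' u∈ v∈ =
      joined-path r {P = λ y' x → y ≡ y' × InStrip a x} (λ { (refl , i) → y< , strip-< i }) (λ { (refl , i) v∈ → cell i v∈ })
        (via (back (from-first in-a)) (from-first in-a')) u∈ v∈
      where
      from-first : ∀ {x} → InStrip a x → Joined (λ y' x → y ≡ y' × InStrip a x) y (bound a) y x
      from-first (l , u) = row-joined (bound a) _ l (λ x' l' u' → refl , l' , ≤-<-trans u' u)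

    cell-path : ∀ {y a u v} → y < h → a < k → v ∈ B y (bound a) → Cell y a u → Path (E g) (Cell y a) u v
    cell-path y< a< v∈ (inj₁ (x , in-a , u∈)) = strip-path y< a< in-a (first a<) u∈ v∈
      where a<k = a<
    cell-path {v = v} y< a< v∈ (inj₂ (refl , i , refl , u∈)) =
      let (p , q , p∈ , q∈ , e) = root-edge i
          q∈' = subst (λ t → q ∈ B 0 t) (≡-sym (trans (bound-< a<) (cong (toℕ ∘ c) (fromℕ<-toℕ i a<)))) q∈
      in path-weaken (λ z∈ → inj₂ (refl , i , refl , z∈)) (root-connected u∈ p∈) ◅◅
         step (inj₂ (refl , i , refl , p∈)) e (strip-path y< a< (first a<) (first a<) q∈' v∈)

  grouped : IsRect g groups h k
  grouped = record
    { disjoint = λ y< a< y'< a'< v∈ v∈' →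
        cell-disjoint y< a< y'< a'< (∈-fromDec⁻ (cell? _ _) v∈) (∈-fromDec⁻ (cell? _ _) v∈')
    ; nonempty = λ y< a< → let (v , v∈) = nonempty y< (strip-< (first a<)) in
        v , ∈-fromDec⁺ (cell? _ _) (cell (first a<) v∈)
    ; connected = λ y< a< u∈ v∈ → let (z , z∈) = nonempty y< (strip-< (first a<)) in
        path-weaken (∈-fromDec⁺ (cell? _ _)) (cell-path y< a< z∈ (∈-fromDec⁻ (cell? _ _) u∈) ◅◅
          path-rev (E-sym g) (cell-path y< a< z∈ (∈-fromDec⁻ (cell? _ _) v∈)))
    ; rightward = λ {y} {a} y< a+1< →
        let a< = <⇒≤ a+1<
            eq = suc-final a<
            (p , q , e) = rightward y< (subst (λ t → t < w) (≡-sym eq) (bound<w a+1<))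
        in ∈-fromDec⁺ (cell? _ _) (cell (last a<) p) ,
           ∈-fromDec⁺ (cell? _ _) (cell (first a+1<) (subst (λ t → right₂ y (final a) ∈ B y t) eq q)) , e
    ; downward = λ y< a< → let (p , q , e) = downward y< (strip-< (first a<)) in
        ∈-fromDec⁺ (cell? _ _) (cell (first a<) p) , ∈-fromDec⁺ (cell? _ _) (cell (first a<) q) , e
    }

  root⊆top : ∀ i {v} → v ∈ root i → v ∈ RectData.B groups 0 (toℕ i)
  root⊆top i v∈ = ∈-fromDec⁺ (cell? _ _) (inj₂ (refl , i , refl , v∈))

select : ∀ {q w} k (col : Fin q → Fin w) (I : Subset q) → k ≤ ∣ I ∣ →
  (∀ {i j} → i ∈ I → j ∈ I → col i ≡ col j → i ≡ j) →
  ∃ λ (c : Fin k → Fin w) → (∀ i j → toℕ i < toℕ j → toℕ (c i) < toℕ (c j)) ×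
  ∃ λ (p : Fin k → Fin q) → (∀ i → p i ∈ I) × (∀ i → col (p i) ≡ c i)
select {q} {w} k col I k≤ injective =
  let (f , f∈ , f-mono) = enumerate k I k≤
      (c , c∈ , c-mono) = enumerate k X (injective⇒≤∣∣ X (col ∘ f) (λ i → ∈-fromDec⁺ used? (f i , f∈ i , refl))
                            (λ {i} {j} eq → increasing⇒injective f-mono (injective (f∈ i) (f∈ j) eq)))
  in c , c-mono , (λ i → proj₁ (∈-fromDec⁻ used? (c∈ i))) , (λ i → proj₁ (proj₂ (∈-fromDec⁻ used? (c∈ i)))) ,
     (λ i → proj₂ (proj₂ (∈-fromDec⁻ used? (c∈ i))))
  where
  used? : ∀ x → Dec (∃ λ i → i ∈ I × col i ≡ x)
  used? x = any? (λ i → (i ∈? I) ×-dec (col i ≟F x))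
  X = fromDec used?

half : ∀ {q} k → k + k ≤ suc q → (I : Subset q) → k ≤ ∣ I ∣ ⊎ k ≤ ∣ ∁ I ∣
half {q} k bound I with k ≤? ∣ I ∣
... | yes p = inj₁ p
... | no ¬p = inj₂ (subst (k ≤_) (≡-sym (∣∁p∣≡n∸∣p∣ I))
        (ℕₚ.m+n≤o⇒m≤o∸n k (ℕₚ.≤-pred (≤-trans (≤-reflexive (≡-sym (+-suc k _))) (≤-trans (+-monoʳ-≤ k (≰⇒> ¬p)) bound)))))

finite-choice : ∀ {m} {A B : Fin m → Set} → (∀ x → A x ⊎ B x) → ∃ A ⊎ (∀ x → B x)
finite-choice {zero} f = inj₂ λ ()
finite-choice {suc m} f with f zero | finite-choice (f ∘ suc)
... | inj₁ a | _ = inj₁ (zero , a)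
... | inj₂ _ | inj₁ (x , a) = inj₁ (suc x , a)
... | inj₂ b | inj₂ bs = inj₂ λ { zero → b ; (suc x) → bs x }

TopRooted : ∀ {m} → SGraph m → Subset m → ℕ → ℕ → Set
TopRooted g S h w = ∃ λ D → IsRect g D h w × ∀ x → x < w → ∃ λ v → v ∈ RectData.B D 0 x × v ∈ S

record Entry {m} (g : SGraph m) (S T L : Subset m) : Set where
  field
    origin before entered : Fin m
    origin∈S  : origin ∈ S
    entered∈L : entered ∈ L
    path      : Path (E g) (λ v → v ∈ L × v ∉ T) origin before
    edge      : E g before entered

find-entry : ∀ {m} {g : SGraph m} {S T L : Subset m} → (∀ {v} → v ∈ T → v ∉ S) →
  (∀ {u v} → u ∈ L → v ∈ L → Path (E g) (_∈ L) u v) → (∃ λ s → s ∈ S × s ∈ L) → (∃ λ t → t ∈ T × t ∈ L) →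
  Σ (Entry g S T L) λ e → Entry.entered e ∈ T × Entry.before e ∉ T
find-entry {T = T} T∉S connected (s , s∈S , s∈L) (t , t∈T , t∈L)
  with path-exit {T = _∉ T} (λ v → ¬? (v ∈? T)) (λ s∈T → T∉S s∈T s∈S) (λ t∉ → t∉ t∈T) (connected s∈L t∈L)
... | exit {u} {w} before e w-in after =
  record { origin∈S = s∈S ; entered∈L = path-start after ; path = before ; edge = e } ,
  decidable-stable (w ∈? T) w-in , proj₂ (path-end before)

module Landing {m} {g : SGraph m} {D : RectData m} {h w} (r : IsRect g D h w) (0<h : 0 < h) {S T : Subset m}
               (D⊆T : ∀ {y x v} → y < h → x < w → v ∈ RectData.B D y x → v ∈ T)
               {q} (L : Fin q → Subset m) (L-disjoint : ∀ {i j v} → v ∈ L i → v ∈ L j → i ≡ j)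
               (entry : ∀ i → Entry g S T (L i)) where
  open Entry

  module _ {k} (c : Fin k → Fin w) (increasing : ∀ i j → toℕ i < toℕ j → toℕ (c i) < toℕ (c j))
           (p : Fin k → Fin q) (p-injective : ∀ {i j} → p i ≡ p j → i ≡ j)
           (landing : ∀ i → entered (entry (p i)) ∈ RectData.B D 0 (toℕ (c i))) where
    private
      off? : ∀ j v → Dec (v ∈ L (p j) × v ∉ T)
      off? j v = (v ∈? L (p j)) ×-dec ¬? (v ∈? T)
      -- Only the part of the linkage member that is connected to its origin outside `T` is used,
      -- since the rest may run through the band and collide with the rows.
      approach : Fin k → Subset m
      approach j = reach (E? g) (off? j) (origin (entry (p j)))
      approach⁻ : ∀ j {v} → v ∈ approach j → v ∈ L (p j) × v ∉ T
      approach⁻ j v∈ = path-end (reach⁻ (E? g) (off? j) _ v∈)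
      approach-path : ∀ j {v} → v ∈ approach j → Path (E g) (_∈ approach j) (origin (entry (p j))) v
      approach-path j = reach-path (E? g) (off? j) _ (E-sym g)
      open Group r 0<h c increasing approach
        (λ {i} {j} a b → p-injective (L-disjoint (proj₁ (approach⁻ i a)) (proj₁ (approach⁻ j b))))
        (λ {i} y< x< a b → proj₂ (approach⁻ i a) (D⊆T y< x< b))
        (λ {i} a b → path-rev (E-sym g) (approach-path i a) ◅◅ approach-path i b)
        (λ i → _ , _ , reach⁺ (E? g) (off? i) _ (path (entry (p i))) , landing i , edge (entry (p i)))

    group-rooted : TopRooted g S h k
    group-rooted = groups , grouped , λ x x<k →
      let i = fromℕ< x<k in
      origin (entry (p i)) , subst (λ t → origin (entry (p i)) ∈ RectData.B groups 0 t) (toℕ-fromℕ< x<k)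
            (root⊆top i (reach⁺ (E? g) (off? i) _ (here (path-start (path (entry (p i))))))) , origin∈S (entry (p i))

  -- The last hypothesis says that a column offers a single vertex of entry. Members of the linkage
  -- are disjoint, so they must then land in different columns.
  land : ∀ k (column : Fin q → Fin w) (I : Subset q) → k ≤ ∣ I ∣ →
    (∀ i → i ∈ I → entered (entry i) ∈ RectData.B D 0 (toℕ (column i))) →
    (∀ {i j} → i ∈ I → j ∈ I → column i ≡ column j → entered (entry i) ≡ entered (entry j)) →
    TopRooted g S h k
  land k column I k≤ landing distinct with select k column I k≤
      (λ {i} {j} i∈ j∈ eq → L-disjoint (entered∈L (entry i)) (subst (_∈ L j) (≡-sym (distinct i∈ j∈ eq)) (entered∈L (entry j))))
  ... | c , increasing , p , p∈ , p-column = group-rooted c increasing p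
          (λ {i} {j} eq → increasing⇒injective increasing (trans (≡-sym (p-column i)) (trans (cong column eq) (p-column j))))
          (λ i → subst (λ x → entered (entry (p i)) ∈ RectData.B D 0 (toℕ x)) (p-column i) (landing (p i) (p∈ i)))

-- Grids in critical graphs

module GridLinkage {m} (D : RectData m) (N : ℕ) where
  open RectData D

  -- These pairs are protected: those inside a branch set, and the one chosen connection between
  -- neighbouring branch sets. Deleting any other edge leaves `D` a grid, and a single chosen
  -- connection is what later makes the vertex of entry unique.
  GridEdge : Fin m → Fin m → Set
  GridEdge u v = ∃₂ λ (y x : Fin N) →
    (u ∈ B (toℕ y) (toℕ x) × v ∈ B (toℕ y) (toℕ x)) ⊎
    (suc (toℕ x) < N × SameEdge (right₁ (toℕ y) (toℕ x)) (right₂ (toℕ y) (toℕ x)) u v) ⊎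
    (suc (toℕ y) < N × SameEdge (down₁ (toℕ y) (toℕ x)) (down₂ (toℕ y) (toℕ x)) u v)

  gridEdge? : ∀ u v → Dec (GridEdge u v)
  gridEdge? u v = any? λ y → any? λ x →
    ((u ∈? B (toℕ y) (toℕ x)) ×-dec (v ∈? B (toℕ y) (toℕ x))) ⊎-dec
    (((suc (toℕ x) <? N) ×-dec sameEdge? _ _ u v) ⊎-dec ((suc (toℕ y) <? N) ×-dec sameEdge? _ _ u v))

  gridEdge-sym : ∀ {u v} → GridEdge u v → GridEdge v u
  gridEdge-sym (y , x , inj₁ (p , q)) = y , x , inj₁ (q , p)
  gridEdge-sym (y , x , inj₂ (inj₁ (l , s))) = y , x , inj₂ (inj₁ (l , SameEdge-swap s))
  gridEdge-sym (y , x , inj₂ (inj₂ (l , s))) = y , x , inj₂ (inj₂ (l , SameEdge-swap s))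

  module _ {g : SGraph m} {a b} (¬grid : ¬ GridEdge a b) where
    private
      keep : ∀ {u v} → GridEdge u v → E g u v → E (deleteEdge g a b) u v
      keep ge e = e , λ { (inj₁ (refl , refl)) → ¬grid ge ; (inj₂ (refl , refl)) → ¬grid (gridEdge-sym ge) }

      at : ∀ (P : ℕ → ℕ → Set) {y x} (y< : y < N) (x< : x < N) → P y x → P (toℕ (fromℕ< y<)) (toℕ (fromℕ< x<))
      at P y< x< = subst₂ P (≡-sym (toℕ-fromℕ< y<)) (≡-sym (toℕ-fromℕ< x<))

    delete-rect : IsRect g D N N → IsRect (deleteEdge g a b) D N N
    delete-rect r = record
      { disjoint = disjoint ; nonempty = nonempty
      ; connected = λ {y} {x} y< x< u∈ v∈ → path-map
          (λ u∈ v∈ → keep (fromℕ< y< , fromℕ< x< , inj₁ (at (λ y x → _ ∈ B y x) y< x< u∈ , at (λ y x → _ ∈ B y x) y< x< v∈)))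
          id (connected y< x< u∈ v∈)
      ; rightward = λ {y} {x} y< x+1< → let (p , q , e) = rightward y< x+1< ; x< = <⇒≤ x+1< in
          p , q , keep (fromℕ< y< , fromℕ< x< , inj₂ (inj₁
            (at (λ y x' → suc x' < N × SameEdge (right₁ y x') (right₂ y x') (right₁ _ x) (right₂ _ x)) y< x< (x+1< , inj₁ (refl , refl))))) e
      ; downward = λ {y} {x} y+1< x< → let (p , q , e) = downward y+1< x< ; y< = <⇒≤ y+1< in
          p , q , keep (fromℕ< y< , fromℕ< x< , inj₂ (inj₂
            (at (λ y' x → suc y' < N × SameEdge (down₁ y' x) (down₂ y' x) (down₁ y _) (down₂ y _)) y< x< (y+1< , inj₁ (refl , refl))))) e
      }
      where open IsRect r

  Sep : ∀ {g} → IsRect g D N N → Subset m → Subset m → Set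
  Sep r S Z = Separation.Separating (GridCore.gridCore r) S Z

  GridLinked : ∀ {g} → IsRect g D N N → Subset m → ℕ → Set
  GridLinked r S q = Separation.Linked≥ (GridCore.gridCore r) S q

  Cut : ∀ {g} → IsRect g D N N → Subset m → ℕ → Set
  Cut r S q = ∃ λ Z → ∣ Z ∣ < q × Sep r S Z

  linked⊎cut : ∀ {g} (r : IsRect g D N N) S q → GridLinked r S q ⊎ Cut r S q
  linked⊎cut r S q with anySubset? (λ Z → (∣ Z ∣ <? q) ×-dec Separation.separating? (GridCore.gridCore r) S Z)
  ... | yes cut = inj₂ cut
  ... | no none = inj₁ (λ Z Z<q sep → none (Z , Z<q , sep))

  -- Minimality of the edges forces the region beyond the closest cut to consist of grid edges.
  -- Minimality of the sources supplies the cut from which the closest one is obtained.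
  record Critical (g₀ : SGraph m) (S₀ : Subset m) (q : ℕ) : Set₁ where
    field
      g       : SGraph m
      S       : Subset m
      r       : IsRect g D N N
      g⊆g₀    : ∀ {x y} → E g x y → E g₀ x y
      S⊆S₀    : S ⊆ S₀
      linked  : GridLinked r S q
      edges   : ∀ a b → E g a b → ¬ GridEdge a b → ∃ λ (¬grid : ¬ GridEdge a b) → Cut (delete-rect ¬grid r) S q
      sources : ∀ s → s ∈ S → Cut r (S - s) q

  criticalise : ∀ {g₀ S₀ q} (r : IsRect g₀ D N N) → GridLinked r S₀ q → Critical g₀ S₀ q
  criticalise {g₀} {S₀} {q} r₀ linked₀ = go _ g₀ S₀ r₀ ≤-refl id id linked₀
    where
    go : ∀ fuel g S (r : IsRect g D N N) → ∣ edgeSet g ∣ + ∣ S ∣ < fuel → (∀ {x y} → E g x y → E g₀ x y) → S ⊆ S₀ →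
      GridLinked r S q → Critical g₀ S₀ q
    go (suc fuel) g S r bound sub subS linked with finite-choice (λ a → finite-choice (try-edge a)) | finite-choice try-source
      where
      try-edge : ∀ a b → (E g a b × ∃ λ (¬grid : ¬ GridEdge a b) → GridLinked (delete-rect ¬grid r) S q) ⊎
        (E g a b → ¬ GridEdge a b → ∃ λ (¬grid : ¬ GridEdge a b) → Cut (delete-rect ¬grid r) S q)
      try-edge a b with E? g a b | gridEdge? a b
      ... | no ¬e | _ = inj₂ λ e → contradiction e ¬e
      ... | yes _ | yes ge = inj₂ λ _ ¬ge → contradiction ge ¬ge
      ... | yes e | no ¬ge with linked⊎cut (delete-rect ¬ge r) S q
      ...   | inj₁ l = inj₁ (e , ¬ge , l)
      ...   | inj₂ c = inj₂ λ _ _ → ¬ge , c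
      try-source : ∀ s → (s ∈ S × GridLinked r (S - s) q) ⊎ (s ∈ S → Cut r (S - s) q)
      try-source s with s ∈? S | linked⊎cut r (S - s) q
      ... | no s∉ | _ = inj₂ λ s∈ → contradiction s∈ s∉
      ... | yes s∈ | inj₁ l = inj₁ (s∈ , l)
      ... | yes _ | inj₂ c = inj₂ λ _ → c
    ... | inj₁ (a , b , e , ¬ge , l) | _ = go fuel (deleteEdge g a b) S (delete-rect ¬ge r)
            (<-≤-trans (ℕₚ.+-monoˡ-< ∣ S ∣ (deleteEdge-decreases g a b e)) (ℕₚ.≤-pred bound)) (sub ∘ proj₁) subS l
    ... | inj₂ _ | inj₁ (s , s∈ , l) = go fuel g (S - s) r
            (<-≤-trans (ℕₚ.+-monoʳ-< ∣ edgeSet g ∣ (x∈p⇒∣p-x∣<∣p∣ s∈)) (ℕₚ.≤-pred bound)) sub (subS ∘ p─q⊆p S ⁅ s ⁆) l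
    ... | inj₂ edges | inj₂ sources = record
            { g = g ; S = S ; r = r ; g⊆g₀ = sub ; S⊆S₀ = subS ; linked = linked ; edges = edges ; sources = sources }

  module FromCritical {g₀ S₀ q} (crit : Critical g₀ S₀ q) (0<q : 0 < q) (2q<N : q + q < N) where
    open Critical crit
    open IsRect r
    open GridCore r
    open Core gridCore
    open Separation gridCore S

    q<N : q < N
    q<N = ≤-<-trans (m≤m+n q q) 2q<N

    core∩S : ∀ Z → ∣ Z ∣ < q → ∃ λ s → s ∈ core Z × s ∈ S
    core∩S Z Z<q with any? (λ s → (s ∈? core Z) ×-dec (s ∈? S))
    ... | yes p = p
    ... | no none = contradiction (λ v v∈ v∈S → none (v , v∈ , v∈S)) (linked Z Z<q)

    abstract
     -- Some source `s` exists, because the empty set does not separate. A cut of fewer than `q`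
     -- vertices for `S - s`, together with `s`, is a separator for `S` of at most `q` vertices.
     nearest : ∃ (Closest q)
     nearest =
      let (s , _ , s∈S) = core∩S ⊥ (subst (λ t → t < q) (≡-sym (∣⊥∣≡0 m)) 0<q)
          (Z , Z<q , sepZ) = sources s s∈S
          Zs≤ = ≤-trans (∣p∪⁅x⁆∣≤1+∣p∣ Z s) Z<q
      in closest 2q<N linked (Z ∪ ⁅ s ⁆) Zs≤ (λ v v∈ v∈S →
           sepZ v (monotone (≤-<-trans Zs≤ q<N) (p⊆p∪q ⁅ s ⁆) v∈)
             (x∈p∧x≢y⇒x∈p-y v∈S (λ { refl → avoids v∈ (x∈p∪⁅x⁆ Z s) })))

    P = proj₁ nearest
    P≤q = proj₁ (proj₂ nearest)
    sepP = proj₁ (proj₂ (proj₂ nearest))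
    P-closest = proj₂ (proj₂ (proj₂ nearest))

    -- If another edge started at `a`, its deletion would create a cut `Z` below `q`. Adding `a` to
    -- `Z` gives a separator of the undeleted graph with at most `q` vertices, so closeness would
    -- place `a` in a core that avoids `a`.
    core-edges : ∀ {a b} → a ∈ core P → E g a b → GridEdge a b
    core-edges {a} {b} a∈ e = decidable-stable (gridEdge? a b) impossible
      where
      impossible : ¬ ¬ GridEdge a b
      impossible ¬ge with edges a b e ¬ge
      ... | ¬grid , Z , Z<q , sepZ = avoids (P-closest (Z ∪ ⁅ a ⁆) Za≤ separating a∈) (x∈p∪⁅x⁆ Z a)
        where
        r' = delete-rect ¬grid r
        Za≤ : ∣ Z ∪ ⁅ a ⁆ ∣ ≤ q
        Za≤ = ≤-trans (∣p∪⁅x⁆∣≤1+∣p∣ Z a) Z<q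
        Z⊆ : Z ⊆ Z ∪ ⁅ a ⁆
        Z⊆ = p⊆p∪q ⁅ a ⁆
        ≢a : ∀ {x} → x ∉ Z ∪ ⁅ a ⁆ → x ≢ a
        ≢a x∉ refl = x∉ (x∈p∪⁅x⁆ Z a)
        separating : Separating (Z ∪ ⁅ a ⁆)
        -- The core in `g` is carried over to the core in the smaller graph: both contain the same
        -- free row, and a path avoiding `a` never uses the deleted edge.
        separating v v∈ = let (y , x , c , y< , x< , free , c∈ , p) = core-base {Z ∪ ⁅ a ⁆} v∈ in
          sepZ v (path-stays {P = _∉ Z} {T = _∈ Core.core (GridCore.gridCore r') Z}
            (Core.closed (GridCore.gridCore r'))
            (GridCore.row⊆core r' (<-trans Z<q q<N) y< x< (λ x v x< v∈ v∈Z → free x v x< v∈ (Z⊆ v∈Z)) c∈)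
            (path-map {Q = _∉ Z} (λ u∉ v∉ e → e , λ { (inj₁ (refl , _)) → ≢a u∉ refl ; (inj₂ (_ , refl)) → ≢a v∉ refl })
              (λ u∉ u∈Z → u∉ (Z⊆ u∈Z)) p))

    module _ {s} (0<s : 0 < s) (bands : suc q * s ≤ N) where
      private
        abstract
          -- There are q + 1 bands and at most `q` vertices in `P`. A band missed by `P` lies in
          -- `core P`, where there are no sources and every edge is a grid edge.
          band : ∃ λ a → a + s ≤ N × (∀ y → a ≤ y → y < a + s → FreeRow r P y)
          band = free-band r (suc q) s P bands (s≤s P≤q)
        a = proj₁ band
        a+s≤N = proj₁ (proj₂ band)
        free = proj₂ (proj₂ band)

      Band : ℕ → Set
      Band y = a ≤ y × y < a + s

      band-< : ∀ {y} → Band y → y < N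
      band-< (_ , y<) = <-≤-trans y< a+s≤N

      InBand : Fin m → Set
      InBand v = ∃₂ λ (y x : Fin N) → Band (toℕ y) × v ∈ B (toℕ y) (toℕ x)

      inBand? : ∀ v → Dec (InBand v)
      inBand? v = any? λ y → any? λ x → ((a ≤? toℕ y) ×-dec (toℕ y <? a + s)) ×-dec (v ∈? B (toℕ y) (toℕ x))

      T = fromDec inBand?

      T⁺ : ∀ {y x v} → Band y → x < N → v ∈ B y x → v ∈ T
      T⁺ {y} {x} {v} b x< v∈ = ∈-fromDec⁺ inBand? (fromℕ< (band-< b) , fromℕ< x< ,
        subst₂ (λ y x → Band y × v ∈ B y x) (≡-sym (toℕ-fromℕ< (band-< b))) (≡-sym (toℕ-fromℕ< x<)) (b , v∈))

      T⊆core : ∀ {v} → v ∈ T → v ∈ core P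
      T⊆core v∈ = let (y , x , (l , u) , v∈B) = ∈-fromDec⁻ inBand? v∈ in
        row⊆core (≤-<-trans P≤q q<N) (toℕ<n y) (toℕ<n x) (free (toℕ y) l u) v∈B

      top-band : Band a
      top-band = ≤-refl , ≤-trans (≤-reflexive (+-comm 1 a)) (+-monoʳ-≤ a 0<s)

      -- Fewer than `q` deleted vertices leave a source in the core and a column free. The column
      -- crosses the band and belongs to the same core.
      linked-to-band : ∀ Z → ∣ Z ∣ < q → ¬ Separates g S T Z
      linked-to-band Z Z<q sepZ with core∩S Z Z<q | free-column Z (<-trans Z<q q<N)
      ... | o , o∈core , o∈S | x , x< , free-x with nonempty (band-< top-band) x<
      ...   | v , v∈ = sepZ o∈S (T⁺ top-band x< v∈)
              (connects {Z} o∈core (column⊆core {Z} (<-trans Z<q q<N) (band-< top-band) x< free-x v∈))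

      abstract
        band-linkage : Linkage (E g) S T q
        band-linkage = [ (λ (Z , Z<q , sepZ) → absurd (linked-to-band Z Z<q sepZ)) , id ]′ (menger g S T q)

      open Linkage band-linkage using (L) renaming (disjoint to L-disjoint; connected to L-connected; source to L-source; target to L-target)

      -- The equation with the chosen end of the vertical edge is recorded because it shows that two
      -- entries on the same side of a column are the same vertex.
      EntersTop EntersBottom : Fin N → Fin m → Set
      EntersTop x w = ∃ λ y → suc y ≡ a × w ≡ down₂ y (toℕ x) × w ∈ B a (toℕ x)
      EntersBottom x w = ∃ λ y → suc y ≡ a + s × w ≡ down₁ y (toℕ x) × w ∈ B y (toℕ x)

      -- Branch sets and horizontal edges stay within a row. A grid edge entering the band from
      -- outside is therefore vertical and crosses one of its two borders.
      entry-kind : ∀ {w u} → u ∉ T → InBand w → GridEdge w u → ∃ λ x → EntersTop x w ⊎ EntersBottom x w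
      entry-kind u∉T (y , x , b , w∈) (y' , x' , inj₁ (w∈' , u∈')) =
        let (p , _) = disjoint (toℕ<n y) (toℕ<n x) (toℕ<n y') (toℕ<n x') w∈ w∈' in
        contradiction (T⁺ (subst Band p b) (toℕ<n x') u∈') u∉T
      entry-kind u∉T (y , x , b , w∈) (y' , x' , inj₂ (inj₁ (x'+1< , inj₁ (refl , refl)))) =
        let (w∈' , u∈' , _) = rightward (toℕ<n y') x'+1<
            (p , _) = disjoint (toℕ<n y) (toℕ<n x) (toℕ<n y') (toℕ<n x') w∈ w∈' in
        contradiction (T⁺ (subst Band p b) x'+1< u∈') u∉T
      entry-kind u∉T (y , x , b , w∈) (y' , x' , inj₂ (inj₁ (x'+1< , inj₂ (refl , refl)))) =
        let (u∈' , w∈' , _) = rightward (toℕ<n y') x'+1<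
            (p , _) = disjoint (toℕ<n y) (toℕ<n x) (toℕ<n y') x'+1< w∈ w∈' in
        contradiction (T⁺ (subst Band p b) (toℕ<n x') u∈') u∉T
      entry-kind u∉T (y , x , b , w∈) (y' , x' , inj₂ (inj₂ (y'+1< , inj₁ (refl , refl)))) =
        let (w∈' , u∈' , _) = downward y'+1< (toℕ<n x')
            (p , _) = disjoint (toℕ<n y) (toℕ<n x) (toℕ<n y') (toℕ<n x') w∈ w∈'
            (l , h) = subst Band p b
        in x' , inj₂ (toℕ y' , ≤-antisym h (≮⇒≥ (λ lt → u∉T (T⁺ (≤-trans l (n≤1+n _) , lt) (toℕ<n x') u∈'))) , refl , w∈')
      entry-kind u∉T (y , x , b , w∈) (y' , x' , inj₂ (inj₂ (y'+1< , inj₂ (refl , refl)))) =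
        let (u∈' , w∈' , _) = downward y'+1< (toℕ<n x')
            (p , _) = disjoint (toℕ<n y) (toℕ<n x) y'+1< (toℕ<n x') w∈ w∈'
            (l , h) = subst Band p b
            eq = ≤-antisym (≰⇒> (λ le → u∉T (T⁺ (le , <⇒≤ h) (toℕ<n x') u∈'))) l
        in x' , inj₁ (toℕ y' , eq , refl , subst (λ t → _ ∈ B t (toℕ x')) eq w∈')

      abstract
        entering : ∀ i → Σ (Entry g S T (L i)) λ e → ∃ λ x → EntersTop x (Entry.entered e) ⊎ EntersBottom x (Entry.entered e)
        entering i = let (e , w∈T , u∉T) = find-entry {g = g} {S} {T} {L i} (λ v∈T → sepP _ (T⊆core v∈T)) L-connected (L-source i) (L-target i) in
          e , entry-kind u∉T (∈-fromDec⁻ inBand? w∈T) (core-edges (T⊆core w∈T) (E-sym g (Entry.edge e)))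

      private
        entry : ∀ i → Entry g S T (L i)
        entry i = proj₁ (entering i)

        column : Fin q → Fin N
        column i = proj₁ (proj₂ (entering i))

        IsTop : ∀ {A B : Set} → A ⊎ B → Set
        IsTop (inj₁ _) = Unit
        IsTop (inj₂ _) = Void

        isTop? : ∀ {A B : Set} (x : A ⊎ B) → Dec (IsTop x)
        isTop? (inj₁ _) = yes tt
        isTop? (inj₂ _) = no id

        is-top : ∀ {A B : Set} (x : A ⊎ B) → IsTop x → A
        is-top (inj₁ a) _ = a

        not-top : ∀ {A B : Set} (x : A ⊎ B) → ¬ IsTop x → B
        not-top (inj₁ _) ¬t = contradiction tt ¬t
        not-top (inj₂ b) _ = b

        kind? : ∀ i → Dec (IsTop (proj₂ (proj₂ (entering i))))
        kind? i = isTop? (proj₂ (proj₂ (entering i)))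

        I : Subset q
        I = fromDec kind?

        top : ∀ {i} → i ∈ I → EntersTop (column i) (Entry.entered (entry i))
        top {i} i∈ = is-top (proj₂ (proj₂ (entering i))) (∈-fromDec⁻ kind? i∈)

        bottom : ∀ {i} → i ∈ ∁ I → EntersBottom (column i) (Entry.entered (entry i))
        bottom {i} i∈ = not-top (proj₂ (proj₂ (entering i))) (λ t → x∈∁p⇒x∉p i∈ (∈-fromDec⁺ kind? t))

        shifted : IsRect g (shift-data D a) s N
        shifted = shift-rect r a s a+s≤N

        flipped : IsRect g (flip-data (shift-data D a) s) s N
        flipped = flip-rect shifted

        bottom-row : ∀ {y} → suc y ≡ a + s → y ≡ a + (s ∸ 1)
        bottom-row y≡ = ℕₚ.suc-injective (trans y≡ (trans (cong (a +_) (∸-step s 0 0<s)) (+-suc a _)))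

      -- One of the two borders receives at least `k` of the `q` entries. If it is the lower one,
      -- the band is turned upside down.
      band-rooted : ∀ k → k + k ≤ suc q → TopRooted g S s k
      band-rooted k 2k≤ with half k 2k≤ I
      ... | inj₁ k≤ = Landing.land shifted 0<s {T = T}
              (λ {y} {x} y< x< v∈ → T⁺ {a + y} (m≤m+n a y , ℕₚ.+-monoʳ-< a y<) x< v∈) L L-disjoint entry k column I k≤
              (λ i i∈ → let (_ , _ , _ , w∈) = top i∈ in
                subst (λ t → Entry.entered (entry i) ∈ B t (toℕ (column i))) (≡-sym (+-identityʳ a)) w∈)
              (λ i∈ j∈ eq → let (y , y≡ , w≡ , _) = top i∈ ; (y' , y'≡ , w'≡ , _) = top j∈ in
                trans w≡ (trans (cong₂ down₂ (ℕₚ.suc-injective (trans y≡ (≡-sym y'≡))) (cong toℕ eq)) (≡-sym w'≡)))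
      ... | inj₂ k≤ = Landing.land flipped 0<s {T = T}
              (λ {y} {x} y< x< v∈ → T⁺ {a + (s ∸ suc y)} (m≤m+n a _ , ℕₚ.+-monoʳ-< a (ℕₚ.∸-monoʳ-< {s} {suc y} {0} (s≤s z≤n) y<)) x< v∈)
              L L-disjoint entry k column (∁ I) k≤
              (λ i i∈ → let (y , y≡ , _ , w∈) = bottom i∈ in
                subst (λ t → Entry.entered (entry i) ∈ B t (toℕ (column i))) (bottom-row y≡) w∈)
              (λ i∈ j∈ eq → let (y , y≡ , w≡ , _) = bottom i∈ ; (y' , y'≡ , w'≡ , _) = bottom j∈ in
                trans w≡ (trans (cong₂ down₁ (ℕₚ.suc-injective (trans y≡ (≡-sym y'≡))) (cong toℕ eq)) (≡-sym w'≡)))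

-- Routing

-- Routing a top-rooted grid of height 2ℓ and width 4ℓ, where ℓ = suc k: the ℓ × ℓ subgrid below
-- columns 2ℓ, …, 3ℓ - 1 is the target; its left and right columns reach the top by nested hooks
-- in the ℓ columns beside it, and its bottom row by nested hooks around the left of those.
module Routing (k : ℕ) where
  private
    ℓ ℓ₂ ℓ₃ ℓ₄ : ℕ
    ℓ = suc k
    ℓ₂ = ℓ + ℓ
    ℓ₃ = ℓ₂ + ℓ
    ℓ₄ = ℓ₃ + ℓ

    -- The number of the bottom hook through a cell. Hook j descends in column k - j, runs along row
    -- ℓ + j and rises in column 2ℓ + j; on each of these pieces one of the three terms attains the
    -- maximum.
    depth : ℕ → ℕ → ℕ
    depth y x = (x ∸ ℓ₂) ⊔ (y ∸ ℓ) ⊔ (k ∸ x)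

    -- Each formula determines i and j from the cell, so the regions are disjoint once the four
    -- zones are. The maxima describe nested hooks by level sets instead of listing their pieces.
    Left Centre Right Bottom Region : ℕ → ℕ → ℕ → ℕ → Set
    Left   i j y x = y < ℓ × ℓ ≤ x × x < ℓ₂ × i ≡ ((k + ℓ) ∸ x) ⊔ y × j ≡ 0
    Centre i j y x = y < ℓ × i ≡ y × j < ℓ × x ≡ ℓ₂ + j
    Right  i j y x = y < ℓ × ℓ₃ ≤ x × x < ℓ₄ × i ≡ (x ∸ ℓ₃) ⊔ y × j ≡ k
    Bottom i j y x = y < ℓ₂ × x < ℓ₃ × (ℓ ≤ y ⊎ x < ℓ) × i ≡ k × j ≡ depth y x
    Region i j y x = Left i j y x ⊎ Centre i j y x ⊎ Right i j y x ⊎ Bottom i j y x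

    region? : ∀ i j y x → Dec (Region i j y x)
    region? i j y x =
      ((y <? ℓ) ×-dec ((ℓ ≤? x) ×-dec ((x <? ℓ₂) ×-dec ((i ≟ℕ _) ×-dec (j ≟ℕ 0))))) ⊎-dec
      (((y <? ℓ) ×-dec ((i ≟ℕ y) ×-dec ((j <? ℓ) ×-dec (x ≟ℕ _)))) ⊎-dec
      (((y <? ℓ) ×-dec ((ℓ₃ ≤? x) ×-dec ((x <? ℓ₄) ×-dec ((i ≟ℕ _) ×-dec (j ≟ℕ k))))) ⊎-dec
      ((y <? ℓ₂) ×-dec ((x <? ℓ₃) ×-dec (((ℓ ≤? y) ⊎-dec (x <? ℓ)) ×-dec ((i ≟ℕ k) ×-dec (j ≟ℕ _)))))))

    ℓ≤ℓ₂ : ℓ ≤ ℓ₂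
    ℓ≤ℓ₂ = m≤m+n ℓ ℓ
    ℓ₂≤ℓ₃ : ℓ₂ ≤ ℓ₃
    ℓ₂≤ℓ₃ = m≤m+n ℓ₂ ℓ
    ℓ₃≤ℓ₄ : ℓ₃ ≤ ℓ₄
    ℓ₃≤ℓ₄ = m≤m+n ℓ₃ ℓ

    clash : ∀ {A : Set} {a b} → a < b → b ≤ a → A
    clash a<b b≤a = contradiction b≤a (<⇒≱ a<b)

    centre-range : ∀ {j x} → j < ℓ → x ≡ ℓ₂ + j → ℓ₂ ≤ x × x < ℓ₃
    centre-range {j} j< refl = m≤m+n ℓ₂ j , ℕₚ.+-monoʳ-< ℓ₂ j<

    off-bottom : ∀ {A : Set} {y x} → y < ℓ → ℓ ≤ x → ℓ ≤ y ⊎ x < ℓ → A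
    off-bottom y< ℓ≤x (inj₁ ℓ≤y) = clash y< ℓ≤y
    off-bottom y< ℓ≤x (inj₂ x<) = clash x< ℓ≤x

    region-unique : ∀ {i j i' j' y x} → Region i j y x → Region i' j' y x → i ≡ i' × j ≡ j'
    region-unique (inj₁ (_ , _ , _ , refl , refl)) (inj₁ (_ , _ , _ , refl , refl)) = refl , refl
    region-unique (inj₁ (_ , _ , x< , _)) (inj₂ (inj₁ (_ , _ , j< , eq))) = clash x< (proj₁ (centre-range j< eq))
    region-unique (inj₁ (_ , _ , x< , _)) (inj₂ (inj₂ (inj₁ (_ , ≤x , _)))) = clash x< (≤-trans ℓ₂≤ℓ₃ ≤x)
    region-unique (inj₁ (y< , ≤x , _)) (inj₂ (inj₂ (inj₂ (_ , _ , c , _)))) = off-bottom y< ≤x c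
    region-unique (inj₂ (inj₁ (_ , _ , j< , eq))) (inj₁ (_ , _ , x< , _)) = clash x< (proj₁ (centre-range j< eq))
    region-unique (inj₂ (inj₁ (_ , refl , _ , p))) (inj₂ (inj₁ (_ , refl , _ , q))) = refl , ℕₚ.+-cancelˡ-≡ ℓ₂ _ _ (trans (≡-sym p) q)
    region-unique (inj₂ (inj₁ (_ , _ , j< , eq))) (inj₂ (inj₂ (inj₁ (_ , ≤x , _)))) = clash (proj₂ (centre-range j< eq)) ≤x
    region-unique (inj₂ (inj₁ (y< , _ , j< , eq))) (inj₂ (inj₂ (inj₂ (_ , _ , c , _)))) = off-bottom y< (≤-trans ℓ≤ℓ₂ (proj₁ (centre-range j< eq))) c
    region-unique (inj₂ (inj₂ (inj₁ (_ , ≤x , _)))) (inj₁ (_ , _ , x< , _)) = clash x< (≤-trans ℓ₂≤ℓ₃ ≤x)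
    region-unique (inj₂ (inj₂ (inj₁ (_ , ≤x , _)))) (inj₂ (inj₁ (_ , _ , j< , eq))) = clash (proj₂ (centre-range j< eq)) ≤x
    region-unique (inj₂ (inj₂ (inj₁ (_ , _ , _ , refl , refl)))) (inj₂ (inj₂ (inj₁ (_ , _ , _ , refl , refl)))) = refl , refl
    region-unique (inj₂ (inj₂ (inj₁ (_ , ≤x , _)))) (inj₂ (inj₂ (inj₂ (_ , x< , _)))) = clash x< ≤x
    region-unique (inj₂ (inj₂ (inj₂ (_ , _ , c , _)))) (inj₁ (y< , ≤x , _)) = off-bottom y< ≤x c
    region-unique (inj₂ (inj₂ (inj₂ (_ , _ , c , _)))) (inj₂ (inj₁ (y< , _ , j< , eq))) = off-bottom y< (≤-trans ℓ≤ℓ₂ (proj₁ (centre-range j< eq))) c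
    region-unique (inj₂ (inj₂ (inj₂ (_ , x< , _)))) (inj₂ (inj₂ (inj₁ (_ , ≤x , _)))) = clash x< ≤x
    region-unique (inj₂ (inj₂ (inj₂ (_ , _ , _ , refl , refl)))) (inj₂ (inj₂ (inj₂ (_ , _ , _ , refl , refl)))) = refl , refl

    region-range : ∀ {i j y x} → Region i j y x → y < ℓ₂ × x < ℓ₄
    region-range (inj₁ (y< , _ , x< , _)) = <-≤-trans y< ℓ≤ℓ₂ , <-≤-trans x< (≤-trans ℓ₂≤ℓ₃ ℓ₃≤ℓ₄)
    region-range (inj₂ (inj₁ (y< , _ , j< , eq))) = <-≤-trans y< ℓ≤ℓ₂ , <-≤-trans (proj₂ (centre-range j< eq)) ℓ₃≤ℓ₄
    region-range (inj₂ (inj₂ (inj₁ (y< , _ , x< , _)))) = <-≤-trans y< ℓ≤ℓ₂ , x<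
    region-range (inj₂ (inj₂ (inj₂ (y< , x< , _)))) = y< , <-≤-trans x< ℓ₃≤ℓ₄

    centre : ∀ {i j} → i < ℓ → j < ℓ → Region i j i (ℓ₂ + j)
    centre i< j< = inj₂ (inj₁ (i< , refl , j< , refl))

    lub : ∀ {a b t} → a ≤ t → b ≤ t → t ≤ b → t ≡ a ⊔ b
    lub {a} {b} a≤ b≤ t≤b = ≤-antisym (≤-trans t≤b (ℕₚ.m≤n⊔m a b)) (ℕₚ.⊔-lub a≤ b≤)

    lub' : ∀ {a b t} → a ≤ t → b ≤ t → t ≤ a ⊔ b → t ≡ a ⊔ b
    lub' a≤ b≤ t≤ = ≤-antisym t≤ (ℕₚ.⊔-lub a≤ b≤)

    left-hook : ∀ {i j y x} → i < ℓ → Left i j y x → Joined (Region i j) y x i (ℓ₂ + j)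
    left-hook {i} {j} {y} {x} i< (y< , ℓ≤x , x<ℓ₂ , eq , refl) =
      via (column-joined y i y≤i vertical) (via (row-joined x (k + ℓ) (ℕₚ.≤-pred x<ℓ₂) horizontal) enter)
      where
      x'≤i : (k + ℓ) ∸ x ≤ i
      x'≤i = subst (λ t → (k + ℓ) ∸ x ≤ t) (≡-sym eq) (ℕₚ.m≤m⊔n _ y)
      y≤i : y ≤ i
      y≤i = subst (λ t → y ≤ t) (≡-sym eq) (ℕₚ.m≤n⊔m ((k + ℓ) ∸ x) y)
      vertical : ∀ y' → y ≤ y' → y' ≤ i → Region i 0 y' x
      vertical y' l u = inj₁ (≤-<-trans u i< , ℓ≤x , x<ℓ₂ ,
        lub' x'≤i u (≤-trans (≤-reflexive eq) (ℕₚ.⊔-monoʳ-≤ ((k + ℓ) ∸ x) l)) , refl)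
      horizontal : ∀ x' → x ≤ x' → x' ≤ k + ℓ → Region i 0 i x'
      horizontal x' l u = inj₁ (i< , ≤-trans ℓ≤x l , s≤s u ,
        lub (≤-trans (ℕₚ.∸-monoʳ-≤ (k + ℓ) l) x'≤i) ≤-refl ≤-refl , refl)
      enter : Joined (Region i 0) i (k + ℓ) i (ℓ₂ + 0)
      enter = subst (λ t → Joined (Region i 0) i (k + ℓ) i t) (≡-sym (+-identityʳ ℓ₂))
        (right (horizontal (k + ℓ) (ℕₚ.≤-pred x<ℓ₂) ≤-refl)
               (subst (λ t → Region i 0 i t) (+-identityʳ ℓ₂) (centre i< (s≤s z≤n))))

    right-hook : ∀ {i j y x} → i < ℓ → Right i j y x → Joined (Region i j) y x i (ℓ₂ + j)
    right-hook {i} {j} {y} {x} i< (y< , ℓ₃≤x , x<ℓ₄ , eq , refl) =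
      via (column-joined y i y≤i vertical) (via (back (row-joined ℓ₃ x ℓ₃≤x horizontal)) (back enter))
      where
      x'≤i : x ∸ ℓ₃ ≤ i
      x'≤i = subst (λ t → x ∸ ℓ₃ ≤ t) (≡-sym eq) (ℕₚ.m≤m⊔n _ y)
      y≤i : y ≤ i
      y≤i = subst (λ t → y ≤ t) (≡-sym eq) (ℕₚ.m≤n⊔m (x ∸ ℓ₃) y)
      vertical : ∀ y' → y ≤ y' → y' ≤ i → Region i k y' x
      vertical y' l u = inj₂ (inj₂ (inj₁ (≤-<-trans u i< , ℓ₃≤x , x<ℓ₄ ,
        lub' x'≤i u (≤-trans (≤-reflexive eq) (ℕₚ.⊔-monoʳ-≤ (x ∸ ℓ₃) l)) , refl)))
      horizontal : ∀ x' → ℓ₃ ≤ x' → x' ≤ x → Region i k i x'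
      horizontal x' l u = inj₂ (inj₂ (inj₁ (i< , l , ≤-<-trans u x<ℓ₄ ,
        lub (≤-trans (ℕₚ.∸-monoˡ-≤ ℓ₃ u) x'≤i) ≤-refl ≤-refl , refl)))
      enter : Joined (Region i k) i (ℓ₂ + k) i ℓ₃
      enter = subst (λ t → Joined (Region i k) i (ℓ₂ + k) i t) (≡-sym (+-suc ℓ₂ k))
        (right (centre i< ≤-refl) (subst (λ t → Region i k i t) (+-suc ℓ₂ k) (horizontal ℓ₃ ≤-refl ℓ₃≤x)))

    bottom-hook : ∀ {i j y x} → j < ℓ → Bottom i j y x → Joined (Region i j) y x i (ℓ₂ + j)
    bottom-hook {i} {j} {y} {x} j< (y< , x<ℓ₃ , c , refl , eq) =
      -- Down to row ℓ + j, right to column 2ℓ + j, then up to the last row of the target.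
      via (column-joined y (ℓ + j) y≤ first) (via (row-joined x (ℓ₂ + j) x≤ second)
        (via (back (column-joined ℓ (ℓ + j) (m≤m+n ℓ j) third))
             (back (down (centre ≤-refl j<) (third ℓ ≤-refl (m≤m+n ℓ j))))))
      where
      a≤j : x ∸ ℓ₂ ≤ j
      a≤j = ≤-trans (ℕₚ.m≤m⊔n (x ∸ ℓ₂) (y ∸ ℓ)) (≤-trans (ℕₚ.m≤m⊔n _ (k ∸ x)) (≤-reflexive (≡-sym eq)))
      b≤j : y ∸ ℓ ≤ j
      b≤j = ≤-trans (ℕₚ.m≤n⊔m (x ∸ ℓ₂) (y ∸ ℓ)) (≤-trans (ℕₚ.m≤m⊔n _ (k ∸ x)) (≤-reflexive (≡-sym eq)))
      c≤j : k ∸ x ≤ j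
      c≤j = ≤-trans (ℕₚ.m≤n⊔m ((x ∸ ℓ₂) ⊔ (y ∸ ℓ)) (k ∸ x)) (≤-reflexive (≡-sym eq))
      y≤ : y ≤ ℓ + j
      y≤ = ≤-trans (ℕₚ.m≤n+m∸n y ℓ) (+-monoʳ-≤ ℓ b≤j)
      x≤ : x ≤ ℓ₂ + j
      x≤ = ≤-trans (ℕₚ.m≤n+m∸n x ℓ₂) (+-monoʳ-≤ ℓ₂ a≤j)
      row<ℓ₂ : ∀ {y'} → y' ≤ ℓ + j → y' < ℓ₂
      row<ℓ₂ u = ≤-<-trans u (ℕₚ.+-monoʳ-< ℓ j<)
      ∸≤ : ∀ {a} b → a ≤ b + j → a ∸ b ≤ j
      ∸≤ {a} b le = ℕₚ.m≤n+o⇒m∸n≤o a b le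
      first : ∀ y' → y ≤ y' → y' ≤ ℓ + j → Region k j y' x
      first y' l u = inj₂ (inj₂ (inj₂ (row<ℓ₂ u , x<ℓ₃ , [ (λ ℓ≤y → inj₁ (≤-trans ℓ≤y l)) , inj₂ ]′ c , refl ,
        lub' (ℕₚ.⊔-lub a≤j (∸≤ ℓ u)) c≤j (≤-trans (≤-reflexive eq)
          (ℕₚ.⊔-monoˡ-≤ (k ∸ x) (ℕₚ.⊔-monoʳ-≤ (x ∸ ℓ₂) (ℕₚ.∸-monoˡ-≤ ℓ l)))))))
      second : ∀ x' → x ≤ x' → x' ≤ ℓ₂ + j → Region k j (ℓ + j) x'
      second x' l u = inj₂ (inj₂ (inj₂ (row<ℓ₂ ≤-refl , ≤-<-trans u (ℕₚ.+-monoʳ-< ℓ₂ j<) , inj₁ (m≤m+n ℓ j) , refl ,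
        lub' (ℕₚ.⊔-lub (∸≤ ℓ₂ u) (∸≤ ℓ ≤-refl)) (≤-trans (ℕₚ.∸-monoʳ-≤ k l) c≤j)
          (≤-trans (≤-reflexive (≡-sym (ℕₚ.m+n∸m≡n ℓ j))) (≤-trans (ℕₚ.m≤n⊔m (x' ∸ ℓ₂) _) (ℕₚ.m≤m⊔n _ (k ∸ x')))))))
      third : ∀ y' → ℓ ≤ y' → y' ≤ ℓ + j → Region k j y' (ℓ₂ + j)
      third y' l u = inj₂ (inj₂ (inj₂ (row<ℓ₂ u , ℕₚ.+-monoʳ-< ℓ₂ j< , inj₁ l , refl ,
        lub' (ℕₚ.⊔-lub (∸≤ ℓ₂ ≤-refl) (∸≤ ℓ u)) (≤-trans (ℕₚ.∸-monoʳ-≤ k x≤) c≤j)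
          (≤-trans (≤-reflexive (≡-sym (ℕₚ.m+n∸m≡n ℓ₂ j))) (≤-trans (ℕₚ.m≤m⊔n _ (y' ∸ ℓ)) (ℕₚ.m≤m⊔n _ (k ∸ (ℓ₂ + j))))))))

    to-centre : ∀ {i j y x} → i < ℓ → j < ℓ → Region i j y x → Joined (Region i j) y x i (ℓ₂ + j)
    to-centre i< j< (inj₁ l) = left-hook i< l
    to-centre i< j< (inj₂ (inj₁ c@(_ , refl , _ , refl))) = stay (inj₂ (inj₁ c))
    to-centre i< j< (inj₂ (inj₂ (inj₁ r))) = right-hook i< r
    to-centre i< j< (inj₂ (inj₂ (inj₂ b))) = bottom-hook j< b

  OnOuter : ℕ → ℕ → Set
  OnOuter i j = (i ≡ 0 ⊎ i ≡ k) ⊎ (j ≡ 0 ⊎ j ≡ k)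

  private
    -- In each case the column solves the formula of the region at y = 0. Corners fall under
    -- whichever side is matched first, as a single root suffices.
    root-column : ∀ {i j} → i < ℓ → j < ℓ → OnOuter i j → ∃ λ x → Region i j 0 x
    root-column {i} {j} i< j< (inj₁ (inj₁ refl)) = _ , centre i< j<
    root-column {i} {j} i< j< (inj₁ (inj₂ refl)) = k ∸ j , inj₂ (inj₂ (inj₂ (s≤s z≤n , <-≤-trans x< (≤-trans ℓ≤ℓ₂ ℓ₂≤ℓ₃) , inj₂ x< , refl ,
        ≡-sym (trans (cong₂ _⊔_ (trans (ℕₚ.⊔-identityʳ _) (ℕₚ.m≤n⇒m∸n≡0 (≤-trans (<⇒≤ x<) ℓ≤ℓ₂))) (ℕₚ.m∸[m∸n]≡n (ℕₚ.≤-pred j<))) refl))))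
      where
      x< : k ∸ j < ℓ
      x< = s≤s (ℕₚ.m∸n≤m k j)
    root-column {i} {j} i< j< (inj₂ (inj₁ refl)) = k + ℓ ∸ i , inj₁ (s≤s z≤n ,
        ℕₚ.m+n≤o⇒m≤o∸n ℓ (≤-trans (≤-reflexive (+-comm ℓ i)) (+-monoˡ-≤ ℓ (ℕₚ.≤-pred i<))) , s≤s (ℕₚ.m∸n≤m (k + ℓ) i) ,
        ≡-sym (trans (ℕₚ.⊔-identityʳ _) (ℕₚ.m∸[m∸n]≡n (≤-trans (ℕₚ.≤-pred i<) (m≤m+n k ℓ)))) , refl)
    root-column {i} {j} i< j< (inj₂ (inj₂ refl)) = ℓ₃ + i , inj₂ (inj₂ (inj₁ (s≤s z≤n , m≤m+n ℓ₃ i , ℕₚ.+-monoʳ-< ℓ₃ i< ,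
        ≡-sym (trans (ℕₚ.⊔-identityʳ _) (ℕₚ.m+n∸m≡n ℓ₃ i)) , refl)))

  module _ {m} {g : SGraph m} {S : Subset m} (rooted : TopRooted g S ℓ₂ ℓ₄) where
    private
      D = proj₁ rooted
      r = proj₁ (proj₂ rooted)
      tops = proj₂ (proj₂ rooted)
      open RectData D
      open IsRect r

      Occupies : ℕ → ℕ → Fin m → Set
      Occupies i j v = ∃₂ λ (y : Fin ℓ₂) (x : Fin ℓ₄) → Region i j (toℕ y) (toℕ x) × v ∈ B (toℕ y) (toℕ x)

      occupies? : ∀ i j v → Dec (Occupies i j v)
      occupies? i j v = any? λ y → any? λ x → region? i j (toℕ y) (toℕ x) ×-dec (v ∈? B (toℕ y) (toℕ x))

      occupy : ∀ {i j y x v} → Region i j y x → v ∈ B y x → v ∈ fromDec (occupies? i j)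
      occupy {i} {j} {y} {x} {v} reg v∈ = let (y< , x<) = region-range reg in
        ∈-fromDec⁺ (occupies? i j) (fromℕ< y< , fromℕ< x< ,
          subst₂ (λ y x → Region i j y x × v ∈ B y x) (≡-sym (toℕ-fromℕ< y<)) (≡-sym (toℕ-fromℕ< x<)) (reg , v∈))

    routed : RectData m
    routed = record
      { B = λ i j → fromDec (occupies? i j)
      ; right₁ = λ i j → right₁ i (ℓ₂ + j) ; right₂ = λ i j → right₂ i (ℓ₂ + j)
      ; down₁ = λ i j → down₁ i (ℓ₂ + j) ; down₂ = λ i j → down₂ i (ℓ₂ + j) }

    routed-rect : IsRect g routed ℓ ℓ
    routed-rect = record
      { disjoint = λ _ _ _ _ v∈ v∈' →
          let (y , x , reg , a) = ∈-fromDec⁻ (occupies? _ _) v∈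
              (y' , x' , reg' , b) = ∈-fromDec⁻ (occupies? _ _) v∈'
              (p , q) = disjoint (toℕ<n y) (toℕ<n x) (toℕ<n y') (toℕ<n x') a b
          in region-unique (subst₂ (Region _ _) p q reg) reg'
      ; nonempty = λ i< j< → let (y< , x<) = region-range (centre i< j<) ; (v , v∈) = nonempty y< x< in v , occupy (centre i< j<) v∈
      ; connected = λ i< j< u∈ v∈ →
          let (y , x , reg , a) = ∈-fromDec⁻ (occupies? _ _) u∈
              (y' , x' , reg' , b) = ∈-fromDec⁻ (occupies? _ _) v∈
          in joined-path r region-range occupy (via (to-centre i< j< reg) (back (to-centre i< j< reg'))) a b
      ; rightward = λ {i} {j} i< j+1< →
          let (y< , x<) = region-range (centre i< j+1<)
              (p , q , e) = rightward y< (subst (λ t → t < ℓ₄) (+-suc ℓ₂ j) x<)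
          in occupy (centre i< (<⇒≤ j+1<)) p ,
             occupy (centre i< j+1<) (subst (λ t → right₂ i (ℓ₂ + j) ∈ B i t) (≡-sym (+-suc ℓ₂ j)) q) , e
      ; downward = λ i+1< j< →
          let (y< , x<) = region-range (centre i+1< j<) ; (p , q , e) = downward y< x<
          in occupy (centre (<⇒≤ i+1<) j<) p , occupy (centre i+1< j<) q , e
      }

    routed-outer : ∀ {i j} → i < ℓ → j < ℓ → OnOuter i j → ∃ λ v → v ∈ RectData.B routed i j × v ∈ S
    routed-outer i< j< out =
      let (x , reg) = root-column i< j< out ; (v , v∈ , v∈S) = tops x (proj₂ (region-range reg)) in v , occupy reg v∈ , v∈S

-- Grid models and rectangles

dist≡1 : ∀ a b → dist a b ≡ 1 → b ≡ suc a ⊎ a ≡ suc b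
dist≡1 zero (suc b) eq = inj₁ eq
dist≡1 (suc a) zero eq = inj₂ eq
dist≡1 (suc a) (suc b) eq = [ inj₁ ∘ cong suc , inj₂ ∘ cong suc ]′ (dist≡1 a b eq)

dist-suc : ∀ a → dist a (suc a) ≡ 1
dist-suc zero = refl
dist-suc (suc a) = dist-suc a

dist+dist≡1 : ∀ a b c d → dist a b + dist c d ≡ 1 →
  (a ≡ b × (d ≡ suc c ⊎ c ≡ suc d)) ⊎ (c ≡ d × (b ≡ suc a ⊎ a ≡ suc b))
dist+dist≡1 a b c d eq with dist a b in p | dist c d in q
dist+dist≡1 a b c d refl | 0 | 1 = inj₁ (ℕₚ.∣m-n∣≡0⇒m≡n p , dist≡1 c d q)
dist+dist≡1 a b c d refl | 1 | 0 = inj₂ (ℕₚ.∣m-n∣≡0⇒m≡n q , dist≡1 a b p)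

rect⇒model : ∀ (G : Graph) (g : SGraph (n G)) → (∀ {x y} → E g x y → Adj G x y) → ∀ {D ℓ} → IsRect g D ℓ ℓ → GridModel G ℓ
rect⇒model G g sub {D} {ℓ} r = record
  { B = λ (i , j) → B (toℕ i) (toℕ j)
  ; disjoint = λ (i , j) (i' , j') ≢ v v∈ v∈' →
      let (p , q) = disjoint (toℕ<n i) (toℕ<n j) (toℕ<n i') (toℕ<n j') v∈ v∈' in ≢ (cong₂ _,_ (toℕ-injective p) (toℕ-injective q))
  ; nonempty = λ (i , j) → nonempty (toℕ<n i) (toℕ<n j)
  ; connected = λ (i , j) u v u∈ v∈ → toWalk (path-map (λ _ _ → sub) id (connected (toℕ<n i) (toℕ<n j) u∈ v∈))
  ; edges = λ (i , j) (i' , j') e → edge (toℕ<n i) (toℕ<n j) (toℕ<n i') (toℕ<n j') (dist+dist≡1 (toℕ i) (toℕ i') (toℕ j) (toℕ j') e)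
  }
  where
  open RectData D
  open IsRect r
  flipped : ∀ {u v} → E g u v → Adj G v u
  flipped e = sub (E-sym g e)
  edge : ∀ {i j i' j'} → i < ℓ → j < ℓ → i' < ℓ → j' < ℓ →
    (i ≡ i' × (j' ≡ suc j ⊎ j ≡ suc j')) ⊎ (j ≡ j' × (i' ≡ suc i ⊎ i ≡ suc i')) →
    ∃₂ λ u v → u ∈ B i j × v ∈ B i' j' × Adj G u v
  edge i< j< i'< j'< (inj₁ (refl , inj₁ refl)) = let (p , q , e) = rightward i< j'< in _ , _ , p , q , sub e
  edge i< j< i'< j'< (inj₁ (refl , inj₂ refl)) = let (p , q , e) = rightward i< j< in _ , _ , q , p , flipped e
  edge i< j< i'< j'< (inj₂ (refl , inj₁ refl)) = let (p , q , e) = downward i'< j< in _ , _ , p , q , sub e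
  edge i< j< i'< j'< (inj₂ (refl , inj₂ refl)) = let (p , q , e) = downward i< j< in _ , _ , q , p , flipped e

module _ (G : Graph) {N : ℕ} (0<N : 0 < N) (M : GridModel G N) where
  open Model M

  private
    at : ∀ {y x} → y < N → x < N → GridV N
    at y< x< = fromℕ< y< , fromℕ< x<

    -- Fills the edge ends at positions outside the grid.
    default : Fin (n G)
    default = proj₁ (nonempty (at 0<N 0<N))

    right-adjacent : ∀ {y x} (y< : y < N) (x+1< : suc x < N) → GridE N (at y< (<⇒≤ x+1<)) (at y< x+1<)
    right-adjacent {y} {x} y< x+1< rewrite toℕ-fromℕ< y< | toℕ-fromℕ< x+1< | toℕ-fromℕ< (<⇒≤ x+1<) | ℕₚ.∣n-n∣≡0 y = dist-suc x

    down-adjacent : ∀ {y x} (y+1< : suc y < N) (x< : x < N) → GridE N (at (<⇒≤ y+1<) x<) (at y+1< x<)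
    down-adjacent {y} {x} y+1< x< rewrite toℕ-fromℕ< x< | toℕ-fromℕ< y+1< | toℕ-fromℕ< (<⇒≤ y+1<) | ℕₚ.∣n-n∣≡0 x = trans (+-identityʳ _) (dist-suc y)

    right-edge : ℕ → ℕ → Fin (n G) × Fin (n G)
    right-edge y x with y <? N | suc x <? N
    ... | yes y< | yes x+1< = let (u , v , _) = edges (at y< (<⇒≤ x+1<)) (at y< x+1<) (right-adjacent y< x+1<) in u , v
    ... | _ | _ = default , default

    down-edge : ℕ → ℕ → Fin (n G) × Fin (n G)
    down-edge y x with suc y <? N | x <? N
    ... | yes y+1< | yes x< = let (u , v , _) = edges (at (<⇒≤ y+1<) x<) (at y+1< x<) (down-adjacent y+1< x<) in u , v
    ... | _ | _ = default , default

    branch : ℕ → ℕ → Subset (n G)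
    branch y x with y <? N | x <? N
    ... | yes y< | yes x< = B (at y< x<)
    ... | _ | _ = ⊥

    branch≡ : ∀ {y x} (y< : y < N) (x< : x < N) → branch y x ≡ B (at y< x<)
    branch≡ {y} {x} y< x< with y <? N | x <? N
    ... | yes _ | yes _ = refl
    ... | no ¬y< | _ = contradiction y< ¬y<
    ... | yes _ | no ¬x< = contradiction x< ¬x<

  model-data : RectData (n G)
  model-data = record
    { B = branch ; right₁ = λ y x → proj₁ (right-edge y x) ; right₂ = λ y x → proj₂ (right-edge y x)
    ; down₁ = λ y x → proj₁ (down-edge y x) ; down₂ = λ y x → proj₂ (down-edge y x) }

  private
    into : ∀ {y x v} (y< : y < N) (x< : x < N) → v ∈ B (at y< x<) → v ∈ branch y x
    into {v = v} y< x< v∈ = subst (λ b → v ∈ b) (≡-sym (branch≡ y< x<)) v∈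

    out : ∀ {y x v} (y< : y < N) (x< : x < N) → v ∈ branch y x → v ∈ B (at y< x<)
    out {v = v} y< x< v∈ = subst (λ b → v ∈ b) (branch≡ y< x<) v∈

    at-injective : ∀ {y x y' x'} (y< : y < N) (x< : x < N) (y'< : y' < N) (x'< : x' < N) →
      at y< x< ≡ at y'< x'< → y ≡ y' × x ≡ x'
    at-injective y< x< y'< x'< eq =
      trans (≡-sym (toℕ-fromℕ< y<)) (trans (cong (toℕ ∘ proj₁) eq) (toℕ-fromℕ< y'<)) ,
      trans (≡-sym (toℕ-fromℕ< x<)) (trans (cong (toℕ ∘ proj₂) eq) (toℕ-fromℕ< x'<))

    right-spec : ∀ {y x} (y< : y < N) (x+1< : suc x < N) → proj₁ (right-edge y x) ∈ B (at y< (<⇒≤ x+1<)) ×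
      proj₂ (right-edge y x) ∈ B (at y< x+1<) × Adj G (proj₁ (right-edge y x)) (proj₂ (right-edge y x))
    right-spec {y} {x} y< x+1< with y <? N | suc x <? N
    ... | yes y<' | yes x+1<' = proj₂ (proj₂ (edges (at y<' (<⇒≤ x+1<')) (at y<' x+1<') (right-adjacent y<' x+1<')))
    ... | no ¬y< | _ = contradiction y< ¬y<
    ... | yes _ | no ¬x< = contradiction x+1< ¬x<

    down-spec : ∀ {y x} (y+1< : suc y < N) (x< : x < N) → proj₁ (down-edge y x) ∈ B (at (<⇒≤ y+1<) x<) ×
      proj₂ (down-edge y x) ∈ B (at y+1< x<) × Adj G (proj₁ (down-edge y x)) (proj₂ (down-edge y x))
    down-spec {y} {x} y+1< x< with suc y <? N | x <? N
    ... | yes y+1<' | yes x<' = proj₂ (proj₂ (edges (at (<⇒≤ y+1<') x<') (at y+1<' x<') (down-adjacent y+1<' x<')))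
    ... | no ¬y< | _ = contradiction y+1< ¬y<
    ... | yes _ | no ¬x< = contradiction x< ¬x<

  model-rect : IsRect (fromGraph G) model-data N N
  model-rect = record
    { disjoint = λ {y} {x} {y'} {x'} {v} y< x< y'< x'< v∈ v∈' → decidable-stable ((y ≟ℕ y') ×-dec (x ≟ℕ x'))
        (λ ≢ → disjoint (at y< x<) (at y'< x'<) (λ eq → ≢ (at-injective y< x< y'< x'< eq)) v (out y< x< v∈) (out y'< x'< v∈'))
    ; nonempty = λ y< x< → let (v , v∈) = nonempty (at y< x<) in v , into y< x< v∈
    ; connected = λ y< x< u∈ v∈ → path-weaken (into y< x<) (fromWalk (connected (at y< x<) _ _ (out y< x< u∈) (out y< x< v∈)))
    ; rightward = λ y< x+1< → let (p , q , e) = right-spec y< x+1< in into y< (<⇒≤ x+1<) p , into y< x+1< q , e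
    ; downward = λ y+1< x< → let (p , q , e) = down-spec y+1< x< in into (<⇒≤ y+1<) x< p , into y+1< x< q , e
    }

-- Main argument

rect-map : ∀ {m} {g g' : SGraph m} → (∀ {x y} → E g x y → E g' x y) → ∀ {D h w} → IsRect g D h w → IsRect g' D h w
rect-map sub r = record
  { disjoint = disjoint ; nonempty = nonempty
  ; connected = λ y< x< u∈ v∈ → path-map (λ _ _ → sub) id (connected y< x< u∈ v∈)
  ; rightward = λ y< x< → let (p , q , e) = rightward y< x< in p , q , sub e
  ; downward = λ y< x< → let (p , q , e) = downward y< x< in p , q , sub e
  }
  where open IsRect r

outer-rooted : ∀ (G : Graph) (S : Subset (n G)) (g : SGraph (n G)) (S' : Subset (n G)) → (∀ {x y} → E g x y → Adj G x y) → S' ⊆ S →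
  ∀ k → TopRooted g S' (suc k + suc k) (suc k + suc k + suc k + suc k) → OuterRootedGridModel G S (suc k)
outer-rooted G S g S' sub S'⊆S k rooted = rect⇒model G g sub (routed-rect rooted) ,
  λ (i , j) outer → let (v , v∈ , v∈S') = routed-outer rooted (toℕ<n i) (toℕ<n j) outer in v , v∈ , S'⊆S v∈S'
  where open Routing k

module _ (G : Graph) (S : Subset (n G)) (k : ℕ) (unrooted : ¬ OuterRootedGridModel G S (suc k))
         (N K : ℕ) (tw : ∀ (H : Graph) → ¬ GridModel H N → TwAtMost H K) where
  private
    -- The routing needs 4ℓ rooted columns from one border of the band; twice as many paths
    -- guarantee them.
    width q : ℕ
    width = suc k + suc k + suc k + suc k
    q = width + width

  module _ (N-large : suc (q + q + q) < N) (bands : suc q * (suc k + suc k) ≤ N) where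
    private
      q+q<N : q + q < N
      q+q<N = ≤-<-trans (≤-trans (m≤m+n (q + q) q) (n≤1+n _)) N-large

      linked-impossible : ∀ {g : SGraph (n G)} {D} → (∀ {x y} → E g x y → Adj G x y) → (r : IsRect g D N N) →
        ¬ GridLinkage.GridLinked D N r S q
      linked-impossible {g} {D} sub r linked = unrooted (outer-rooted G S Crit.g Crit.S (sub ∘ Crit.g⊆g₀) Crit.S⊆S₀ k
          (FromCritical.band-rooted crit (s≤s z≤n) q+q<N (s≤s z≤n) bands width (n≤1+n _)))
        where
        open GridLinkage D N
        crit = criticalise r linked
        module Crit = Critical crit

      -- Descends to the size of a minimum cut, since a closest cut is only available at a size
      -- below which nothing separates.
      thin : ∀ {g : SGraph (n G)} {D} (r : IsRect g D N N) → ∀ b Z → ∣ Z ∣ ≤ b → GridLinkage.Sep D N r S Z → b < q →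
        ∃ λ p → p < q × GridLinkage.GridLinked D N r S p × ∃ λ Z → ∣ Z ∣ ≤ p × GridLinkage.Sep D N r S Z
      thin {D = D} r b Z Z≤ sepZ b<q with GridLinkage.linked⊎cut D N r S b
      thin r b Z Z≤ sepZ b<q | inj₁ linked = b , b<q , linked , Z , Z≤ , sepZ
      thin r (suc b) Z Z≤ sepZ b<q | inj₂ (Z' , s≤s Z'≤ , sepZ') = thin r b Z' Z'≤ sepZ' (<⇒≤ b<q)

      -- The vertex is an end of a horizontal grid edge in a row that misses the closest cut. The
      -- row places it in the core, where it is dispensable, and the edge guarantees that its
      -- deletion lowers the number of edges.
      cut-reduces : ∀ {g : SGraph (n G)} {D} → (r : IsRect g D N N) → GridLinkage.Cut D N r S q → Haven g S (suc K) →
        ∃ λ v → Haven (restrict g (⊤ - v)) S (suc K) × ∃ λ u → E g v u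
      cut-reduces {g} {D} r (Z , Z<q , sepZ) hv =
        let (p , p<q , linked , Z' , Z'≤ , sepZ') = thin r _ Z ≤-refl sepZ Z<q
            p≤q = <⇒≤ p<q
            P = closest (≤-<-trans (+-mono-≤ p≤q p≤q) q+q<N) linked Z' Z'≤ sepZ'
            P<N = ≤-<-trans (≤-trans (proj₁ (proj₂ P)) (≤-trans p≤q (m≤m+n q q))) q+q<N
            (y , y< , free) = free-row r (proj₁ P) P<N
            1<N = ≤-trans (s≤s (s≤s z≤n)) N-large
            (v∈ , _ , e) = IsRect.rightward r y< 1<N
        in _ , Irrelevant.haven-without gridCore hv
                 (≤-<-trans (s≤s (+-mono-≤ (+-mono-≤ p≤q p≤q) p≤q)) N-large) linked (proj₂ P)
                 (row⊆core P<N y< (<⇒≤ 1<N) free v∈)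
             , _ , e
        where
        open GridCore r
        open Separation gridCore S

    -- Descent on the number of edges. The treewidth bound asks for the absence of a grid, so every
    -- grid model is refuted: a linked one yields an outer-rooted model, any other a haven in a
    -- graph with fewer edges.
    no-haven : ∀ (g : SGraph (n G)) → (∀ {x y} → E g x y → Adj G x y) → ¬ Haven g S (suc K)
    no-haven g sub = go _ g sub ≤-refl
      where
      go : ∀ fuel (g : SGraph (n G)) → (∀ {x y} → E g x y → Adj G x y) → ∣ edgeSet g ∣ < fuel → ¬ Haven g S (suc K)
      go (suc fuel) g sub bound hv = haven⇒¬treedec g (tw (toGraph g) no-grid) hv
        where
        0<N : 0 < N
        0<N = ≤-trans (s≤s z≤n) N-large
        no-grid : ¬ GridModel (toGraph g) N
        no-grid M = by-linkage (rect-map (fromAdj g) (model-rect (toGraph g) 0<N M))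
          where
          by-linkage : ∀ {D} → IsRect g D N N → Void
          by-linkage {D} r with GridLinkage.linked⊎cut D N r S q
          ... | inj₁ linked = linked-impossible sub r linked
          ... | inj₂ cut = let (v , hv' , u , e) = cut-reduces r cut hv in
                go fuel (restrict g (⊤ - v)) (sub ∘ proj₁)
                  (<-≤-trans (edges-decrease g (restrict g (⊤ - v)) proj₁ e (λ (_ , v∈ , _) → proj₂ (∈--⁻ ⊤ v v∈) refl)) (ℕₚ.≤-pred bound)) hv'

-- Size estimates

private
  square≤fourth : ∀ ℓ → 1 ≤ ℓ → ℓ * ℓ ≤ ℓ ^ 4
  square≤fourth ℓ 1≤ℓ = ≤-trans (≤-reflexive (≡-sym (ℕₚ.*-identityʳ (ℓ * ℓ)))) (≤-trans
    (ℕₚ.*-monoʳ-≤ (ℓ * ℓ) (ℕₚ.*-mono-≤ 1≤ℓ 1≤ℓ)) (≤-reflexive (solve 1 (λ ℓ → (ℓ :* ℓ) :* (ℓ :* ℓ) := ℓ :^ 4) refl ℓ)))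
    where open +-*-Solver

  scale : ∀ c ℓ {X} → 1 ≤ ℓ → X ≤ c * (ℓ * ℓ) → c ≤ 6144 → X ≤ 6144 * ℓ ^ 4
  scale c ℓ 1≤ℓ X≤ c≤ = ≤-trans X≤ (ℕₚ.*-mono-≤ c≤ (square≤fourth ℓ 1≤ℓ))

  linear≤ : ∀ ℓ → 1 ≤ ℓ → ℓ ≤ ℓ * ℓ
  linear≤ ℓ 1≤ℓ = ≤-trans (≤-reflexive (≡-sym (ℕₚ.*-identityʳ ℓ))) (ℕₚ.*-monoʳ-≤ ℓ 1≤ℓ)

  -- With q = 8ℓ the left side plus one is 24ℓ + 2, hence the factor 26 of ℓ².
  width-bound : ∀ ℓ → 1 ≤ ℓ → let w = ℓ + ℓ + ℓ + ℓ ; q = w + w in suc (q + q + q) < 6144 * ℓ ^ 4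
  width-bound ℓ 1≤ℓ = scale 26 ℓ 1≤ℓ (≤-trans (≤-reflexive eq) (≤-trans (+-mono-≤ (ℕₚ.*-monoʳ-≤ 24 (linear≤ ℓ 1≤ℓ)) (ℕₚ.*-monoʳ-≤ 2 (≤-trans 1≤ℓ (linear≤ ℓ 1≤ℓ))))
      (≤-reflexive (≡-sym (ℕₚ.*-distribʳ-+ (ℓ * ℓ) 24 2))))) (ℕₚ.≤ᵇ⇒≤ 26 6144 tt)
    where
    open +-*-Solver
    eq : let w = ℓ + ℓ + ℓ + ℓ ; q = w + w in suc (suc (q + q + q)) ≡ 24 * ℓ + 2 * 1
    eq = solve 1 (λ ℓ → let w = ℓ :+ ℓ :+ ℓ :+ ℓ ; q = w :+ w in con 2 :+ (q :+ q :+ q) := con 24 :* ℓ :+ con 2) refl ℓ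

  -- With q = 8ℓ the product is 16ℓ² + 2ℓ, hence the factor 18 of ℓ².
  band-bound : ∀ ℓ → 1 ≤ ℓ → let w = ℓ + ℓ + ℓ + ℓ ; q = w + w in suc q * (ℓ + ℓ) ≤ 6144 * ℓ ^ 4
  band-bound ℓ 1≤ℓ = scale 18 ℓ 1≤ℓ (≤-trans (≤-reflexive eq) (≤-trans (+-monoʳ-≤ (16 * (ℓ * ℓ)) (ℕₚ.*-monoʳ-≤ 2 (linear≤ ℓ 1≤ℓ)))
      (≤-reflexive (≡-sym (ℕₚ.*-distribʳ-+ (ℓ * ℓ) 16 2))))) (ℕₚ.≤ᵇ⇒≤ 18 6144 tt)
    where
    open +-*-Solver
    eq : let w = ℓ + ℓ + ℓ + ℓ ; q = w + w in suc q * (ℓ + ℓ) ≡ 16 * (ℓ * ℓ) + 2 * ℓ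
    eq = solve 1 (λ ℓ → let w = ℓ :+ ℓ :+ ℓ :+ ℓ ; q = w :+ w in (con 1 :+ q) :* (ℓ :+ ℓ) := con 16 :* (ℓ :* ℓ) :+ con 2 :* ℓ) refl ℓ

theorem3p4 : (f : ℕ → ℕ) →
    (∀ ℓ → 1 ≤ ℓ → (G : Graph) → ¬ GridModel G ℓ → TwAtMost G (f ℓ)) →
    ∀ ℓ → 1 ≤ ℓ → (G : Graph) → (S : Subset (n G)) →
    ¬ OuterRootedGridModel G S ℓ →
    TwPairAtMost G S (3 * f (6144 * ℓ ^ 4) + 1)
theorem3p4 f tw ℓ@(suc k) 1≤ℓ G S unrooted = no-haven⇒pairTreeDec G S (f N) λ A →
  no-haven G S k unrooted N (f N) (tw N (≤-trans (s≤s z≤n) large)) large (band-bound ℓ 1≤ℓ) (restrict (fromGraph G) A) proj₁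
  where
  N = 6144 * ℓ ^ 4
  large = width-bound ℓ 1≤ℓ
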